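{- Let $n$ be any positive integer. Then $$r_{16}(n)=-(-1)^n\cdot\tfrac{32}{3}\left[\tilde\sigma_1(n)+\tilde\sigma_3(n)+\tilde\sigma_5(n)\right]+(-1)^n\cdot\tfrac{256}{3}\sum_{m=1}^{n-1}\left[\tilde\sigma_1(m)\tilde\sigma_5(n-m)-\tilde\sigma_3(m)\tilde\sigma_3(n-m)\right]$$ and $$r_{24}(n)=(-1)^n\cdot\tfrac{16}{9}\left[17\,\sigma_3^{\dagger}(n)+8\,\sigma_5^{\dagger}(n)+2\,\sigma_7^{\dagger}(n)\right]+(-1)^n\cdot\tfrac{512}{9}\sum_{m=1}^{n-1}\left[\sigma_3^{\dagger}(m)\sigma_7^{\dagger}(n-m)-\sigma_5^{\dagger}(m)\sigma_5^{\dagger}(n-m)\right].$$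
   Context: $r_s(n)$ denotes the number of integer solutions $(x_1,\dots,x_s)\in\mathbb Z^s$ of $x_1^2+\cdots+x_s^2=n$ (changing the sign or the order of the $x_i$ gives distinct solutions). For positive integers $r,n$, $$\tilde\sigma_r(n):=\sum_{d\mid n,\,d>0}(-1)^{d+n/d}d^r,\qquad \sigma_r^{\dagger}(n):=\sum_{d\mid n,\,d>0}(-1)^{d}d^r.$$ -}

module Defs where

open import Data.Fin.Base using (Fin; zero; suc)
open import Data.Integer.Base as ℤ using (ℤ; +_; -[1+_]; 0ℤ; -1ℤ; ∣_∣)
import Data.Integer.Properties as ℤ
open import Data.List.Base as List
  using (List; []; _∷_; _++_; map; filter; upTo; length; cartesianProductWith)
open import Data.List.Membership.Propositional using (_∈_)
open import Data.List.Membership.Propositional.Properties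
open import Data.List.Relation.Unary.All as ListAll using ()
open import Data.List.Relation.Unary.AllPairs using ([]; _∷_)
open import Data.List.Relation.Unary.Any as Any using (here)
open import Data.List.Relation.Unary.Any.Properties using (lookup-index)
open import Data.List.Relation.Unary.Unique.Propositional using (Unique)
import Data.List.Relation.Unary.Unique.Propositional.Properties as Unique
open import Data.Nat.Base as ℕ using (ℕ; zero; suc; NonZero; _∸_; s≤s; z≤n)
open import Data.Nat.Divisibility using (_∣?_)
open import Data.Nat.DivMod using (_/_)
import Data.Nat.Properties as ℕ
open import Data.Product.Base using (Σ-syntax; ∃-syntax; _×_; _,_; proj₁; proj₂)
open import Data.Vec.Base as Vec using (Vec; []; _∷_)
open import Data.Vec.Properties using (∷-injective)
open import Data.Vec.Relation.Unary.All as VecAll using ([]; _∷_)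
open import Function.Bundles using (_↔_; mk↔ₛ′)
open import Relation.Binary.PropositionalEquality
open import Relation.Nullary.Negation using (contradiction)
open import Axiom.UniquenessOfIdentityProofs using (module Decidable⇒UIP)

sumOfSquares : ∀ {s} → Vec ℤ s → ℤ
sumOfSquares = Vec.foldr′ (λ x acc → x ℤ.^ 2 ℤ.+ acc) 0ℤ

-- The integers x with ∣ x ∣ ≤ n.
interval : ℕ → List ℤ
interval n = map -[1+_] (upTo n) ++ map +_ (upTo (suc n))

box : ∀ s → ℕ → List (Vec ℤ s)
box zero    n = [] ∷ []
box (suc s) n = cartesianProductWith _∷_ (interval n) (box s n)

-- Restricting to the box loses no solution, since x₁² + ⋯ + xₛ² = n forces
-- ∣ xᵢ ∣ ≤ n.  That r s n is the cardinality of the set of all solutions in ℤˢ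
-- is r-counts below.
solutions : ∀ s → ℕ → List (Vec ℤ s)
solutions s n = filter (λ x → sumOfSquares x ℤ.≟ + n) (box s n)

r : ℕ → ℕ → ℕ
r s n = length (solutions s n)

sumℤ : List ℤ → ℤ
sumℤ = List.foldr ℤ._+_ 0ℤ

-- Divisors are enumerated as suc i with i < n, so that each d is visibly NonZero.
-- Only n ≥ 1 is meaningful: at n = 0 the sum is empty.
∑∣ : ℕ → ((d : ℕ) .{{_ : NonZero d}} → ℤ) → ℤ
∑∣ n f = sumℤ (map (λ i → f (suc i)) (filter (λ i → suc i ∣? n) (upTo n)))

syntax ∑∣ n (λ d → e) = ∑[ d ∣ n ] e

-- The indices 1 , … , n − 1 are enumerated as suc i with i < n ∸ 1.
∑< : ℕ → (ℕ → ℤ) → ℤ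
∑< n f = sumℤ (map (λ i → f (suc i)) (upTo (n ∸ 1)))

syntax ∑< n (λ m → e) = ∑[1≤ m < n ] e

σ̃ : ℕ → ℕ → ℤ
σ̃ k n = ∑[ d ∣ n ] (-1ℤ ℤ.^ (d ℕ.+ n / d) ℤ.* (+ d) ℤ.^ k)

σ† : ℕ → ℕ → ℤ
σ† k n = ∑[ d ∣ n ] (-1ℤ ℤ.^ d ℤ.* (+ d) ℤ.^ k)

private

  square : ∀ x → x ℤ.^ 2 ≡ + (∣ x ∣ ℕ.* ∣ x ∣)
  square x = trans (cong (x ℤ.*_) (ℤ.*-identityʳ x)) (lemma x)
    where
    lemma : ∀ x → x ℤ.* x ≡ + (∣ x ∣ ℕ.* ∣ x ∣)
    lemma (+ n)      = sym (ℤ.pos-* n n)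
    lemma (-[1+ n ]) = refl

  n≤n*n : ∀ n → n ℕ.≤ n ℕ.* n
  n≤n*n zero    = z≤n
  n≤n*n (suc n) = ℕ.m≤m*n (suc n) (suc n)

  sumOfSquares-bound : ∀ {s} (x : Vec ℤ s) →
    ∃[ k ] sumOfSquares x ≡ + k × VecAll.All (λ y → ∣ y ∣ ℕ.≤ k) x
  sumOfSquares-bound []      = 0 , refl , []
  sumOfSquares-bound (y ∷ x) with sumOfSquares-bound x
  ... | k , eq , bounds =
    y² ℕ.+ k , cong₂ ℤ._+_ (square y) eq ,
    ℕ.≤-trans (n≤n*n ∣ y ∣) (ℕ.m≤m+n y² k) ∷
    VecAll.map (λ z≤k → ℕ.≤-trans z≤k (ℕ.m≤n+m k y²)) bounds
    where
    y² : ℕ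
    y² = ∣ y ∣ ℕ.* ∣ y ∣

  ∈-interval : ∀ {n} x → ∣ x ∣ ℕ.≤ n → x ∈ interval n
  ∈-interval {n} (+ k)      k≤n =
    ∈-++⁺ʳ (map -[1+_] (upTo n)) (∈-map⁺ +_ (∈-upTo⁺ (s≤s k≤n)))
  ∈-interval     (-[1+ k ]) k<n = ∈-++⁺ˡ (∈-map⁺ -[1+_] (∈-upTo⁺ k<n))

  ∈-box : ∀ {s n} {x : Vec ℤ s} → VecAll.All (λ y → ∣ y ∣ ℕ.≤ n) x → x ∈ box s n
  ∈-box []       = here refl
  ∈-box (p ∷ ps) = ∈-cartesianProductWith⁺ _∷_ (∈-interval _ p) (∈-box ps)

  interval-unique : ∀ n → Unique (interval n)
  interval-unique n = Unique.++⁺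
    (Unique.map⁺ ℤ.-[1+-injective (Unique.upTo⁺ n))
    (Unique.map⁺ ℤ.+-injective (Unique.upTo⁺ (suc n)))
    λ { (x∈₁ , x∈₂) → disjoint (∈-map⁻ -[1+_] x∈₁) (∈-map⁻ +_ x∈₂) }
    where
    disjoint : ∀ {A : Set} {x} →
      ∃[ i ] i ∈ upTo n × x ≡ -[1+ i ] → ∃[ j ] j ∈ upTo (suc n) × x ≡ + j → A
    disjoint (_ , _ , refl) (_ , _ , ())

  box-unique : ∀ s n → Unique (box s n)
  box-unique zero    n = ListAll.[] ∷ []
  box-unique (suc s) n =
    Unique.cartesianProductWith⁺ _∷_ ∷-injective (interval-unique n) (box-unique s n)

  lookup-injective : ∀ {A : Set} {xs : List A} → Unique xs →
    ∀ i j → List.lookup xs i ≡ List.lookup xs j → i ≡ j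
  lookup-injective (_ ∷ _)  zero    zero    _  = refl
  lookup-injective (p ∷ _)  zero    (suc j) eq =
    contradiction eq (ListAll.lookup p (∈-lookup j))
  lookup-injective (p ∷ _)  (suc i) zero    eq =
    contradiction (sym eq) (ListAll.lookup p (∈-lookup i))
  lookup-injective (_ ∷ ps) (suc i) (suc j) eq = cong suc (lookup-injective ps i j eq)

  solutions-complete : ∀ s n (x : Vec ℤ s) → sumOfSquares x ≡ + n → x ∈ solutions s n
  solutions-complete s n x eq with sumOfSquares-bound x
  ... | k , eq′ , bounds with ℤ.+-injective (trans (sym eq′) eq)
  ... | refl = ∈-filter⁺ (λ x → sumOfSquares x ℤ.≟ + n) (∈-box bounds) eq

r-counts : ∀ s n → Fin (r s n) ↔ (Σ[ x ∈ Vec ℤ s ] sumOfSquares x ≡ + n)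
r-counts s n = mk↔ₛ′ to from to∘from from∘to
  where
  Solution : Set
  Solution = Σ[ x ∈ Vec ℤ s ] sumOfSquares x ≡ + n

  to : Fin (r s n) → Solution
  to i = List.lookup (solutions s n) i ,
    proj₂ (∈-filter⁻ (λ x → sumOfSquares x ℤ.≟ + n) {xs = box s n} (∈-lookup i))

  from : Solution → Fin (r s n)
  from (x , eq) = Any.index (solutions-complete s n x eq)

  ext : {x y : Solution} → proj₁ x ≡ proj₁ y → x ≡ y
  ext {x , p} {_ , q} refl = cong (x ,_) (Decidable⇒UIP.≡-irrelevant ℤ._≟_ p q)

  to∘from : ∀ x → to (from x) ≡ x
  to∘from (x , eq) = ext (sym (lookup-index (solutions-complete s n x eq)))

  from∘to : ∀ i → from (to i) ≡ i
  from∘to i = lookup-injective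
    (Unique.filter⁺ (λ x → sumOfSquares x ℤ.≟ + n) (box-unique s n)) _ _
    (cong proj₁ (to∘from (to i)))

{-# OPTIONS --safe #-}

-- Let θ = Σ (-1)^k q^(k²), so that θ^s has coefficients (-1)^n r_s(n), and let D = q d/dq.
-- With U_k = Σ σ̃_k(n) q^n, W_k = Σ σ†_k(n) q^n, O = Σ (1 - (-1)^a) a q^(ax) and
-- P = Σ (1 - (-1)^x) a q^(ax), the last two over a, x ≥ 1, put
--   v₁ = -1 + 8 U₁,  v₃ = 1 + 16 U₃,  v₅ = -1 + 8 U₅,  ε = 1 + 12 O,
--   w₃ = 1 + 16 W₃,  w₅ = 1 - 8 W₅,  w₇ = 17 + 32 W₇.
-- These satisfy the quadratic relations
--   w₃ = v₁²,  v₃ = -ε v₁,  4 v₅ = -ε v₃ + 3 v₁ w₃,  w₅ = ε w₃,  w₇ = 8 ε w₅ + 9 w₃²,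
-- whence 4 v₁ v₅ - v₃² = 3 v₁⁴ and w₃ w₇ - 8 w₅² = 9 w₃³ = 9 v₁⁶.  Moreover θ⁴ and -v₁ solve the
-- same equation D f = -4 P f with the same constant term, so θ⁴ = -v₁, and the theorem follows by
-- comparing coefficients.
--
-- The quadratic relations and the equation for v₁ are convolution identities, obtained as in
-- Skoruppa's proof of the Eisenstein series identities from the bijection
-- (a,b,x,y) ↦ (a+b,b,x,y-x) between the solutions of ax + by = n with x < y and those with a > b.
-- The equation D θ = -P θ comes from involutions on the solutions of ax + k² = n, that is, on the
-- binary quadratic forms (a, 2k, -x) of discriminant 4n.
module Submission where

open import Defs
open import Algebra.Bundles using (CommutativeRing)
import Algebra.Solver.Ring as RingSolver
open import Algebra.Solver.Ring.AlmostCommutativeRing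
  using (fromCommutativeRing; _-Raw-AlmostCommutative⟶_)
open import Algebra.Structures using (IsCommutativeRing)
open import Axiom.UniquenessOfIdentityProofs.WithK using (uip)
open import Data.Fin.Base as Fin using (Fin; zero; suc)
open import Data.Integer.Base as ℤ
  using (ℤ; +_; -[1+_]; 0ℤ; 1ℤ; -1ℤ; ∣_∣; +<+; +≤+)
import Data.Integer.Properties as ℤ
open import Data.Integer.Tactic.RingSolver using (solve-∀; ring)
open import Data.List.Base
  using (List; []; _∷_; _++_; map; filter; upTo; applyUpTo; allFin; length)
open import Data.List.Membership.Propositional using (_∈_)
open import Data.List.Membership.Propositional.Properties
open import Data.List.Membership.Propositional.Properties.WithK using (unique∧set⇒bag)
open import Data.List.Properties using (map-upTo; map-∘; map-++; length-tabulate; length-map)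
open import Data.List.Relation.Binary.BagAndSetEquality using (∼bag⇒↭)
open import Data.List.Relation.Binary.Permutation.Propositional as ↭ using (_↭_)
open import Data.List.Relation.Binary.Permutation.Propositional.Properties
  using () renaming (map⁺ to ↭-map⁺)
open import Data.List.Relation.Unary.All as All using ([]; _∷_)
import Data.List.Relation.Unary.All.Properties as All
open import Data.List.Relation.Unary.AllPairs using ([]; _∷_)
open import Data.List.Relation.Unary.Any using (here; there)
open import Data.List.Relation.Unary.Unique.Propositional using (Unique)
import Data.List.Relation.Unary.Unique.Propositional.Properties as Unique
open import Data.Maybe.Base using (Maybe; just; nothing)
open import Data.Nat.Base as ℕ using (ℕ; zero; suc; NonZero; _∸_; z<s; s≤s; z≤n)
open import Data.Nat.Divisibility using (_∣_; _∣?_; m∣m*n; ∣⇒≤)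
open import Data.Nat.DivMod using (m*n/n≡m; m/n*n≡m; m≥n⇒m/n>0)
open import Data.Nat.Induction using (<-rec)
import Data.Nat.Properties as ℕ
open import Data.Product.Base using (Σ; ∃-syntax; _×_; _,_; proj₁; proj₂; swap)
open import Data.Rational.Base as ℚ using (ℚ; _/_)
open import Data.Rational.Literals using (fromℤ)
import Data.Rational.Properties as ℚ
open import Data.Rational.Unnormalised.Base as ℚᵘ using (mkℚᵘ; *≡*)
import Data.Rational.Unnormalised.Properties as ℚᵘ
open import Data.Sum.Base using (inj₁; inj₂; _⊎_)
open import Data.Vec.Base as Vec using (Vec; []; _∷_; tabulate)
open import Data.Vec.N-ary using (N-ary; _$ⁿ_)
open import Data.Vec.Properties using (lookup-map)
open import Function.Base using (_∘_; id; _⟨_⟩_)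
open import Function.Bundles using (mk⇔; module Inverse)
open import Relation.Binary.PropositionalEquality hiding ([_])
import Relation.Binary.Reasoning.Setoid as SetoidReasoning
open import Relation.Binary.Structures using (IsEquivalence)
open import Relation.Nullary.Decidable using (yes; no; ¬?)
open import Relation.Unary using (Decidable)
import Tactic.RingSolver.Core.Polynomial.Semantics as Semantics
import Tactic.RingSolver.NonReflective ring as Solver
open import Algebra.Properties.Semiring.Exp.TCOptimised ℤ.+-*-semiring using (^-congˡ)

-- In terms of modular forms, `ε` is 2 E₂(2τ) - E₂(τ), and the quadratic relations are identities
-- between forms on Γ₀(4). Here they come from finite bijections instead, which evaluate particular
-- combinations of products of Lambert series. `ε` occurs in neither formula of the theorem: it
-- links the other series through such products and cancels at the end, since 4 v₁ v₅ and v₃² share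
-- the part ε² v₁², while w₃ w₇ and 8 w₅² share 8 ε² w₃². The series P equals (E₂(2τ) - E₂(τ)) / 12.
-- It is only quasimodular, but it has no constant term, so D f = -4 P f determines every
-- coefficient of f from the constant one. The equation D θ = -P θ is the logarithmic derivative of
-- Gauss's product θ = Π (1 - q^n) / (1 + q^n), reached here without infinite products.

+-congˡ : ∀ a {b c} → b ≡ c → a ℤ.+ b ≡ a ℤ.+ c
+-congˡ a = cong (λ z → a ℤ.+ z)

-- Formal power series

Series : Set
Series = ℕ → ℤ

infix 4 _≐_
_≐_ : Series → Series → Set
f ≐ g = ∀ n → f n ≡ g n

infixl 6 _⊞_
infixl 7 _⋆_

_⊞_ : Series → Series → Series
(f ⊞ g) n = f n ℤ.+ g n

⊟_ : Series → Series
(⊟ f) n = ℤ.- f n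

scale : ℤ → Series → Series
scale c f n = c ℤ.* f n

-- The Cauchy product, by f = f₀ + q f′ with f′ = f ∘ suc.
_⋆_ : Series → Series → Series
(f ⋆ g) zero    = f 0 ℤ.* g 0
(f ⋆ g) (suc n) = f 0 ℤ.* g (suc n) ℤ.+ (f ∘ suc ⋆ g) n

const : ℤ → Series
const c zero    = c
const c (suc n) = 0ℤ

∂ : Series → Series
∂ f n = + n ℤ.* f n

twist : Series → Series
twist f n = -1ℤ ℤ.^ n ℤ.* f n

⋆-cong : ∀ {f f′ g g′} → f ≐ f′ → g ≐ g′ → f ⋆ g ≐ f′ ⋆ g′
⋆-cong p q zero    = cong₂ ℤ._*_ (p 0) (q 0)
⋆-cong p q (suc n) =
  cong₂ ℤ._+_ (cong₂ ℤ._*_ (p 0) (q (suc n))) (⋆-cong (p ∘ suc) q n)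

-- The definition of `⋆` peels off the left factor only; with the mirror-image recursion,
-- commutativity becomes an induction.
⋆-unfoldʳ : ∀ f g n → (f ⋆ g) (suc n) ≡ f (suc n) ℤ.* g 0 ℤ.+ (f ⋆ g ∘ suc) n
⋆-unfoldʳ f g zero    = ℤ.+-comm (f 0 ℤ.* g 1) (f 1 ℤ.* g 0)
⋆-unfoldʳ f g (suc n) = trans
  (+-congˡ (f 0 ℤ.* g (suc (suc n))) (⋆-unfoldʳ (f ∘ suc) g n))
  (lemma (f 0 ℤ.* g (suc (suc n))) (f (suc (suc n)) ℤ.* g 0) ((f ∘ suc ⋆ g ∘ suc) n))
  where
  lemma : ∀ a b c → a ℤ.+ (b ℤ.+ c) ≡ b ℤ.+ (a ℤ.+ c)
  lemma = solve-∀

⋆-comm : ∀ f g → f ⋆ g ≐ g ⋆ f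
⋆-comm f g zero    = ℤ.*-comm (f 0) (g 0)
⋆-comm f g (suc n) = trans
  (cong₂ ℤ._+_ (ℤ.*-comm (f 0) (g (suc n))) (⋆-comm (f ∘ suc) g n))
  (sym (⋆-unfoldʳ g f n))

⋆-distribʳ-⊞ : ∀ h f g → (f ⊞ g) ⋆ h ≐ f ⋆ h ⊞ g ⋆ h
⋆-distribʳ-⊞ h f g zero    = ℤ.*-distribʳ-+ (h 0) (f 0) (g 0)
⋆-distribʳ-⊞ h f g (suc n) = trans
  (+-congˡ ((f 0 ℤ.+ g 0) ℤ.* h (suc n)) (⋆-distribʳ-⊞ h (f ∘ suc) (g ∘ suc) n))
  (lemma (f 0) (g 0) (h (suc n)) ((f ∘ suc ⋆ h) n) ((g ∘ suc ⋆ h) n))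
  where
  lemma : ∀ a b c x y →
    (a ℤ.+ b) ℤ.* c ℤ.+ (x ℤ.+ y) ≡ (a ℤ.* c ℤ.+ x) ℤ.+ (b ℤ.* c ℤ.+ y)
  lemma = solve-∀

⋆-distribˡ-⊞ : ∀ h f g → h ⋆ (f ⊞ g) ≐ h ⋆ f ⊞ h ⋆ g
⋆-distribˡ-⊞ h f g n = trans (⋆-comm h (f ⊞ g) n) (trans (⋆-distribʳ-⊞ h f g n)
  (cong₂ ℤ._+_ (⋆-comm f h n) (⋆-comm g h n)))

scale-⋆ : ∀ c f g → scale c f ⋆ g ≐ scale c (f ⋆ g)
scale-⋆ c f g zero    = ℤ.*-assoc c (f 0) (g 0)
scale-⋆ c f g (suc n) = trans
  (+-congˡ (c ℤ.* f 0 ℤ.* g (suc n)) (scale-⋆ c (f ∘ suc) g n))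
  (lemma c (f 0) (g (suc n)) ((f ∘ suc ⋆ g) n))
  where
  lemma : ∀ c a b x → c ℤ.* a ℤ.* b ℤ.+ c ℤ.* x ≡ c ℤ.* (a ℤ.* b ℤ.+ x)
  lemma = solve-∀

⋆-assoc : ∀ f g h → (f ⋆ g) ⋆ h ≐ f ⋆ (g ⋆ h)
⋆-assoc f g h zero    = ℤ.*-assoc (f 0) (g 0) (h 0)
⋆-assoc f g h (suc n) = begin
  f 0 ℤ.* g 0 ℤ.* h (suc n) ℤ.+ ((scale (f 0) (g ∘ suc) ⊞ (f ∘ suc ⋆ g)) ⋆ h) n
    ≡⟨ +-congˡ (f 0 ℤ.* g 0 ℤ.* h (suc n))
         (⋆-distribʳ-⊞ h (scale (f 0) (g ∘ suc)) (f ∘ suc ⋆ g) n) ⟩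
  f 0 ℤ.* g 0 ℤ.* h (suc n) ℤ.+
    ((scale (f 0) (g ∘ suc) ⋆ h) n ℤ.+ ((f ∘ suc ⋆ g) ⋆ h) n)
    ≡⟨ +-congˡ (f 0 ℤ.* g 0 ℤ.* h (suc n))
         (cong₂ ℤ._+_ (scale-⋆ (f 0) (g ∘ suc) h n) (⋆-assoc (f ∘ suc) g h n)) ⟩
  f 0 ℤ.* g 0 ℤ.* h (suc n) ℤ.+
    (f 0 ℤ.* (g ∘ suc ⋆ h) n ℤ.+ (f ∘ suc ⋆ (g ⋆ h)) n)
    ≡⟨ lemma (f 0) (g 0) (h (suc n)) _ _ ⟩
  f 0 ℤ.* (g ⋆ h) (suc n) ℤ.+ (f ∘ suc ⋆ (g ⋆ h)) n ∎
  where
  open ≡-Reasoning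
  lemma : ∀ a b c x y →
    a ℤ.* b ℤ.* c ℤ.+ (a ℤ.* x ℤ.+ y) ≡ a ℤ.* (b ℤ.* c ℤ.+ x) ℤ.+ y
  lemma = solve-∀

0-⋆ : ∀ f → (λ _ → 0ℤ) ⋆ f ≐ λ _ → 0ℤ
0-⋆ f zero    = refl
0-⋆ f (suc n) = trans (ℤ.+-identityˡ _) (0-⋆ f n)

const-⋆ : ∀ c f → const c ⋆ f ≐ scale c f
const-⋆ c f zero    = refl
const-⋆ c f (suc n) =
  trans (+-congˡ (c ℤ.* f (suc n)) (0-⋆ f n)) (ℤ.+-identityʳ _)

⋆-identityˡ : ∀ f → const 1ℤ ⋆ f ≐ f
⋆-identityˡ f n = trans (const-⋆ 1ℤ f n) (ℤ.*-identityˡ (f n))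

≐-isEquivalence : IsEquivalence _≐_
≐-isEquivalence = record
  { refl  = λ _ → refl
  ; sym   = λ p n → sym (p n)
  ; trans = λ p q n → trans (p n) (q n)
  }

const-0 : ∀ n → 0ℤ ≡ const 0ℤ n
const-0 zero    = refl
const-0 (suc n) = refl

series-isCommutativeRing : IsCommutativeRing _≐_ _⊞_ _⋆_ ⊟_ (const 0ℤ) (const 1ℤ)
series-isCommutativeRing = record
  { isRing = record
    { +-isAbelianGroup = record
      { isGroup = record
        { isMonoid = record
          { isSemigroup = record
            { isMagma = record
              { isEquivalence = ≐-isEquivalence
              ; ∙-cong        = λ p q n → cong₂ ℤ._+_ (p n) (q n)
              }
            ; assoc = λ f g h n → ℤ.+-assoc (f n) (g n) (h n)
            }
          ; identity =
              (λ f n → trans (cong (ℤ._+ f n) (sym (const-0 n))) (ℤ.+-identityˡ (f n))) ,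
              (λ f n → trans (+-congˡ (f n) (sym (const-0 n))) (ℤ.+-identityʳ (f n)))
          }
        ; inverse =
            (λ f n → trans (ℤ.+-inverseˡ (f n)) (const-0 n)) ,
            (λ f n → trans (ℤ.+-inverseʳ (f n)) (const-0 n))
        ; ⁻¹-cong = λ p n → cong ℤ.-_ (p n)
        }
      ; comm = λ f g n → ℤ.+-comm (f n) (g n)
      }
    ; *-cong     = ⋆-cong
    ; *-assoc    = ⋆-assoc
    ; *-identity = ⋆-identityˡ , λ f n → trans (⋆-comm f (const 1ℤ) n) (⋆-identityˡ f n)
    ; distrib    = ⋆-distribˡ-⊞ , ⋆-distribʳ-⊞
    }
  ; *-comm = ⋆-comm
  }

seriesRing : CommutativeRing _ _
seriesRing = record { isCommutativeRing = series-isCommutativeRing }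

-- The coefficients of the solver are integers embedded by `const`, so numerical constants are
-- evaluated during normalisation instead of being treated as atoms.
module SeriesSolver where
  constants : ℤ.+-*-rawRing -Raw-AlmostCommutative⟶ fromCommutativeRing seriesRing
  constants = record
    { ⟦_⟧    = const
    ; +-homo = λ { a b zero → refl ; a b (suc n) → refl }
    ; *-homo = λ { a b zero → refl ; a b (suc n) →
        sym (trans (const-⋆ a (const b) (suc n)) (ℤ.*-zeroʳ a)) }
    ; -‿homo = λ { a zero → refl ; a (suc n) → refl }
    ; 0-homo = λ _ → refl
    ; 1-homo = λ _ → refl
    }

  constants≟ : ∀ a b → Maybe (const a ≐ const b)
  constants≟ a b with a ℤ.≟ b
  ... | yes refl = just (λ _ → refl)
  ... | no  _    = nothing

  open RingSolver ℤ.+-*-rawRing (fromCommutativeRing seriesRing) constants constants≟ public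

-- The derivation q d/dq and the substitution of -q for q

∂-⋆ : ∀ f g → ∂ (f ⋆ g) ≐ ∂ f ⋆ g ⊞ f ⋆ ∂ g
∂-⋆ f g zero    = sym (cong₂ ℤ._+_ (ℤ.*-zeroˡ (g 0)) (ℤ.*-zeroʳ (f 0)))
∂-⋆ f g (suc n) = begin
  + suc n ℤ.* (f 0 ℤ.* g (suc n) ℤ.+ (f′ ⋆ g) n)
    ≡⟨ lemma₁ (+ n) (f 0) (g (suc n)) ((f′ ⋆ g) n) ⟩
  f 0 ℤ.* ∂ g (suc n) ℤ.+ ∂ (f′ ⋆ g) n ℤ.+ (f′ ⋆ g) n
    ≡⟨ cong (λ z → f 0 ℤ.* ∂ g (suc n) ℤ.+ z ℤ.+ (f′ ⋆ g) n) (∂-⋆ f′ g n) ⟩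
  f 0 ℤ.* ∂ g (suc n) ℤ.+ ((∂ f′ ⋆ g) n ℤ.+ (f′ ⋆ ∂ g) n) ℤ.+ (f′ ⋆ g) n
    ≡⟨ lemma₂ (f 0 ℤ.* ∂ g (suc n)) _ _ _ ⟩
  ((f′ ⋆ g) n ℤ.+ (∂ f′ ⋆ g) n) ℤ.+ (f 0 ℤ.* ∂ g (suc n) ℤ.+ (f′ ⋆ ∂ g) n)
    ≡⟨ cong (ℤ._+ (f ⋆ ∂ g) (suc n)) unfold ⟩
  (∂ f ⋆ g) (suc n) ℤ.+ (f ⋆ ∂ g) (suc n) ∎
  where
  open ≡-Reasoning
  f′ = f ∘ suc
  lemma₁ : ∀ n a b x →
    (1ℤ ℤ.+ n) ℤ.* (a ℤ.* b ℤ.+ x) ≡ a ℤ.* ((1ℤ ℤ.+ n) ℤ.* b) ℤ.+ n ℤ.* x ℤ.+ x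
  lemma₁ = solve-∀
  lemma₂ : ∀ a b c d → a ℤ.+ (b ℤ.+ c) ℤ.+ d ≡ (d ℤ.+ b) ℤ.+ (a ℤ.+ c)
  lemma₂ = solve-∀
  lemma₃ : ∀ k y → y ℤ.+ k ℤ.* y ≡ (1ℤ ℤ.+ k) ℤ.* y
  lemma₃ = solve-∀
  unfold : (f′ ⋆ g) n ℤ.+ (∂ f′ ⋆ g) n ≡ (∂ f ⋆ g) (suc n)
  -- `∂ f` vanishes at 0, and since the index moves by one its shift is `f′ ⊞ ∂ f′`.
  unfold = sym (trans (cong (ℤ._+ (∂ f ∘ suc ⋆ g) n) (ℤ.*-zeroˡ (g (suc n))))
    (trans (ℤ.+-identityˡ _) (trans
      (⋆-cong {g = g} (λ k → sym (lemma₃ (+ k) (f′ k))) (λ _ → refl) n)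
      (⋆-distribʳ-⊞ g f′ (∂ f′) n))))

⋆-vanish : ∀ f g n → f 0 ≡ 0ℤ → (∀ k → k ℕ.< n → g k ≡ 0ℤ) → (f ⋆ g) n ≡ 0ℤ
⋆-vanish f g zero    f₀ _ = trans (cong (ℤ._* g 0) f₀) (ℤ.*-zeroˡ (g 0))
⋆-vanish f g (suc n) f₀ p = trans (⋆-unfoldʳ f g n) (cong₂ ℤ._+_
  (trans (cong (f (suc n) ℤ.*_) (p 0 ℕ.z<s)) (ℤ.*-zeroʳ (f (suc n))))
  (⋆-vanish f (g ∘ suc) n f₀ (λ k k<n → p (suc k) (ℕ.s<s k<n))))

-- Because `f 0` vanishes, the coefficient of `f ⋆ h` at n involves only `h k` with k < n. Strong
-- induction makes it zero, and the factor n ≥ 1 on the left can be cancelled.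
∂-unique-0 : ∀ f h → f 0 ≡ 0ℤ → h 0 ≡ 0ℤ → ∂ h ≐ f ⋆ h → h ≐ λ _ → 0ℤ
∂-unique-0 f h f₀ h₀ ode = <-rec _ step
  where
  step : ∀ n → (∀ {k} → k ℕ.< n → h k ≡ 0ℤ) → h n ≡ 0ℤ
  step zero    _   = h₀
  step (suc n) rec = ℤ.*-cancelˡ-≡ (+ suc n) (h (suc n)) 0ℤ
    (trans (trans (ode (suc n)) (⋆-vanish f h (suc n) f₀ (λ _ → rec)))
      (sym (ℤ.*-zeroʳ (+ suc n))))

∂-unique : ∀ f g h → f 0 ≡ 0ℤ → g 0 ≡ h 0 → ∂ g ≐ f ⋆ g → ∂ h ≐ f ⋆ h → g ≐ h
∂-unique f g h f₀ g₀ odeᵍ odeʰ n = ℤ.i-j≡0⇒i≡j (g n) (h n)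
  (∂-unique-0 f (g ⊞ ⊟ h) f₀ (ℤ.i≡j⇒i-j≡0 g₀) ode n)
  where
  lemma : ∀ k a b → k ℤ.* (a ℤ.- b) ≡ k ℤ.* a ℤ.- k ℤ.* b
  lemma = solve-∀
  open SeriesSolver
  ode : ∂ (g ⊞ ⊟ h) ≐ f ⋆ (g ⊞ ⊟ h)
  ode n = trans (lemma (+ n) (g n) (h n)) (trans
    (cong₂ ℤ._-_ (odeᵍ n) (odeʰ n))
    (solve 3 (λ f g h → f :* g :- f :* h := f :* (g :- h)) (λ _ → refl) f g h n))

twist-suc : ∀ f → twist f ∘ suc ≐ scale -1ℤ (twist (f ∘ suc))
twist-suc f n = ℤ.*-assoc -1ℤ (-1ℤ ℤ.^ n) (f (suc n))

-- Substituting -q for q is a ring homomorphism.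
twist-⋆ : ∀ f g → twist (f ⋆ g) ≐ twist f ⋆ twist g
twist-⋆ f g zero    = lemma (f 0) (g 0)
  where
  lemma : ∀ a b → 1ℤ ℤ.* (a ℤ.* b) ≡ (1ℤ ℤ.* a) ℤ.* (1ℤ ℤ.* b)
  lemma = solve-∀
twist-⋆ f g (suc n) = begin
  -1ℤ ℤ.^ suc n ℤ.* (f 0 ℤ.* g (suc n) ℤ.+ (f ∘ suc ⋆ g) n)
    ≡⟨ lemma (-1ℤ ℤ.^ n) (f 0) (g (suc n)) _ ⟩
  twist f 0 ℤ.* twist g (suc n) ℤ.+ -1ℤ ℤ.* twist (f ∘ suc ⋆ g) n
    ≡⟨ cong (λ z → twist f 0 ℤ.* twist g (suc n) ℤ.+ -1ℤ ℤ.* z) (twist-⋆ (f ∘ suc) g n) ⟩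
  twist f 0 ℤ.* twist g (suc n) ℤ.+ -1ℤ ℤ.* (twist (f ∘ suc) ⋆ twist g) n
    ≡⟨ +-congˡ (twist f 0 ℤ.* twist g (suc n))
         (trans (sym (scale-⋆ -1ℤ (twist (f ∘ suc)) (twist g) n))
           (⋆-cong {g = twist g} (λ k → sym (twist-suc f k)) (λ _ → refl) n)) ⟩
  (twist f ⋆ twist g) (suc n) ∎
  where
  open ≡-Reasoning
  lemma : ∀ s a b x → -1ℤ ℤ.* s ℤ.* (a ℤ.* b ℤ.+ x) ≡
    1ℤ ℤ.* a ℤ.* (-1ℤ ℤ.* s ℤ.* b) ℤ.+ -1ℤ ℤ.* (s ℤ.* x)
  lemma = solve-∀

-- Sums over finite predicates

-- The list is only a witness of finiteness: by `∑-bij`, sums depend on the predicate alone, so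
-- lists built in different ways can be compared.
record Enum {A : Set} (P : A → Set) : Set where
  field
    list     : List A
    unique   : Unique list
    sound    : ∀ {x} → x ∈ list → P x
    complete : ∀ {x} → P x → x ∈ list
open Enum

-- The maps are total on the ambient types and inverse to each other only on P and Q, so the
-- elements summed over carry no proofs.
record _≅_ {A B : Set} (P : A → Set) (Q : B → Set) : Set where
  field
    to       : A → B
    from     : B → A
    to-∈     : ∀ {x} → P x → Q (to x)
    from-∈   : ∀ {y} → Q y → P (from y)
    from∘to  : ∀ {x} → P x → from (to x) ≡ x
    to∘from  : ∀ {y} → Q y → to (from y) ≡ y
open _≅_

∑ : ∀ {A : Set} {P : A → Set} → Enum P → (A → ℤ) → ℤ
∑ E F = sumℤ (map F (list E))

private
  variable
    A B : Set
    P : A → Set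
    Q : B → Set

sumℤ-map-cong : ∀ {F G : A → ℤ} xs → (∀ {x} → x ∈ xs → F x ≡ G x) →
  sumℤ (map F xs) ≡ sumℤ (map G xs)
sumℤ-map-cong []       eq = refl
sumℤ-map-cong (x ∷ xs) eq = cong₂ ℤ._+_ (eq (here refl)) (sumℤ-map-cong xs (eq ∘ there))

sumℤ-++ : ∀ xs ys → sumℤ (xs ++ ys) ≡ sumℤ xs ℤ.+ sumℤ ys
sumℤ-++ []       ys = sym (ℤ.+-identityˡ _)
sumℤ-++ (x ∷ xs) ys = trans (+-congˡ x (sumℤ-++ xs ys)) (sym (ℤ.+-assoc x _ _))

sumℤ-↭ : ∀ {xs ys} → xs ↭ ys → sumℤ xs ≡ sumℤ ys
sumℤ-↭ ↭.refl         = refl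
sumℤ-↭ (↭.prep x p)   = +-congˡ x (sumℤ-↭ p)
sumℤ-↭ (↭.swap {xs} {ys} x y p) = trans
  (+-congˡ x (+-congˡ y (sumℤ-↭ p))) (lemma x y (sumℤ ys))
  where
  lemma : ∀ a b c → a ℤ.+ (b ℤ.+ c) ≡ b ℤ.+ (a ℤ.+ c)
  lemma = solve-∀
sumℤ-↭ (↭.trans p q)  = trans (sumℤ-↭ p) (sumℤ-↭ q)

∑-cong : (E : Enum P) {F G : _ → ℤ} → (∀ {x} → P x → F x ≡ G x) → ∑ E F ≡ ∑ E G
∑-cong E eq = sumℤ-map-cong (list E) (eq ∘ sound E)

sumℤ-map-+ : (F G : A → ℤ) → ∀ xs →
  sumℤ (map (λ x → F x ℤ.+ G x) xs) ≡ sumℤ (map F xs) ℤ.+ sumℤ (map G xs)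
sumℤ-map-+ F G []       = refl
sumℤ-map-+ F G (x ∷ xs) = trans (+-congˡ (F x ℤ.+ G x) (sumℤ-map-+ F G xs)) (lemma (F x) (G x) _ _)
  where
  lemma : ∀ a b c d → (a ℤ.+ b) ℤ.+ (c ℤ.+ d) ≡ (a ℤ.+ c) ℤ.+ (b ℤ.+ d)
  lemma = solve-∀

sumℤ-map-* : ∀ c (F : A → ℤ) xs → sumℤ (map (λ x → c ℤ.* F x) xs) ≡ c ℤ.* sumℤ (map F xs)
sumℤ-map-* c F []       = sym (ℤ.*-zeroʳ c)
sumℤ-map-* c F (x ∷ xs) = trans (+-congˡ (c ℤ.* F x) (sumℤ-map-* c F xs))
    (sym (ℤ.*-distribˡ-+ c (F x) _))

sumℤ-map-- : (F G : A → ℤ) → ∀ xs →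
  sumℤ (map (λ x → F x ℤ.- G x) xs) ≡ sumℤ (map F xs) ℤ.- sumℤ (map G xs)
sumℤ-map-- F G xs = trans (sumℤ-map-+ F (λ x → ℤ.- G x) xs) (+-congˡ (sumℤ (map F xs))
  (trans (sumℤ-map-cong xs (λ {x} _ → sym (ℤ.-1*i≡-i (G x))))
  (trans (sumℤ-map-* -1ℤ G xs) (ℤ.-1*i≡-i (sumℤ (map G xs))))))

∑-+ : (E : Enum P) (F G : _ → ℤ) → ∑ E (λ x → F x ℤ.+ G x) ≡ ∑ E F ℤ.+ ∑ E G
∑-+ E F G = sumℤ-map-+ F G (list E)

∑-- : (E : Enum P) (F G : _ → ℤ) → ∑ E (λ x → F x ℤ.- G x) ≡ ∑ E F ℤ.- ∑ E G
∑-- E F G = sumℤ-map-- F G (list E)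

∑-* : ∀ c (E : Enum P) (F : _ → ℤ) → ∑ E (λ x → c ℤ.* F x) ≡ c ℤ.* ∑ E F
∑-* c E F = sumℤ-map-* c F (list E)

∑-neg : (E : Enum P) (F : _ → ℤ) → ∑ E (λ x → ℤ.- F x) ≡ ℤ.- ∑ E F
∑-neg E F = trans (∑-cong E (λ {x} _ → sym (ℤ.-1*i≡-i (F x))))
  (trans (∑-* -1ℤ E F) (ℤ.-1*i≡-i _))

map-unique : ∀ (f : A → B) {xs} → (∀ {x y} → x ∈ xs → y ∈ xs → f x ≡ f y → x ≡ y) →
  Unique xs → Unique (map f xs)
map-unique f inj []       = []
map-unique f inj (p ∷ ps) =
  All.map⁺ (All.tabulate λ y∈ eq → All.lookup p y∈ (inj (here refl) (there y∈) eq)) ∷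
  map-unique f (λ x∈ y∈ → inj (there x∈) (there y∈)) ps

infixr 5 _⟫_
_⟫_ : Enum P → P ≅ Q → Enum Q
E ⟫ b = record
  { list     = map (to b) (list E)
  ; unique   = map-unique (to b) (λ x∈ y∈ eq → trans (sym (from∘to b (sound E x∈)))
      (trans (cong (from b) eq) (from∘to b (sound E y∈)))) (unique E)
  ; sound    = λ z∈ → helper (∈-map⁻ (to b) z∈)
  ; complete = λ q → subst (_∈ map (to b) (list E)) (to∘from b q)
      (∈-map⁺ (to b) (complete E (from-∈ b q)))
  }
  where
  helper : ∀ {z} → ∃[ x ] (x ∈ list E × z ≡ to b x) → _
  helper (x , x∈ , refl) = to-∈ b (sound E x∈)

-- After transport along the bijection both lists are free of repetitions and have the same members,
-- hence are permutations of each other.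
∑-bij : (E : Enum P) (E′ : Enum Q) (b : P ≅ Q) {F : _ → ℤ} {G : _ → ℤ} →
  (∀ {x} → P x → F x ≡ G (to b x)) → ∑ E F ≡ ∑ E′ G
∑-bij E E′ b {F} {G} eq = begin
  ∑ E F                                ≡⟨ ∑-cong E eq ⟩
  sumℤ (map (G ∘ to b) (list E))       ≡⟨ cong sumℤ (map-∘ (list E)) ⟩
  sumℤ (map G (list (E ⟫ b)))
       ≡⟨ sumℤ-↭ (↭-map⁺ G (∼bag⇒↭ (unique∧set⇒bag (unique (E ⟫ b)) (unique E′)
    (mk⇔ (complete E′ ∘ sound (E ⟫ b)) (complete (E ⟫ b) ∘ sound E′))))) ⟩
  ∑ E′ G ∎
  where
  open ≡-Reasoning

refine : {P Q : A → Set} → (∀ {x} → P x → Q x) → (∀ {x} → Q x → P x) → P ≅ Q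
refine f g = record
  { to = id ; from = id ; to-∈ = f ; from-∈ = g ; from∘to = λ _ → refl ; to∘from = λ _ → refl }

infixl 6 _∣ᴱ_
_∣ᴱ_ : {P Q : A → Set} → Enum P → Decidable Q → Enum (λ x → P x × Q x)
E ∣ᴱ Q? = record
  { list     = filter Q? (list E)
  ; unique   = Unique.filter⁺ Q? (unique E)
  ; sound    = λ x∈ → let (x∈′ , q) = ∈-filter⁻ Q? {xs = list E} x∈ in sound E x∈′ , q
  ; complete = λ (p , q) → ∈-filter⁺ Q? (complete E p) q
  }

∑-split : {P Q : A → Set} (E : Enum P) (Q? : Decidable Q) (F : _ → ℤ) →
  ∑ E F ≡ ∑ (E ∣ᴱ Q?) F ℤ.+ ∑ (E ∣ᴱ (¬? ∘ Q?)) F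
∑-split E Q? F = go (list E)
  where
  lemma : ∀ a b c → a ℤ.+ (b ℤ.+ c) ≡ b ℤ.+ (a ℤ.+ c)
  lemma = solve-∀
  go : ∀ xs → sumℤ (map F xs) ≡
    sumℤ (map F (filter Q? xs)) ℤ.+ sumℤ (map F (filter (¬? ∘ Q?) xs))
  go []       = refl
  go (x ∷ xs) with Q? x
  ... | yes _ = trans (+-congˡ (F x) (go xs)) (sym (ℤ.+-assoc (F x) _ _))
  ... | no  _ = trans (+-congˡ (F x) (go xs))
      (lemma (F x) (sumℤ (map F (filter Q? xs))) (sumℤ (map F (filter (¬? ∘ Q?) xs))))

pairsOver : List A → (A → List B) → List (A × B)
pairsOver []       f = []
pairsOver (x ∷ xs) f = map (x ,_) (f x) ++ pairsOver xs f

sumℤ-pairsOver : ∀ xs (f : A → List B) (F : A × B → ℤ) →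
  sumℤ (map F (pairsOver xs f)) ≡ sumℤ (map (λ x → sumℤ (map (λ y → F (x , y)) (f x))) xs)
sumℤ-pairsOver []       f F = refl
sumℤ-pairsOver (x ∷ xs) f F = begin
  sumℤ (map F (map (x ,_) (f x) ++ pairsOver xs f))
    ≡⟨ cong sumℤ (map-++ F (map (x ,_) (f x)) (pairsOver xs f)) ⟩
  sumℤ (map F (map (x ,_) (f x)) ++ map F (pairsOver xs f))
    ≡⟨ sumℤ-++ (map F (map (x ,_) (f x))) _ ⟩
  sumℤ (map F (map (x ,_) (f x))) ℤ.+ sumℤ (map F (pairsOver xs f))
    ≡⟨ cong₂ ℤ._+_ (cong sumℤ (sym (map-∘ (f x)))) (sumℤ-pairsOver xs f F) ⟩
  _ ∎
  where open ≡-Reasoning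

sigma : {P : A → Set} {R : A → B → Set} → Enum P → (∀ x → Enum (R x)) →
    Enum (λ (x , y) → P x × R x y)
sigma {R = R} E E′ = record
  { list     = go (list E)
  ; unique   = go-unique (unique E)
  ; sound    = λ z∈ → let (x∈ , y∈) = go-sound (list E) z∈ in sound E x∈ , sound (E′ _) y∈
  ; complete = λ (p , r) → go-complete (complete E p) (complete (E′ _) r)
  }
  where
  go : List _ → List _
  go xs = pairsOver xs (list ∘ E′)

  go-sound : ∀ xs {x y} → (x , y) ∈ go xs → x ∈ xs × y ∈ list (E′ x)
  go-sound (x ∷ xs) z∈ with ∈-++⁻ (map (x ,_) (list (E′ x))) z∈
  ... | inj₂ z∈′ = let (x∈ , y∈) = go-sound xs z∈′ in there x∈ , y∈
  ... | inj₁ z∈′ with ∈-map⁻ (x ,_) z∈′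
  ...   | (_ , y∈ , refl) = here refl , y∈

  go-complete : ∀ {xs x y} → x ∈ xs → y ∈ list (E′ x) → (x , y) ∈ go xs
  go-complete (here refl)        y∈ = ∈-++⁺ˡ (∈-map⁺ (_ ,_) y∈)
  go-complete {x ∷ xs} (there p) y∈ = ∈-++⁺ʳ (map (x ,_) (list (E′ x))) (go-complete p y∈)

  go-unique : ∀ {xs} → Unique xs → Unique (go xs)
  go-unique []              = []
  go-unique {x ∷ xs} (p ∷ ps) = Unique.++⁺ (Unique.map⁺ (cong proj₂) (unique (E′ x))) (go-unique ps)
    λ (v∈ , w∈) → disjoint v∈ w∈
    where
    disjoint : ∀ {v} → v ∈ map (x ,_) (list (E′ x)) → v ∈ go xs → _
    disjoint v∈ w∈ with ∈-map⁻ (x ,_) v∈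
    ... | (_ , _ , refl) = All.lookup p (proj₁ (go-sound xs w∈)) refl

∑-sigma : {P : A → Set} {R : A → B → Set} (E : Enum P) (E′ : ∀ x → Enum (R x)) (F : A × B → ℤ) →
  ∑ (sigma E E′) F ≡ ∑ E (λ x → ∑ (E′ x) (λ y → F (x , y)))
∑-sigma E E′ F = sumℤ-pairsOver (list E) (list ∘ E′) F

-- Signs and telescoping sums

-- The parity character (-1)^a, extended to negative a; not the sign of a.
sgn : ℤ → ℤ
sgn a = -1ℤ ℤ.^ ∣ a ∣

pow-+ : ∀ m n → -1ℤ ℤ.^ (m ℕ.+ n) ≡ -1ℤ ℤ.^ m ℤ.* -1ℤ ℤ.^ n
pow-+ m n = ℤ.^-distribˡ-+-* -1ℤ m n

sgn² : ∀ a → sgn a ℤ.* sgn a ≡ 1ℤ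
sgn² a = go ∣ a ∣
  where
  lemma : ∀ x → -1ℤ ℤ.* x ℤ.* (-1ℤ ℤ.* x) ≡ x ℤ.* x
  lemma = solve-∀
  go : ∀ n → -1ℤ ℤ.^ n ℤ.* -1ℤ ℤ.^ n ≡ 1ℤ
  go zero    = refl
  go (suc n) = trans (lemma (-1ℤ ℤ.^ n)) (go n)

sgn-neg : ∀ a → sgn (ℤ.- a) ≡ sgn a
sgn-neg a = cong (-1ℤ ℤ.^_) (ℤ.∣-i∣≡∣i∣ a)

sgn-⊖ : ∀ m n → sgn (m ℤ.⊖ n) ≡ -1ℤ ℤ.^ m ℤ.* -1ℤ ℤ.^ n
sgn-⊖ zero    zero    = refl
sgn-⊖ zero    (suc n) = sym (ℤ.*-identityˡ _)
sgn-⊖ (suc m) zero    = sym (ℤ.*-identityʳ _)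
sgn-⊖ (suc m) (suc n) = trans (cong sgn (ℤ.[1+m]⊖[1+n]≡m⊖n m n))
  (trans (sgn-⊖ m n) (sym (lemma (-1ℤ ℤ.^ m) (-1ℤ ℤ.^ n))))
  where
  lemma : ∀ x y → -1ℤ ℤ.* x ℤ.* (-1ℤ ℤ.* y) ≡ x ℤ.* y
  lemma = solve-∀

sgn-+ : ∀ a b → sgn (a ℤ.+ b) ≡ sgn a ℤ.* sgn b
sgn-+ (+ m)    (+ n)    = pow-+ m n
sgn-+ (+ m)    -[1+ n ] = sgn-⊖ m (suc n)
sgn-+ -[1+ m ] (+ n)    = trans (sgn-⊖ n (suc m)) (ℤ.*-comm (-1ℤ ℤ.^ n) (sgn -[1+ m ]))
sgn-+ -[1+ m ] -[1+ n ] = trans (cong (-1ℤ ℤ.^_) (sym (ℕ.+-suc (suc m) n))) (pow-+ (suc m) (suc n))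

IsSign : ℤ → Set
IsSign δ = δ ≡ 1ℤ ⊎ δ ≡ -1ℤ

sgn-cases : ∀ a → IsSign (sgn a)
sgn-cases a = go ∣ a ∣
  where
  go : ∀ n → IsSign (-1ℤ ℤ.^ n)
  go zero    = inj₁ refl
  go (suc n) with go n
  ... | inj₁ eq = inj₂ (cong (-1ℤ ℤ.*_) eq)
  ... | inj₂ eq = inj₁ (cong (-1ℤ ℤ.*_) eq)

sgn-- : ∀ a b → sgn (a ℤ.- b) ≡ sgn a ℤ.* sgn b
sgn-- a b = trans (sgn-+ a (ℤ.- b)) (cong (sgn a ℤ.*_) (sgn-neg b))

sgn-double : ∀ a → sgn (a ℤ.+ a) ≡ 1ℤ
sgn-double a = trans (sgn-+ a a) (sgn² a)

sgn-suc : ∀ a → sgn (a ℤ.+ 1ℤ) ≡ ℤ.- sgn a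
sgn-suc a = trans (sgn-+ a 1ℤ) (trans (ℤ.*-comm (sgn a) -1ℤ) (ℤ.-1*i≡-i (sgn a)))

sgn-even : ∀ a b c → a ≡ b ℤ.+ (c ℤ.+ c) → sgn a ≡ sgn b
sgn-even a b c refl = trans (sgn-+ b (c ℤ.+ c))
    (trans (cong (sgn b ℤ.*_) (sgn-double c)) (ℤ.*-identityʳ _))

between : ∀ m → Enum (λ x → 0ℤ ℤ.< x × x ℤ.< m)
between m = record
  { list     = go m
  ; unique   = go-unique m
  ; sound    = go-sound m
  ; complete = go-complete m
  }
  where
  go : ℤ → List ℤ
  go (+ n)    = map (+_ ∘ suc) (upTo (ℕ.pred n))
  go -[1+ n ] = []
  go-unique : ∀ m → Unique (go m)
  go-unique (+ n)    = Unique.map⁺ (ℕ.suc-injective ∘ ℤ.+-injective) (Unique.upTo⁺ (ℕ.pred n))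
  go-unique -[1+ n ] = []
  go-sound : ∀ m {x} → x ∈ go m → 0ℤ ℤ.< x × x ℤ.< m
  go-sound (+ n) x∈ with ∈-map⁻ (+_ ∘ suc) x∈
  go-sound (+ suc n) x∈ | (i , i∈ , refl) = +<+ z<s , +<+ (s≤s (∈-upTo⁻ i∈))
  go-complete : ∀ m {x} → 0ℤ ℤ.< x × x ℤ.< m → x ∈ go m
  go-complete (+ suc n) {+ suc i} (_ , +<+ (s≤s i<n)) = ∈-map⁺ (+_ ∘ suc) (∈-upTo⁺ i<n)
  go-complete (+ suc n) {+ zero} (+<+ () , _)

-- `between m` begins at 1, whence the lower boundary `C 1ℤ`; for m ≤ 0 the sum is empty and the
-- boundary terms need not cancel.
telescope : ∀ m → 0ℤ ℤ.< m → (C g : ℤ → ℤ) → (∀ x → g x ≡ C (x ℤ.+ 1ℤ) ℤ.- C x) →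
  ∑ (between m) g ≡ C m ℤ.- C 1ℤ
telescope (+ suc n) _ C g tel =
    trans (cong sumℤ (trans (sym (map-∘ (upTo n))) (map-upTo (g ∘ +_ ∘ suc) n)))
  (go (+_ ∘ suc) (λ k → cong +_ (ℕ.+-comm (suc k) 1)) n)
  where
  lemma : ∀ a b c → b ℤ.- a ℤ.+ (c ℤ.- b) ≡ c ℤ.- a
  lemma = solve-∀
  go : ∀ (h : ℕ → ℤ) → (∀ k → h k ℤ.+ 1ℤ ≡ h (suc k)) → ∀ n → sumℤ (applyUpTo (g ∘ h) n) ≡
      C (h n) ℤ.- C (h 0)
  go h eq zero    = sym (ℤ.+-inverseʳ (C (h 0)))
  go h eq (suc n) = trans (cong₂ ℤ._+_ (trans (tel (h 0)) (cong (λ z → C z ℤ.- C (h 0)) (eq 0)))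
      (go (h ∘ suc) (eq ∘ suc) n))
    (lemma (C (h 0)) (C (h 1)) (C (h (suc n))))
telescope (+ zero) (+<+ ()) C g tel

-- Lambert series and their products

Pos : ℤ → Set
Pos x = 0ℤ ℤ.< x

pos-+ : ∀ {a b} → Pos a → Pos b → Pos (a ℤ.+ b)
pos-+ = ℤ.+-mono-<

pos-* : ∀ {a b} → Pos a → Pos b → Pos (a ℤ.* b)
pos-* {+ suc a} {+ suc b} p q = +<+ z<s
pos-* {+ zero} (+<+ ())
pos-* {+ suc a} {+ zero} _ (+<+ ())

pos-- : ∀ {a b} → a ℤ.< b → Pos (b ℤ.- a)
pos-- {a} {b} a<b = subst (ℤ._< b ℤ.- a) (ℤ.+-inverseʳ a) (ℤ.+-monoˡ-< (ℤ.- a) a<b)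

pos-≤-* : ∀ {a b} → Pos a → Pos b → a ℤ.≤ a ℤ.* b
pos-≤-* {+ suc a} {+ suc b} p q = +≤+ (ℕ.m≤m*n (suc a) (suc b))
pos-≤-* {+ zero} (+<+ ())
pos-≤-* {+ suc a} {+ zero} _ (+<+ ())

<-suc : ∀ {a n} → a ℤ.≤ + n → a ℤ.< + suc n
<-suc {n = n} a≤n = ℤ.≤-<-trans a≤n (+<+ (ℕ.n<1+n n))

-- Recovers from a solution of u + v = n the degree of its first part, that is, the tag carried by
-- `graded`.
nonneg-split : ∀ {u v n} → 0ℤ ℤ.≤ u → 0ℤ ℤ.≤ v → u ℤ.+ v ≡ + n →
  ∣ u ∣ ℕ.≤ n × u ≡ + ∣ u ∣ × v ≡ + (n ∸ ∣ u ∣)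
nonneg-split {+ k} {+ l} _ _ refl = ℕ.m≤m+n k l , refl , cong +_ (sym (ℕ.m+n∸m≡n k l))

IsPair : ℕ → ℤ × ℤ → Set
IsPair n (a , x) = Pos a × Pos x × a ℤ.* x ≡ + n

pairs : ∀ n → Enum (IsPair n)
pairs n = sigma (between (+ suc n)) (λ _ → between (+ suc n)) ∣ᴱ (λ (a , x) → a ℤ.* x ℤ.≟ + n) ⟫
  refine (λ (((0<a , _) , (0<x , _)) , eq) → 0<a , 0<x , eq)
    (λ {(a , x)} (0<a , 0<x , eq) →
      ((0<a , <-suc (subst (a ℤ.≤_) eq (pos-≤-* 0<a 0<x))) ,
       (0<x , <-suc (subst (x ℤ.≤_) (trans (ℤ.*-comm x a) eq) (pos-≤-* 0<x 0<a)))) , eq)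

-- The Lambert series Σ c(a, x) q^(ax) over a, x ≥ 1. Its constant term is an empty sum, which is
-- used repeatedly below.
Λ : (ℤ → ℤ → ℤ) → Series
Λ c n = ∑ (pairs n) (λ (a , x) → c a x)

upToᴱ : ∀ n → Enum (ℕ._≤ n)
upToᴱ n = record
  { list     = upTo (suc n)
  ; unique   = Unique.upTo⁺ (suc n)
  ; sound    = λ x∈ → ℕ.s≤s⁻¹ (∈-upTo⁻ x∈)
  ; complete = λ x≤n → ∈-upTo⁺ (s≤s x≤n)
  }

⋆-as-∑ : ∀ f g n → (f ⋆ g) n ≡ ∑ (upToᴱ n) (λ j → f j ℤ.* g (n ∸ j))
⋆-as-∑ f g n = sym (trans (cong sumℤ (map-upTo (λ j → f j ℤ.* g (n ∸ j)) (suc n))) (go f n))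
  where
  go : ∀ f n → sumℤ (applyUpTo (λ j → f j ℤ.* g (n ∸ j)) (suc n)) ≡ (f ⋆ g) n
  go f zero    = ℤ.+-identityʳ _
  go f (suc n) = +-congˡ (f 0 ℤ.* g (suc n)) (go (f ∘ suc) n)

module _ {A B : Set} {P : ℕ → A → Set} {Q : ℕ → B → Set}
  (E : ∀ j → Enum (P j)) (E′ : ∀ j → Enum (Q j)) where

  -- Tagging by the degree j of the first component matches the Cauchy product. In each use the tag
  -- is determined by that component and is dropped afterwards.
  graded : ∀ n → Enum (λ ((j , (p , q)) : ℕ × (A × B)) → j ℕ.≤ n × P j p × Q (n ∸ j) q)
  graded n = sigma (upToᴱ n) (λ j → sigma (E j) (λ _ → E′ (n ∸ j)))

  ∑-graded : ∀ F G n → ∑ (graded n) (λ (_ , (p , q)) → F p ℤ.* G q) ≡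
    ((λ j → ∑ (E j) F) ⋆ (λ j → ∑ (E′ j) G)) n
  ∑-graded F G n = begin
    ∑ (graded n) (λ (_ , (p , q)) → F p ℤ.* G q)
      ≡⟨ ∑-sigma (upToᴱ n) (λ j → sigma (E j) (λ _ → E′ (n ∸ j))) (λ (_ , (p , q)) → F p ℤ.* G q) ⟩
    ∑ (upToᴱ n) (λ j → ∑ (sigma (E j) (λ _ → E′ (n ∸ j))) (λ (p , q) → F p ℤ.* G q))
      ≡⟨ ∑-cong (upToᴱ n) (λ {j} _ →
          trans (∑-sigma (E j) (λ _ → E′ (n ∸ j)) (λ (p , q) → F p ℤ.* G q)) (trans
           (∑-cong (E j) (λ {p} _ → ∑-* (F p) (E′ (n ∸ j)) G))
           (trans (∑-cong (E j) (λ {p} _ → ℤ.*-comm (F p) (∑ (E′ (n ∸ j)) G)))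
             (trans (∑-* (∑ (E′ (n ∸ j)) G) (E j) F) (ℤ.*-comm (∑ (E′ (n ∸ j)) G) (∑ (E j) F)))))) ⟩
    ∑ (upToᴱ n) (λ j → ∑ (E j) F ℤ.* ∑ (E′ (n ∸ j)) G)
      ≡⟨ sym (⋆-as-∑ _ _ n) ⟩
    _ ∎
    where open ≡-Reasoning

Quad : Set
Quad = (ℤ × ℤ) × (ℤ × ℤ)

IsQuad : ℕ → Quad → Set
IsQuad n ((a , x) , (b , y)) = (Pos a × Pos x) × (Pos b × Pos y) × a ℤ.* x ℤ.+ b ℤ.* y ≡ + n

pairs≅quads : ∀ n →
  (λ ((j , (p , q)) : ℕ × ((ℤ × ℤ) × (ℤ × ℤ))) → j ℕ.≤ n × IsPair j p × IsPair (n ∸ j) q) ≅ IsQuad n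
pairs≅quads n = record
  { to      = proj₂
  ; from    = λ { ((a , x) , (b , y)) → ∣ a ℤ.* x ∣ , ((a , x) , (b , y)) }
  ; to-∈    = λ { (j≤n , (0<a , 0<x , eq) , (0<b , 0<y , eq′)) →
      (0<a , 0<x) , (0<b , 0<y) , trans (cong₂ ℤ._+_ eq eq′) (cong +_ (ℕ.m+[n∸m]≡n j≤n)) }
  ; from-∈  = λ { ((0<a , 0<x) , (0<b , 0<y) , eq) →
      let (k≤n , eqˡ , eqʳ) = nonneg-split (ℤ.<⇒≤ (pos-* 0<a 0<x)) (ℤ.<⇒≤ (pos-* 0<b 0<y)) eq
      in k≤n , (0<a , 0<x , eqˡ) , (0<b , 0<y , eqʳ) }
  ; from∘to = λ { {_ , (p , q)} (_ , (_ , _ , eq) , _) → cong (_, (p , q)) (cong ∣_∣ eq) }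
  ; to∘from = λ _ → refl
  }

quads : ∀ n → Enum (IsQuad n)
quads n = graded pairs pairs n ⟫ pairs≅quads n

Λ-⋆ : ∀ c c′ n → (Λ c ⋆ Λ c′) n ≡
  ∑ (quads n) (λ ((a , x) , (b , y)) → c a x ℤ.* c′ b y)
Λ-⋆ c c′ n = trans
  (sym (∑-graded pairs pairs (λ (a , x) → c a x) (λ (b , y) → c′ b y) n))
  (∑-bij (graded pairs pairs n) (quads n) (pairs≅quads n) (λ _ → refl))

-- Convolution sums by shearing

∑-trichotomy : ∀ {A : Set} {P : A → Set} (E : Enum P) (u v : A → ℤ) (F : A → ℤ) →
  ∑ E F ≡ ∑ (E ∣ᴱ (λ z → u z ℤ.<? v z)) F ℤ.+ ∑ (E ∣ᴱ (λ z → v z ℤ.<? u z)) F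
    ℤ.+ ∑ (E ∣ᴱ (λ z → u z ℤ.≟ v z)) F
∑-trichotomy E u v F = begin
  ∑ E F
    ≡⟨ ∑-split E (λ z → u z ℤ.<? v z) F ⟩
  ∑ E₁ F ℤ.+ ∑ E₁′ F
    ≡⟨ +-congˡ (∑ E₁ F) (∑-split E₁′ (λ z → v z ℤ.<? u z) F) ⟩
  ∑ E₁ F ℤ.+ (∑ E₂ F ℤ.+ ∑ E₃ F)
    ≡⟨ +-congˡ (∑ E₁ F) (cong₂ ℤ._+_
         (∑-bij E₂ (E ∣ᴱ (λ z → v z ℤ.<? u z)) (refine
           (λ ((p , _) , v<u) → p , v<u)
           (λ (p , v<u) → (p , ℤ.<-asym v<u) , v<u)) (λ _ → refl))
         (∑-bij E₃ (E ∣ᴱ (λ z → u z ℤ.≟ v z)) (refine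
           (λ ((p , u≮v) , v≮u) → p , ℤ.≤-antisym (ℤ.≮⇒≥ v≮u) (ℤ.≮⇒≥ u≮v))
           (λ (p , u≡v) → (p , ℤ.<-irrefl u≡v) , ℤ.<-irrefl (sym u≡v))) (λ _ → refl))) ⟩
  ∑ E₁ F ℤ.+ (∑ (E ∣ᴱ (λ z → v z ℤ.<? u z)) F ℤ.+ ∑ (E ∣ᴱ (λ z → u z ℤ.≟ v z)) F)
    ≡⟨ sym (ℤ.+-assoc (∑ E₁ F) _ _) ⟩
  _ ∎
  where
  open ≡-Reasoning
  E₁ = E ∣ᴱ (λ z → u z ℤ.<? v z)
  E₁′ = E ∣ᴱ (¬? ∘ (λ z → u z ℤ.<? v z))
  E₂ = E₁′ ∣ᴱ (λ z → v z ℤ.<? u z)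
  E₃ = E₁′ ∣ᴱ (¬? ∘ (λ z → v z ℤ.<? u z))

-- The arguments α, β, γ stand for (-1)^a, (-1)^b, (-1)^(a+b), and ξ, η, ζ likewise for x, y, so
-- that a shear merely permutes them.
Weight : Set
Weight = (a b α β γ ξ η ζ : ℤ) → ℤ

at : Weight → Quad → ℤ
at Φ ((a , x) , (b , y)) =
  Φ a b (sgn a) (sgn b) (sgn (a ℤ.+ b)) (sgn x) (sgn y) (sgn (x ℤ.+ y))

module _ (n : ℕ) where

  x<y≅b<a : (λ ((p@(a , x) , q@(b , y)) : Quad) → IsQuad n (p , q) × x ℤ.< y) ≅
            (λ ((p@(a , x) , q@(b , y)) : Quad) → IsQuad n (p , q) × b ℤ.< a)
  x<y≅b<a = record
    { to      = λ { ((a , x) , (b , y)) → (a ℤ.+ b , x) , (b , y ℤ.- x) }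
    ; from    = λ { ((a , x) , (b , y)) → (a ℤ.- b , x) , (b , x ℤ.+ y) }
    ; to-∈    = λ { {(a , x) , (b , y)} (((0<a , 0<x) , (0<b , 0<y) , eq) , x<y) →
        ((pos-+ 0<a 0<b , 0<x) , (0<b , pos-- x<y) , trans (norm₁ a b x y) eq) ,
        subst (ℤ._< a ℤ.+ b) (ℤ.+-identityˡ b) (ℤ.+-monoˡ-< b 0<a) }
    ; from-∈  = λ { {(a , x) , (b , y)} (((0<a , 0<x) , (0<b , 0<y) , eq) , b<a) →
        ((pos-- b<a , 0<x) , (0<b , pos-+ 0<x 0<y) , trans (norm₂ a b x y) eq) ,
        subst (ℤ._< x ℤ.+ y) (ℤ.+-identityʳ x) (ℤ.+-monoʳ-< x 0<y) }
    ; from∘to = λ { {(a , x) , (b , y)} _ →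
        cong₂ (λ u v → (u , x) , (b , v)) (back a b) (forth x y) }
    ; to∘from = λ { {(a , x) , (b , y)} _ →
        cong₂ (λ u v → (u , x) , (b , v)) (back′ a b) (forth′ x y) }
    }
    where
    norm₁ : ∀ a b x y → (a ℤ.+ b) ℤ.* x ℤ.+ b ℤ.* (y ℤ.- x) ≡ a ℤ.* x ℤ.+ b ℤ.* y
    norm₁ = solve-∀
    norm₂ : ∀ a b x y → (a ℤ.- b) ℤ.* x ℤ.+ b ℤ.* (x ℤ.+ y) ≡ a ℤ.* x ℤ.+ b ℤ.* y
    norm₂ = solve-∀
    back : ∀ a b → a ℤ.+ b ℤ.- b ≡ a
    back = solve-∀
    back′ : ∀ a b → a ℤ.- b ℤ.+ b ≡ a
    back′ = solve-∀
    forth : ∀ x y → x ℤ.+ (y ℤ.- x) ≡ y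
    forth = solve-∀
    forth′ : ∀ x y → x ℤ.+ y ℤ.- x ≡ y
    forth′ = solve-∀

  swap-quads : IsQuad n ≅ IsQuad n
  swap-quads = record
    { to      = swap
    ; from    = swap
    ; to-∈    = λ { {(a , x) , (b , y)} (p , q , eq) → q , p ,
        trans (ℤ.+-comm (b ℤ.* y) (a ℤ.* x)) eq }
    ; from-∈  = λ { {(a , x) , (b , y)} (p , q , eq) → q , p ,
        trans (ℤ.+-comm (b ℤ.* y) (a ℤ.* x)) eq }
    ; from∘to = λ _ → refl
    ; to∘from = λ _ → refl
    }

  swap-region : (R : Quad → Set) →
    (λ z → IsQuad n z × R (swap z)) ≅ (λ z → IsQuad n z × R z)
  swap-region R = record
    { to      = swap
    ; from    = swap
    ; to-∈    = λ (p , r) → to-∈ swap-quads p , r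
    ; from-∈  = λ (p , r) → to-∈ swap-quads p , r
    ; from∘to = λ _ → refl
    ; to∘from = λ _ → refl
    }

  private
    E = quads n
    first second : Quad → ℤ
    first  ((a , x) , (b , y)) = a
    second ((a , x) , (b , y)) = b
    third fourth : Quad → ℤ
    third  ((a , x) , (b , y)) = x
    fourth ((a , x) , (b , y)) = y

    E[a>b] = E ∣ᴱ (λ z → second z ℤ.<? first z)
    E[a<b] = E ∣ᴱ (λ z → first z ℤ.<? second z)
    E[a≡b] = E ∣ᴱ (λ z → second z ℤ.≟ first z)
    E[x<y] = E ∣ᴱ (λ z → third z ℤ.<? fourth z)
    E[x>y] = E ∣ᴱ (λ z → fourth z ℤ.<? third z)
    E[x≡y] = E ∣ᴱ (λ z → third z ℤ.≟ fourth z)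

  module _ (Φ Ψ : Weight)
    (shear₁ : ∀ a b α β γ ξ η ζ → Φ (a ℤ.+ b) b γ β α ξ ζ η ≡ Ψ a b α β γ ξ η ζ)
    (shear₂ : ∀ a b α β γ ξ η ζ → Φ a (a ℤ.+ b) α γ β ζ η ξ ≡ Ψ a b α β γ ξ η ζ)
    where

    private
      even₁ : ∀ a b → a ℤ.+ b ℤ.+ b ≡ a ℤ.+ (b ℤ.+ b)
      even₁ = solve-∀
      even₂ : ∀ x y → x ℤ.+ y ≡ y ℤ.- x ℤ.+ (x ℤ.+ x)
      even₂ = solve-∀
      even₃ : ∀ x y → x ℤ.+ (y ℤ.- x) ≡ y
      even₃ = solve-∀
      even₄ : ∀ a b → a ℤ.+ (a ℤ.+ b) ≡ b ℤ.+ (a ℤ.+ a)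
      even₄ = solve-∀
      even₅ : ∀ x y → x ℤ.+ y ≡ x ℤ.- y ℤ.+ (y ℤ.+ y)
      even₅ = solve-∀
      even₆ : ∀ x y → x ℤ.- y ℤ.+ y ≡ x
      even₆ = solve-∀

    -- Under the shear, the parities of (a + b) + b and y - x are those of a and x + y, so the six
    -- signs are permuted exactly as in `shear₁`.
    ∑-shear₁ : ∑ E[x<y] (at Ψ) ≡ ∑ E[a>b] (at Φ)
    ∑-shear₁ = ∑-bij E[x<y] E[a>b] x<y≅b<a λ { {(a , x) , (b , y)} _ → sym (trans
      (cong₂ (λ u v → Φ (a ℤ.+ b) b (sgn (a ℤ.+ b)) (sgn b) u (sgn x) v (sgn (x ℤ.+ (y ℤ.- x))))
        (sgn-even (a ℤ.+ b ℤ.+ b) a b (even₁ a b))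
        (sym (sgn-even (x ℤ.+ y) (y ℤ.- x) x (even₂ x y))))
      (trans (cong (λ u → Φ (a ℤ.+ b) b (sgn (a ℤ.+ b)) (sgn b) (sgn a) (sgn x) (sgn (x ℤ.+ y))
          (sgn u))
        (even₃ x y))
        (shear₁ a b _ _ _ _ _ _))) }

    -- Swapping the two pairs, shearing and swapping back amounts to (a, b, x, y) ↦ (a, a + b, x -
    -- y, y) on the region x > y.
    ∑-shear₂ : ∑ E[x>y] (at Ψ) ≡ ∑ E[a<b] (at Φ)
    ∑-shear₂ = trans (∑-bij E[x>y] E[x<y] (swap-region (λ z → third z ℤ.< fourth z)) {G = G}
        (λ _ → refl))
      (trans (∑-bij E[x<y] E[a>b] x<y≅b<a {G = H} (λ {z} _ → eq z))
      (∑-bij E[a>b] E[a<b] (swap-region (λ z → first z ℤ.< second z)) (λ _ → refl)))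
      where
      G H : Quad → ℤ
      G = at Ψ ∘ swap
      H = at Φ ∘ swap
      eq : ∀ z → G z ≡ H (to x<y≅b<a z)
      eq ((b , y) , (a , x)) = sym (trans
        (cong₂ (λ u v → Φ a u (sgn a) (sgn u) (sgn (a ℤ.+ u)) (sgn (x ℤ.- y)) (sgn y) (sgn v))
          (ℤ.+-comm b a) (even₆ x y))
        (trans (cong₂ (λ u v → Φ a (a ℤ.+ b) (sgn a) (sgn (a ℤ.+ b)) u v (sgn y) (sgn x))
          (sgn-even (a ℤ.+ (a ℤ.+ b)) b a (even₄ a b))
          (sym (sgn-even (x ℤ.+ y) (x ℤ.- y) y (even₅ x y))))
        (shear₂ a b _ _ _ _ _ _)))

    -- The sum of Φ over a ≠ b equals that of Ψ over x ≠ y, so only one diagonal of each trichotomy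
    -- survives.
    ∑-shear : ∑ E (at Φ) ℤ.- ∑ E (at Ψ) ≡ ∑ E[a≡b] (at Φ) ℤ.- ∑ E[x≡y] (at Ψ)
    ∑-shear = trans (cong₂ ℤ._-_
        (∑-trichotomy E second first (at Φ)) (∑-trichotomy E third fourth (at Ψ)))
      (trans (cong (λ z → ∑ E[a>b] (at Φ) ℤ.+ ∑ E[a<b] (at Φ) ℤ.+ ∑ E[a≡b]
          (at Φ) ℤ.- (z ℤ.+ ∑ E[x≡y] (at Ψ)))
          (cong₂ ℤ._+_ ∑-shear₁ ∑-shear₂))
        (lemma (∑ E[a>b] (at Φ) ℤ.+ ∑ E[a<b] (at Φ)) (∑ E[a≡b] (at Φ)) (∑ E[x≡y] (at Ψ))))
      where
      lemma : ∀ s a b → s ℤ.+ a ℤ.- (s ℤ.+ b) ≡ a ℤ.- b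
      lemma = solve-∀

  -- For a = b = d the equation reads d (x + y) = n. With m = x + y, the diagonal fibres over the
  -- factorisations d m = n, the fibre being 0 < x < m. The diagonal x = y is treated in the same
  -- way with the roles exchanged.
  ∑-a≡b : ∀ F → ∑ E[a≡b] F ≡
      ∑ (pairs n) (λ (d , m) → ∑ (between m) (λ x → F ((d , x) , (d , m ℤ.- x))))
  ∑-a≡b F = sym (trans (sym (∑-sigma (pairs n) (λ (d , m) → between m)
      (λ ((d , m) , x) → F ((d , x) , (d , m ℤ.- x)))))
    (∑-bij (sigma (pairs n) (λ (d , m) → between m)) E[a≡b] b λ _ → refl))
    where
    dist : ∀ a x y → a ℤ.* x ℤ.+ a ℤ.* y ≡ a ℤ.* (x ℤ.+ y)
    dist = solve-∀
    cancel : ∀ m x → x ℤ.+ (m ℤ.- x) ≡ m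
    cancel = solve-∀
    cancel′ : ∀ x y → x ℤ.+ y ℤ.- x ≡ y
    cancel′ = solve-∀
    b : (λ ((p@(d , m) , x) : (ℤ × ℤ) × ℤ) → IsPair n p × Pos x × x ℤ.< m) ≅
        (λ z → IsQuad n z × second z ≡ first z)
    b = record
      { to      = λ { ((d , m) , x) → (d , x) , (d , m ℤ.- x) }
      ; from    = λ { ((a , x) , (_ , y)) → (a , x ℤ.+ y) , x }
      ; to-∈    = λ { {(d , m) , x} ((0<d , _ , eq) , 0<x , x<m) →
          ((0<d , 0<x) , (0<d , pos-- x<m) ,
            trans (dist d x (m ℤ.- x)) (trans (cong (d ℤ.*_) (cancel m x)) eq)) , refl }
      ; from-∈  = λ { {(a , x) , (_ , y)} (((0<a , 0<x) , (_ , 0<y) , eq) , refl) →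
          (0<a , pos-+ 0<x 0<y , trans (sym (dist a x y)) eq) , 0<x ,
          subst (ℤ._< x ℤ.+ y) (ℤ.+-identityʳ x) (ℤ.+-monoʳ-< x 0<y) }
      ; from∘to = λ { {(d , m) , x} _ → cong (λ z → (d , z) , x) (cancel m x) }
      ; to∘from = λ { {(a , x) , (_ , y)} (_ , refl) →
          cong (λ z → (a , x) , (a , z)) (cancel′ x y) }
      }

  ∑-x≡y : ∀ F → ∑ E[x≡y] F ≡
      ∑ (pairs n) (λ (d , m) → ∑ (between d) (λ a → F ((a , m) , (d ℤ.- a , m))))
  ∑-x≡y F = sym (trans (sym (∑-sigma (pairs n) (λ (d , m) → between d)
      (λ ((d , m) , a) → F ((a , m) , (d ℤ.- a , m)))))
    (∑-bij (sigma (pairs n) (λ (d , m) → between d)) E[x≡y] b λ _ → refl))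
    where
    dist : ∀ a b x → a ℤ.* x ℤ.+ b ℤ.* x ≡ (a ℤ.+ b) ℤ.* x
    dist = solve-∀
    cancel : ∀ m x → x ℤ.+ (m ℤ.- x) ≡ m
    cancel = solve-∀
    cancel′ : ∀ x y → x ℤ.+ y ℤ.- x ≡ y
    cancel′ = solve-∀
    b : (λ ((p@(d , m) , a) : (ℤ × ℤ) × ℤ) → IsPair n p × Pos a × a ℤ.< d) ≅
        (λ z → IsQuad n z × third z ≡ fourth z)
    b = record
      { to      = λ { ((d , m) , a) → (a , m) , (d ℤ.- a , m) }
      ; from    = λ { ((a , x) , (b , _)) → (a ℤ.+ b , x) , a }
      ; to-∈    = λ { {(d , m) , a} ((_ , 0<m , eq) , 0<a , a<d) →
          ((0<a , 0<m) , (pos-- a<d , 0<m) ,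
            trans (dist a (d ℤ.- a) m) (trans (cong (ℤ._* m) (cancel d a)) eq)) , refl }
      ; from-∈  = λ { {(a , x) , (b , _)} (((0<a , 0<x) , (0<b , _) , eq) , refl) →
          (pos-+ 0<a 0<b , 0<x , trans (sym (dist a b x)) eq) , 0<a ,
          subst (ℤ._< a ℤ.+ b) (ℤ.+-identityʳ a) (ℤ.+-monoʳ-< a 0<b) }
      ; from∘to = λ { {(d , m) , a} _ → cong (λ z → (z , m) , a) (cancel d a) }
      ; to∘from = λ { {(a , x) , (b , _)} (_ , refl) →
          cong (λ z → (a , x) , (z , x)) (cancel′ a b) }
      }

-- Φ and Ψ are related by the shear, which leaves the diagonals a = b and x = y unmatched.  Since
-- Ψ is Φ with a negated, Φ - Ψ keeps only the monomials odd in a, and these are the products of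
-- Lambert coefficients to be summed.
record Shear : Set where
  field
    Φ t    : Weight
    shear₁ : ∀ a b α β γ ξ η ζ → Φ (a ℤ.+ b) b γ β α ξ ζ η ≡ Φ (ℤ.- a) b α β γ ξ η ζ
    shear₂ : ∀ a b α β γ ξ η ζ → Φ a (a ℤ.+ b) α γ β ζ η ξ ≡ Φ (ℤ.- a) b α β γ ξ η ζ
    defect : ∀ a b α β γ ξ η ζ →
      Φ a b α β γ ξ η ζ ℤ.- Φ (ℤ.- a) b α β γ ξ η ζ ≡ t a b α β γ ξ η ζ ℤ.+ t b a β α γ η ξ ζ
    -- C and D are antidifferences of the summands on the diagonals a = b = d and x = y = m.
    C D    : (d m δ μ x ξ : ℤ) → ℤ
    ΔC     : ∀ d m δ μ x ξ → Φ d d δ δ 1ℤ ξ (μ ℤ.* ξ) μ ≡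
               C d m δ μ (x ℤ.+ 1ℤ) (ℤ.- ξ) ℤ.- C d m δ μ x ξ
    ΔD     : ∀ d m δ μ a α → Φ (ℤ.- a) (d ℤ.- a) α (δ ℤ.* α) δ μ μ 1ℤ ≡
               D d m δ μ (a ℤ.+ 1ℤ) (ℤ.- α) ℤ.- D d m δ μ a α
    g      : (d m δ μ : ℤ) → ℤ
    total  : ∀ d m {δ μ} → IsSign δ → IsSign μ →
      (C d m δ μ m μ ℤ.- C d m δ μ 1ℤ -1ℤ) ℤ.- (D d m δ μ d δ ℤ.- D d m δ μ 1ℤ -1ℤ) ≡
          + 2 ℤ.* g d m δ μ

  Ψ : Weight
  Ψ a = Φ (ℤ.- a)

  -- Exchanging (a, x) and (b, y) shows that twice the sum of `t` is the sum of `t` and its swap,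
  -- hence by `defect` that of Φ - Ψ. The two diagonals left by `∑-shear` telescope, and the factor
  -- 2 in `total` cancels the doubling.
  convolution : ∀ n → ∑ (quads n) (at t) ≡ Λ (λ d m → g d m (sgn d) (sgn m)) n
  convolution n = ℤ.*-cancelˡ-≡ (+ 2) (∑ (quads n) (at t)) (Λ (λ d m → g d m (sgn d) (sgn m)) n)
      (begin
    + 2 ℤ.* T
      ≡⟨ double T ⟩
    T ℤ.+ T
      ≡⟨ +-congˡ T (∑-bij E E (swap-quads n) (λ { {(a , x) , (b , y)} _ →
           cong₂ (λ u v → t a b (sgn a) (sgn b) u (sgn x) (sgn y) v) (cong sgn (ℤ.+-comm a b))
               (cong sgn (ℤ.+-comm x y)) })) ⟩
    T ℤ.+ ∑ E tˢ
      ≡⟨ sym (∑-+ E (at t) tˢ) ⟩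
    ∑ E (λ z → at t z ℤ.+ tˢ z)
      ≡⟨ ∑-cong E (λ { {(a , x) , (b , y)} _ → sym (defect a b _ _ _ _ _ _) }) ⟩
    ∑ E (λ z → at Φ z ℤ.- at Ψ z)
      ≡⟨ ∑-- E (at Φ) (at Ψ) ⟩
    ∑ E (at Φ) ℤ.- ∑ E (at Ψ)
      ≡⟨ ∑-shear n Φ Ψ shear₁ shear₂ ⟩
    _
      ≡⟨ cong₂ ℤ._-_ (∑-a≡b n (at Φ)) (∑-x≡y n (at Ψ)) ⟩
    ∑ (pairs n) (λ (d , m) → ∑ (between m) (λ x → at Φ ((d , x) , (d , m ℤ.- x)))) ℤ.-
    ∑ (pairs n) (λ (d , m) → ∑ (between d) (λ a → at Ψ ((a , m) , (d ℤ.- a , m))))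
      ≡⟨ sym (∑-- (pairs n) _ _) ⟩
    ∑ (pairs n) (λ (d , m) →
      ∑ (between m) (λ x → at Φ ((d , x) , (d , m ℤ.- x))) ℤ.-
      ∑ (between d) (λ a → at Ψ ((a , m) , (d ℤ.- a , m))))
      ≡⟨ ∑-cong (pairs n) (λ { {d , m} (0<d , 0<m , _) → trans
           (cong₂ ℤ._-_ (sumΦ d m 0<m) (sumΨ d m 0<d)) (total d m (sgn-cases d) (sgn-cases m)) }) ⟩
    Λ (λ d m → + 2 ℤ.* g d m (sgn d) (sgn m)) n
      ≡⟨ ∑-* (+ 2) (pairs n) (λ (d , m) → g d m (sgn d) (sgn m)) ⟩
    + 2 ℤ.* Λ (λ d m → g d m (sgn d) (sgn m)) n ∎)
    where
    open ≡-Reasoning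
    E = quads n
    T = ∑ E (at t)
    tˢ : Quad → ℤ
    tˢ ((a , x) , (b , y)) = t b a (sgn b) (sgn a) (sgn (a ℤ.+ b)) (sgn y) (sgn x) (sgn (x ℤ.+ y))
    double : ∀ T → + 2 ℤ.* T ≡ T ℤ.+ T
    double = solve-∀
    cancel : ∀ m x → x ℤ.+ (m ℤ.- x) ≡ m
    cancel = solve-∀

    sumΦ : ∀ d m → Pos m → ∑ (between m) (λ x → at Φ ((d , x) , (d , m ℤ.- x))) ≡
      C d m (sgn d) (sgn m) m (sgn m) ℤ.- C d m (sgn d) (sgn m) 1ℤ -1ℤ
    -- Here y = m - x, so the sign of y is the product of the signs of m and x. A step from x to x +
    -- 1 flips the sign of x, which is why `C` takes that sign as a separate argument.
    sumΦ d m 0<m = telescope m 0<m (λ x → C d m (sgn d) (sgn m) x (sgn x)) _ λ x → trans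
      (cong₂ (λ u v → Φ d d (sgn d) (sgn d) u (sgn x) v (sgn (x ℤ.+ (m ℤ.- x)))) (sgn-double d)
          (sgn-- m x))
      (trans (cong (λ u → Φ d d (sgn d) (sgn d) 1ℤ (sgn x) (sgn m ℤ.* sgn x) (sgn u)) (cancel m x))
      (trans (ΔC d m (sgn d) (sgn m) x (sgn x))
      (cong (λ u → C d m (sgn d) (sgn m) (x ℤ.+ 1ℤ) u ℤ.- C d m (sgn d) (sgn m) x (sgn x))
          (sym (sgn-suc x)))))

    sumΨ : ∀ d m → Pos d → ∑ (between d) (λ a → at Ψ ((a , m) , (d ℤ.- a , m))) ≡
      D d m (sgn d) (sgn m) d (sgn d) ℤ.- D d m (sgn d) (sgn m) 1ℤ -1ℤ
    sumΨ d m 0<d = telescope d 0<d (λ a → D d m (sgn d) (sgn m) a (sgn a)) _ λ a → trans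
      (cong₂ (λ u v → Ψ a (d ℤ.- a) (sgn a) u (sgn (a ℤ.+ (d ℤ.- a))) (sgn m) (sgn m) v)
          (sgn-- d a) (sgn-double m))
      (trans (cong (λ u → Ψ a (d ℤ.- a) (sgn a) (sgn d ℤ.* sgn a) (sgn u) (sgn m) (sgn m) 1ℤ)
          (cancel d a))
      (trans (ΔD d m (sgn d) (sgn m) a (sgn a))
      (cong (λ u → D d m (sgn d) (sgn m) (a ℤ.+ 1ℤ) u ℤ.- D d m (sgn d) (sgn m) a (sgn a))
          (sym (sgn-suc a)))))

-- Polynomial shears

open Solver using (Expr; Κ; Ι; _⊕_; _⊗_; ⊝_; _⊛_)
open Solver.Ops using (⟦_⟧; norm; correct; homo)

private
  variable
    k n : ℕ

infixl 6 _+_ _-_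
infixl 7 _*_
infixr 7 _·_
infix  8 -_
infixr 9 _^_

_+_ _-_ _*_ : Expr ℤ n → Expr ℤ n → Expr ℤ n
_+_ = _⊕_
_*_ = _⊗_
x - y = x ⊕ (⊝ y)

-_ : Expr ℤ n → Expr ℤ n
-_ = ⊝_

num : ℤ → Expr ℤ n
num = Κ

_·_ : ℤ → Expr ℤ n → Expr ℤ n
c · x = Κ c ⊗ x

-- Unfolded into products so that evaluation follows the recursion of `ℤ._^_`.
_^_ : Expr ℤ n → ℕ → Expr ℤ n
x ^ zero  = Κ 1ℤ
x ^ suc k = x ⊗ x ^ k

poly : ∀ n → N-ary n (Expr ℤ n) (Expr ℤ n) → Expr ℤ n
poly n f = f $ⁿ tabulate Ι

infixl 10 _[_]
_[_] : Expr ℤ k → Vec (Expr ℤ n) k → Expr ℤ n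
Κ c     [ σ ] = Κ c
Ι i     [ σ ] = Vec.lookup σ i
(x ⊕ y) [ σ ] = x [ σ ] ⊕ y [ σ ]
(x ⊗ y) [ σ ] = x [ σ ] ⊗ y [ σ ]
(⊝ x)   [ σ ] = ⊝ (x [ σ ])
(x ⊛ i) [ σ ] = x [ σ ] ⊛ i

⟦_⟧* : Vec (Expr ℤ n) k → Vec ℤ n → Vec ℤ k
⟦ σ ⟧* ρ = Vec.map (λ e → ⟦ e ⟧ ρ) σ

⟦[]⟧ : (e : Expr ℤ k) (σ : Vec (Expr ℤ n) k) (ρ : Vec ℤ n) → ⟦ e [ σ ] ⟧ ρ ≡ ⟦ e ⟧ (⟦ σ ⟧* ρ)
⟦[]⟧ (Κ c)   σ ρ = refl
⟦[]⟧ (Ι i)   σ ρ = sym (lookup-map i (λ e → ⟦ e ⟧ ρ) σ)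
⟦[]⟧ (x ⊕ y) σ ρ = cong₂ ℤ._+_ (⟦[]⟧ x σ ρ) (⟦[]⟧ y σ ρ)
⟦[]⟧ (x ⊗ y) σ ρ = cong₂ ℤ._*_ (⟦[]⟧ x σ ρ) (⟦[]⟧ y σ ρ)
⟦[]⟧ (⊝ x)   σ ρ = cong ℤ.-_ (⟦[]⟧ x σ ρ)
⟦[]⟧ (x ⊛ i) σ ρ = ^-congˡ i (⟦[]⟧ x σ ρ)

infix 4 _≃_
-- Normal forms are closed data, so `refl` proves a polynomial identity for all values of the
-- variables at once. Signs are independent variables here, without the relation that their squares
-- are 1.
_≃_ : Expr ℤ n → Expr ℤ n → Set
e₁ ≃ e₂ = norm e₁ ≡ norm e₂

≃⇒≡ : (e₁ e₂ : Expr ℤ n) → e₁ ≃ e₂ → ∀ ρ → ⟦ e₁ ⟧ ρ ≡ ⟦ e₂ ⟧ ρ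
≃⇒≡ e₁ e₂ eq ρ = trans (sym (correct e₁ ρ))
  (trans (cong (λ p → Semantics.⟦_⟧ homo p ρ) eq) (correct e₂ ρ))

module Variables₈ where
  a b α β γ ξ η ζ : Expr ℤ 8
  a = Ι zero
  b = Ι (suc zero)
  α = Ι (suc (suc zero))
  β = Ι (suc (suc (suc zero)))
  γ = Ι (suc (suc (suc (suc zero))))
  ξ = Ι (suc (suc (suc (suc (suc zero)))))
  η = Ι (suc (suc (suc (suc (suc (suc zero))))))
  ζ = Ι (suc (suc (suc (suc (suc (suc (suc zero)))))))

  same negated swapped sheared₁ sheared₂ : Vec (Expr ℤ 8) 8
  same     = a ∷ b ∷ α ∷ β ∷ γ ∷ ξ ∷ η ∷ ζ ∷ []
  negated  = - a ∷ b ∷ α ∷ β ∷ γ ∷ ξ ∷ η ∷ ζ ∷ []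
  swapped  = b ∷ a ∷ β ∷ α ∷ γ ∷ η ∷ ξ ∷ ζ ∷ []
  sheared₁ = a + b ∷ b ∷ γ ∷ β ∷ α ∷ ξ ∷ ζ ∷ η ∷ []
  sheared₂ = a ∷ a + b ∷ α ∷ γ ∷ β ∷ ζ ∷ η ∷ ξ ∷ []

-- On the diagonal x = y the variables x and ε stand for a and (-1)^a.
module Variables₆ where
  d m δ μ x ε : Expr ℤ 6
  d = Ι zero
  m = Ι (suc zero)
  δ = Ι (suc (suc zero))
  μ = Ι (suc (suc (suc zero)))
  x = Ι (suc (suc (suc (suc zero))))
  ε = Ι (suc (suc (suc (suc (suc zero)))))

  diagonalΦ diagonalΨ : Vec (Expr ℤ 6) 8
  diagonalΦ = d ∷ d ∷ δ ∷ δ ∷ num 1ℤ ∷ ε ∷ μ * ε ∷ μ ∷ []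
  diagonalΨ = - x ∷ d - x ∷ ε ∷ δ * ε ∷ δ ∷ μ ∷ μ ∷ num 1ℤ ∷ []

  current next : Vec (Expr ℤ 6) 6
  current = d ∷ m ∷ δ ∷ μ ∷ x ∷ ε ∷ []
  next = d ∷ m ∷ δ ∷ μ ∷ x + num 1ℤ ∷ - ε ∷ []

-- At the end of a diagonal the running sign becomes δ or μ, and squares of signs appear. Normal
-- forms do not know that these are 1, so the signs are replaced by constants, one case for each
-- choice.
module Variables₂ (δ μ : ℤ) where
  d m : Expr ℤ 2
  d = Ι zero
  m = Ι (suc zero)

  signs : Vec (Expr ℤ 2) 4
  signs = d ∷ m ∷ num δ ∷ num μ ∷ []

  start endC endD : Vec (Expr ℤ 2) 6
  start = d ∷ m ∷ num δ ∷ num μ ∷ num 1ℤ ∷ num -1ℤ ∷ []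
  endC  = d ∷ m ∷ num δ ∷ num μ ∷ m ∷ num μ ∷ []
  endD  = d ∷ m ∷ num δ ∷ num μ ∷ d ∷ num δ ∷ []

Total : (C D : Expr ℤ 6) (g : Expr ℤ 4) (δ μ : ℤ) → Set
Total C D g δ μ = (C [ endC ] - C [ start ]) - (D [ endD ] - D [ start ]) ≃ + 2 · g [ signs ]
  where open Variables₂ δ μ

record PolynomialShear : Set where
  open Variables₈
  open Variables₆
  field
    Φ t : Expr ℤ 8
    C D : Expr ℤ 6
    g   : Expr ℤ 4
    shear₁ : Φ [ sheared₁ ] ≃ Φ [ negated ]
    shear₂ : Φ [ sheared₂ ] ≃ Φ [ negated ]
    defect : Φ [ same ] - Φ [ negated ] ≃ t [ same ] + t [ swapped ]
    ΔC     : Φ [ diagonalΦ ] ≃ C [ next ] - C [ current ]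
    ΔD     : Φ [ diagonalΨ ] ≃ D [ next ] - D [ current ]
    total₁ : Total C D g 1ℤ 1ℤ
    total₂ : Total C D g 1ℤ -1ℤ
    total₃ : Total C D g -1ℤ 1ℤ
    total₄ : Total C D g -1ℤ -1ℤ

toShear : PolynomialShear → Shear
toShear S = record
  { Φ      = eval₈ Φ
  ; t      = eval₈ t
  ; shear₁ = λ a b α β γ ξ η ζ → let ρ = a ∷ b ∷ α ∷ β ∷ γ ∷ ξ ∷ η ∷ ζ ∷ [] in
      sym (⟦[]⟧ Φ sheared₁ ρ) ⟨ trans ⟩ ≃⇒≡ (Φ [ sheared₁ ]) (Φ [ negated ]) shear₁ ρ ⟨ trans ⟩
      ⟦[]⟧ Φ negated ρ
  ; shear₂ = λ a b α β γ ξ η ζ → let ρ = a ∷ b ∷ α ∷ β ∷ γ ∷ ξ ∷ η ∷ ζ ∷ [] in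
      sym (⟦[]⟧ Φ sheared₂ ρ) ⟨ trans ⟩ ≃⇒≡ (Φ [ sheared₂ ]) (Φ [ negated ]) shear₂ ρ ⟨ trans ⟩
      ⟦[]⟧ Φ negated ρ
  ; defect = λ a b α β γ ξ η ζ → let ρ = a ∷ b ∷ α ∷ β ∷ γ ∷ ξ ∷ η ∷ ζ ∷ [] in
      sym (cong₂ ℤ._-_ (⟦[]⟧ Φ same ρ) (⟦[]⟧ Φ negated ρ)) ⟨ trans ⟩
      ≃⇒≡ (Φ [ same ] - Φ [ negated ]) (t [ same ] + t [ swapped ]) defect ρ ⟨ trans ⟩
      cong₂ ℤ._+_ (⟦[]⟧ t same ρ) (⟦[]⟧ t swapped ρ)
  ; C      = eval₆ C
  ; D      = eval₆ D
  ; ΔC     = λ d m δ μ x ε → let ρ = d ∷ m ∷ δ ∷ μ ∷ x ∷ ε ∷ [] in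
      sym (⟦[]⟧ Φ diagonalΦ ρ) ⟨ trans ⟩
      ≃⇒≡ (Φ [ diagonalΦ ]) (C [ next ] - C [ current ]) ΔC ρ ⟨ trans ⟩
      cong₂ ℤ._-_ (⟦[]⟧ C next ρ) (⟦[]⟧ C current ρ)
  ; ΔD     = λ d m δ μ x ε → let ρ = d ∷ m ∷ δ ∷ μ ∷ x ∷ ε ∷ [] in
      sym (⟦[]⟧ Φ diagonalΨ ρ) ⟨ trans ⟩
      ≃⇒≡ (Φ [ diagonalΨ ]) (D [ next ] - D [ current ]) ΔD ρ ⟨ trans ⟩
      cong₂ ℤ._-_ (⟦[]⟧ D next ρ) (⟦[]⟧ D current ρ)
  ; g      = eval₄ g
  ; total  = λ where
      d m (inj₁ refl) (inj₁ refl) → total 1ℤ 1ℤ total₁ d m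
      d m (inj₁ refl) (inj₂ refl) → total 1ℤ -1ℤ total₂ d m
      d m (inj₂ refl) (inj₁ refl) → total -1ℤ 1ℤ total₃ d m
      d m (inj₂ refl) (inj₂ refl) → total -1ℤ -1ℤ total₄ d m
  }
  where
  open PolynomialShear S
  open Variables₈ using (same; negated; swapped; sheared₁; sheared₂)
  open Variables₆ using (diagonalΦ; diagonalΨ; current; next)
  eval₈ : Expr ℤ 8 → Weight
  eval₈ e a b α β γ ξ η ζ = ⟦ e ⟧ (a ∷ b ∷ α ∷ β ∷ γ ∷ ξ ∷ η ∷ ζ ∷ [])
  eval₆ : Expr ℤ 6 → (d m δ μ x ε : ℤ) → ℤ
  eval₆ e d m δ μ x ε = ⟦ e ⟧ (d ∷ m ∷ δ ∷ μ ∷ x ∷ ε ∷ [])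
  eval₄ : Expr ℤ 4 → (d m δ μ : ℤ) → ℤ
  eval₄ e d m δ μ = ⟦ e ⟧ (d ∷ m ∷ δ ∷ μ ∷ [])
  total : ∀ δ μ → Total C D g δ μ → ∀ d m →
    (eval₆ C d m δ μ m μ ℤ.- eval₆ C d m δ μ 1ℤ -1ℤ) ℤ.-
    (eval₆ D d m δ μ d δ ℤ.- eval₆ D d m δ μ 1ℤ -1ℤ) ≡ + 2 ℤ.* eval₄ g d m δ μ
  total δ μ eq d m = let ρ = d ∷ m ∷ [] in
    sym (cong₂ ℤ._-_ (cong₂ ℤ._-_ (⟦[]⟧ C endC ρ) (⟦[]⟧ C start ρ))
      (cong₂ ℤ._-_ (⟦[]⟧ D endD ρ) (⟦[]⟧ D start ρ))) ⟨ trans ⟩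
    ≃⇒≡ ((C [ endC ] - C [ start ]) - (D [ endD ] - D [ start ])) (+ 2 · g [ signs ]) eq ρ ⟨ trans ⟩
    cong (+ 2 ℤ.*_) (⟦[]⟧ g signs ρ)
    where open Variables₂ δ μ using (signs; start; endC; endD)

-- Identities between Lambert series from polynomial shears

lambert : Expr ℤ 4 → Series
lambert e = Λ (λ d m → ⟦ e ⟧ (d ∷ m ∷ sgn d ∷ sgn m ∷ []))

lambert-cong : ∀ {e₁ e₂} → e₁ ≃ e₂ → lambert e₁ ≐ lambert e₂
lambert-cong {e₁} {e₂} eq n =
  ∑-cong (pairs n) λ { {d , m} _ → ≃⇒≡ e₁ e₂ eq (d ∷ m ∷ sgn d ∷ sgn m ∷ []) }

Linear Bilinear : Set
Linear   = List (ℤ × Expr ℤ 4)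
Bilinear = List (ℤ × Expr ℤ 4 × Expr ℤ 4)

linear-term : Linear → Expr ℤ 4
linear-term []            = Κ 0ℤ
linear-term ((c , u) ∷ l) = c · u + linear-term l

linear-series : Linear → Series
linear-series []            = const 0ℤ
linear-series ((c , u) ∷ l) = const c ⋆ lambert u ⊞ linear-series l

module VariablesQuad where
  a x α ξ b y β η : Expr ℤ 8
  a = Ι zero
  x = Ι (suc zero)
  α = Ι (suc (suc zero))
  ξ = Ι (suc (suc (suc zero)))
  b = Ι (suc (suc (suc (suc zero))))
  y = Ι (suc (suc (suc (suc (suc zero)))))
  β = Ι (suc (suc (suc (suc (suc (suc zero))))))
  η = Ι (suc (suc (suc (suc (suc (suc (suc zero)))))))

  first second : Vec (Expr ℤ 8) 4
  first  = a ∷ x ∷ α ∷ ξ ∷ []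
  second = b ∷ y ∷ β ∷ η ∷ []

  -- Writing the signs of a + b and x + y as αβ and ξη makes `t` a combination of products of a term
  -- in (a, x) and a term in (b, y).
  paired : Vec (Expr ℤ 8) 8
  paired = a ∷ b ∷ α ∷ β ∷ α * β ∷ ξ ∷ η ∷ ξ * η ∷ []

open VariablesQuad using (first; second; paired)

bilinear-term : Bilinear → Expr ℤ 8
bilinear-term []                = Κ 0ℤ
bilinear-term ((c , u , v) ∷ w) =
  c · (u [ first ] * v [ second ]) + bilinear-term w

bilinear-series : Bilinear → Series
bilinear-series []                = const 0ℤ
bilinear-series ((c , u , v) ∷ w) = const c ⋆ (lambert u ⋆ lambert v) ⊞ bilinear-series w

∑-0 : ∀ {A : Set} {P : A → Set} (E : Enum P) → ∑ E (λ _ → 0ℤ) ≡ 0ℤ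
∑-0 E = ∑-* 0ℤ E (λ _ → 0ℤ)

lambert-linear : ∀ l → lambert (linear-term l) ≐ linear-series l
lambert-linear [] n = trans (∑-0 (pairs n)) (const-0 n)
lambert-linear ((c , u) ∷ l) n = begin
  lambert (c · u + linear-term l) n
    ≡⟨ ∑-+ (pairs n) _ _ ⟩
  ∑ (pairs n) (λ (d , m) → c ℤ.* ⟦ u ⟧ (d ∷ m ∷ sgn d ∷ sgn m ∷ [])) ℤ.+ lambert (linear-term l) n
    ≡⟨ cong₂ ℤ._+_ (trans (∑-* c (pairs n) _) (sym (const-⋆ c (lambert u) n)))
        (lambert-linear l n) ⟩
  (const c ⋆ lambert u) n ℤ.+ linear-series l n ∎
  where open ≡-Reasoning

variables : Quad → Vec ℤ 8
variables ((a , x) , (b , y)) = a ∷ x ∷ sgn a ∷ sgn x ∷ b ∷ y ∷ sgn b ∷ sgn y ∷ []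

∑-bilinear : ∀ w n → ∑ (quads n) (λ z → ⟦ bilinear-term w ⟧ (variables z)) ≡ bilinear-series w n
∑-bilinear [] n = trans (∑-0 (quads n)) (const-0 n)
∑-bilinear ((c , u , v) ∷ w) n = begin
  ∑ (quads n) (λ z → ⟦ bilinear-term ((c , u , v) ∷ w) ⟧ (variables z))
    ≡⟨ ∑-+ (quads n) _ _ ⟩
  ∑ (quads n) (λ z → c ℤ.* (⟦ u [ first ] ⟧ (variables z) ℤ.* ⟦ v [ second ] ⟧ (variables z))) ℤ.+
  ∑ (quads n) (λ z → ⟦ bilinear-term w ⟧ (variables z))
    ≡⟨ cong₂ ℤ._+_ (trans (∑-* c (quads n) _) (trans (cong (c ℤ.*_) product)
         (sym (const-⋆ c (lambert u ⋆ lambert v) n)))) (∑-bilinear w n) ⟩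
  (const c ⋆ (lambert u ⋆ lambert v)) n ℤ.+ bilinear-series w n ∎
  where
  open ≡-Reasoning
  product : ∑ (quads n) (λ z → ⟦ u [ first ] ⟧ (variables z) ℤ.* ⟦ v [ second ] ⟧ (variables z)) ≡
    (lambert u ⋆ lambert v) n
  product = trans
    (∑-cong (quads n) λ { {z} _ →
        cong₂ ℤ._*_ (⟦[]⟧ u first (variables z)) (⟦[]⟧ v second (variables z)) })
    (sym (Λ-⋆ (λ d m → ⟦ u ⟧ (d ∷ m ∷ sgn d ∷ sgn m ∷ []))
        (λ d m → ⟦ v ⟧ (d ∷ m ∷ sgn d ∷ sgn m ∷ [])) n))

module _ (S : PolynomialShear) (w : Bilinear) (l : Linear) where
  open PolynomialShear S

  -- Once `t` is separated by `w`, its sum over quadruples is a combination of Cauchy products;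
  -- splitting `g` by `l` turns the right-hand side into single Lambert series.
  convolution-identity :
    t [ paired ] ≃ bilinear-term w → g ≃ linear-term l →
    bilinear-series w ≐ linear-series l
  convolution-identity t≃ g≃ n = begin
    bilinear-series w n
      ≡⟨ sym (∑-bilinear w n) ⟩
    ∑ (quads n) (λ z → ⟦ bilinear-term w ⟧ (variables z))
      ≡⟨ ∑-cong (quads n) (λ { {z@((a , x) , (b , y))} _ →
           sym (≃⇒≡ (t [ paired ]) (bilinear-term w) t≃ (variables z)) ⟨ trans ⟩
           ⟦[]⟧ t paired (variables z) ⟨ trans ⟩
           cong₂ (λ i j → ⟦ t ⟧ (a ∷ b ∷ sgn a ∷ sgn b ∷ i ∷ sgn x ∷ sgn y ∷ j ∷ []))
             (sym (sgn-+ a b)) (sym (sgn-+ x y)) }) ⟩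
    ∑ (quads n) (at (Shear.t (toShear S)))
      ≡⟨ Shear.convolution (toShear S) n ⟩
    lambert g n
      ≡⟨ lambert-cong {g} {linear-term l} g≃ n ⟩
    lambert (linear-term l) n
      ≡⟨ lambert-linear l n ⟩
    linear-series l n ∎
    where open ≡-Reasoning

u w : ℕ → Expr ℤ 4
u k = poly 4 λ d m δ μ → δ * μ * d ^ k
w k = poly 4 λ d m δ μ → δ * d ^ k

o p : Expr ℤ 4
o = poly 4 λ d m δ μ → d - δ * d
p = poly 4 λ d m δ μ → d - μ * d

-- In each case Φ was found by linear algebra from the required t; C and D are then sums of
-- Bernoulli and Euler polynomials.
shear-P′U₁ : PolynomialShear
shear-P′U₁ = record
  { Φ = poly 8 λ a b α β γ ξ η ζ →
      + 2 · (β * η * (+ 2 · (a * b) - b ^ 2)) + + 2 · (α * ξ * (+ 2 · (a * b) - a ^ 2))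
      + + 2 · (β * ζ * (b ^ 2 - + 2 · (a * b))) + + 2 · (α * ζ * (a ^ 2 - + 2 · (a * b)))
      + + 2 · (γ * η * (a ^ 2 - b ^ 2)) + + 2 · (γ * ξ * (b ^ 2 - a ^ 2))
  ; t = poly 8 λ a b α β γ ξ η ζ → + 8 · (β * η * (a * b)) - + 8 · (β * ζ * (a * b))
  ; C = poly 6 λ d m δ μ x ξ →
      - (δ * μ * ξ * (d ^ 2)) - δ * ξ * (d ^ 2) - + 4 · (δ * μ * (d ^ 2 * x))
  ; D = poly 6 λ d m δ μ a α →
      δ * α * (a ^ 2 - d ^ 2 - a) + δ * μ * α * (d ^ 2 + a - a ^ 2)
      + μ * α * (+ 2 · (d * a) + a - d - a ^ 2) + α * (d + a ^ 2 - + 2 · (d * a) - a)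
  ; g = poly 4 λ d m δ μ → d - μ * d - + 2 · (δ * μ * (d ^ 2 * m))
  ; shear₁ = refl
  ; shear₂ = refl
  ; defect = refl
  ; ΔC = refl
  ; ΔD = refl
  ; total₁ = refl
  ; total₂ = refl
  ; total₃ = refl
  ; total₄ = refl
  }

shear-U₁U₁ : PolynomialShear
shear-U₁U₁ = record
  { Φ = poly 8 λ a b α β γ ξ η ζ →
      + 2 · (γ * ζ * (+ 2 · (a * b) - b ^ 2 - a ^ 2)) - + 2 · (β * ξ * (b ^ 2))
      - + 2 · (α * η * (a ^ 2))
  ; t = poly 8 λ a b α β γ ξ η ζ → + 4 · (γ * ζ * (a * b))
  ; C = poly 6 λ d m δ μ x ξ → δ * ξ * (d ^ 2) + δ * μ * ξ * (d ^ 2)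
  ; D = poly 6 λ d m δ μ a α →
      δ * μ * α * (d ^ 2 + d + a ^ 2 - + 2 · (d * a) - a) + μ * α * (a ^ 2 - a)
      - + 2 · (δ * (d ^ 2 * a))
  ; g = poly 4 λ d m δ μ → δ * (d ^ 3) + δ * μ * d
  ; shear₁ = refl
  ; shear₂ = refl
  ; defect = refl
  ; ΔC = refl
  ; ΔD = refl
  ; total₁ = refl
  ; total₂ = refl
  ; total₃ = refl
  ; total₄ = refl
  }

shear-OU₁ : PolynomialShear
shear-OU₁ = record
  { Φ = poly 8 λ a b α β γ ξ η ζ →
      + 6 · (β * η * (+ 2 · (a * b) - a ^ 2)) + + 6 · (α * ξ * (+ 2 · (a * b) - b ^ 2))
      + + 6 · (β * ζ * (b ^ 2 - a ^ 2)) + + 6 · (α * ζ * (a ^ 2 - b ^ 2))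
      + + 6 · (γ * η * (a ^ 2 - + 2 · (a * b))) + + 6 · (γ * ξ * (b ^ 2 - + 2 · (a * b)))
  ; t = poly 8 λ a b α β γ ξ η ζ → + 24 · (β * η * (a * b)) - + 24 · (γ * η * (a * b))
  ; C = poly 6 λ d m δ μ x ξ →
      + 3 · (μ * ξ * (d ^ 2)) + + 3 · (ξ * (d ^ 2)) - + 3 · (δ * μ * ξ * (d ^ 2))
      - + 3 · (δ * ξ * (d ^ 2))
  ; D = poly 6 λ d m δ μ a α →
      + 3 · (δ * α * (+ 2 · (d * a) - d ^ 2 - d))
      + + 2 · (δ * μ * (+ 3 · (d ^ 2 * a) + + 3 · (a ^ 2) + + 3 · (d * a ^ 2) - + 2 · (a ^ 3)
        - a - + 3 · (d * a))) + + 3 · (δ * μ * α * (+ 2 · (d * a) + a - d - a ^ 2))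
      + + 3 · (α * (d ^ 2 + d - + 2 · (d * a))) + + 3 · (μ * α * (d ^ 2 + a - a ^ 2))
  ; g = poly 4 λ d m δ μ → + 3 · d - + 3 · (δ * d) - + 2 · (δ * μ * (d + + 2 · (d ^ 3)))
  ; shear₁ = refl
  ; shear₂ = refl
  ; defect = refl
  ; ΔC = refl
  ; ΔD = refl
  ; total₁ = refl
  ; total₂ = refl
  ; total₃ = refl
  ; total₄ = refl
  }

shear-U₁W₃ : PolynomialShear
shear-U₁W₃ = record
  { Φ = poly 8 λ a b α β γ ξ η ζ →
      + 12 · (β * η * (a ^ 2 * b ^ 2 - + 2 · (a * b ^ 3)))
      + + 12 · (α * ξ * (a ^ 2 * b ^ 2 - + 2 · (a ^ 3 * b)))
      + + 12 · (β * ζ * (a ^ 2 * b ^ 2 - b ^ 4)) + + 12 · (α * ζ * (a ^ 2 * b ^ 2 - a ^ 4))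
      + + 12 · (γ * η * (+ 2 · (a * b ^ 3) + + 4 · (a ^ 3 * b) - + 5 · (a ^ 2 * b ^ 2) - a ^ 4))
      + + 12 · (γ * ξ * (+ 2 · (a ^ 3 * b) + + 4 · (a * b ^ 3) - + 5 · (a ^ 2 * b ^ 2) - b ^ 4))
  ; t = poly 8 λ a b α β γ ξ η ζ →
      + 96 · (γ * ξ * (a * b ^ 3)) + + 48 · (γ * η * (a * b ^ 3)) - + 48 · (β * η * (a * b ^ 3))
  ; C = poly 6 λ d m δ μ x ξ → + 6 · (δ * μ * ξ * (d ^ 4)) + + 6 · (δ * ξ * (d ^ 4))
  ; D = poly 6 λ d m δ μ a α →
      + 3 · (δ * α * (+ 2 · (d ^ 4) + + 4 · (d ^ 3) + + 10 · (d ^ 2 * a ^ 2)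
        + + 6 · (d * a ^ 2) - + 8 · (d ^ 3 * a) - + 10 · (d ^ 2 * a) - d - + 4 · (d * a ^ 3)))
      + + 4 · (δ * μ * (+ 2 · (d ^ 2 * a ^ 3) + d ^ 2 * a + + 3 · (d ^ 3 * a)
        - + 3 · (d ^ 4 * a) - + 3 · (d ^ 2 * a ^ 2) - + 3 · (d ^ 3 * a ^ 2)))
      + + 6 · (δ * μ * α * (d ^ 3 + + 5 · (d ^ 2 * a ^ 2) + + 6 · (d * a ^ 2) + a
        + a ^ 4 - + 2 · (d ^ 3 * a) - + 5 · (d ^ 2 * a) - d - + 4 · (d * a ^ 3) - + 2 · (a ^ 3)))
      + + 6 · (μ * α * (d ^ 2 * a + a + a ^ 4 - d ^ 2 * a ^ 2 - + 2 · (a ^ 3)))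
      + + 3 · (α * (+ 2 · (d ^ 2 * a) + d + + 4 · (d * a ^ 3) - + 2 · (d ^ 2 * a ^ 2)
        - + 6 · (d * a ^ 2)))
  ; g = poly 4 λ d m δ μ →
      + 2 · (δ * μ * (+ 4 · (d ^ 5) + + 2 · (d ^ 3) - + 3 · d)) + + 3 · d
      + + 3 · (δ * (+ 4 · (d ^ 3) - d))
  ; shear₁ = refl
  ; shear₂ = refl
  ; defect = refl
  ; ΔC = refl
  ; ΔD = refl
  ; total₁ = refl
  ; total₂ = refl
  ; total₃ = refl
  ; total₄ = refl
  }

shear-OW₃ : PolynomialShear
shear-OW₃ = record
  { Φ = poly 8 λ a b α β γ ξ η ζ →
      + 24 · (β * (a * b ^ 3 - a ^ 2 * b ^ 2)) + + 24 · (α * (a ^ 3 * b - a ^ 2 * b ^ 2))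
      + + 24 · (γ * (+ 2 · (a ^ 2 * b ^ 2) - a * b ^ 3 - a ^ 3 * b))
  ; t = poly 8 λ a b α β γ ξ η ζ → + 48 · (β * (a * b ^ 3)) - + 48 · (γ * (a * b ^ 3))
  ; C = poly 6 λ d m δ μ x ξ → num 0ℤ
  ; D = poly 6 λ d m δ μ a α →
      + 3 · (δ * α * (+ 4 · (d ^ 3 * a) + + 8 · (d ^ 2 * a) + d + + 4 · (d * a ^ 3)
        - + 2 · (d ^ 3) - + 8 · (d ^ 2 * a ^ 2) - + 6 · (d * a ^ 2)))
      + + 4 · (δ * (+ 3 · (d ^ 3 * a ^ 2) + + 3 · (d ^ 2 * a ^ 2) - + 3 · (d ^ 3 * a)
        - + 2 · (d ^ 2 * a ^ 3) - d ^ 2 * a))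
      + + 3 · (α * (+ 4 · (d ^ 2 * a ^ 2) + + 6 · (d * a ^ 2) - + 4 · (d ^ 2 * a) - d
        - + 4 · (d * a ^ 3)))
  ; g = poly 4 λ d m δ μ → δ * (+ 3 · d - + 2 · (d ^ 5) - + 4 · (d ^ 3)) - + 3 · d
  ; shear₁ = refl
  ; shear₂ = refl
  ; defect = refl
  ; ΔC = refl
  ; ΔD = refl
  ; total₁ = refl
  ; total₂ = refl
  ; total₃ = refl
  ; total₄ = refl
  }

shear-W₃W₃ : PolynomialShear
shear-W₃W₃ = record
  { Φ = poly 8 λ a b α β γ ξ η ζ →
      + 12 · (β * (a ^ 2 * b ^ 4 - a * b ^ 5)) + + 12 · (α * (a ^ 4 * b ^ 2 - a ^ 5 * b))
      + + 12 · (γ * (a * b ^ 5 + a ^ 5 * b + + 6 · (a ^ 3 * b ^ 3)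
        - + 4 · (a ^ 2 * b ^ 4) - + 4 · (a ^ 4 * b ^ 2)))
  ; t = poly 8 λ a b α β γ ξ η ζ →
      + 24 · (γ * (+ 3 · (a ^ 3 * b ^ 3) + a * b ^ 5)) - + 24 · (β * (a * b ^ 5))
  ; C = poly 6 λ d m δ μ x ξ → num 0ℤ
  ; D = poly 6 λ d m δ μ a α →
      + 3 · (δ * α * (d ^ 5 + + 8 · (d ^ 4 * a ^ 2) + + 18 · (d ^ 3 * a ^ 2)
        + + 8 · (d ^ 2 * a) + + 8 · (d ^ 2 * a ^ 4) + d + + 5 · (d * a ^ 4)
        - + 2 · (d ^ 5 * a) - + 8 · (d ^ 4 * a) - + 3 · (d ^ 3)
        - + 12 · (d ^ 3 * a ^ 3) - + 16 · (d ^ 2 * a ^ 3) - + 5 · (d * a ^ 2)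
        - + 2 · (d * a ^ 5)))
      + + 2 · (δ * (+ 3 · (d ^ 5 * a) + + 2 · (d ^ 4 * a ^ 3) + d ^ 4 * a
        - + 3 · (d ^ 5 * a ^ 2) - + 3 · (d ^ 4 * a ^ 2)))
      + + 3 · (α * (+ 4 · (d ^ 2 * a ^ 3) + + 5 · (d * a ^ 2) + + 2 · (d * a ^ 5)
        - + 2 · (d ^ 2 * a) - + 2 · (d ^ 2 * a ^ 4) - d - + 5 · (d * a ^ 4)))
  ; g = poly 4 λ d m δ μ → δ * (d ^ 7 + + 3 · d + + 2 · (d ^ 5) - + 9 · (d ^ 3)) - + 3 · d
  ; shear₁ = refl
  ; shear₂ = refl
  ; defect = refl
  ; ΔC = refl
  ; ΔD = refl
  ; total₁ = refl
  ; total₂ = refl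
  ; total₃ = refl
  ; total₄ = refl
  }

-- On the diagonal a = b, part of Φ does not depend on x and is summed over m - 1 values. This
-- produces the term with the factor `d * m`, which equals n and so becomes the derivative of U₁.
convolution-P′U₁ = convolution-identity shear-P′U₁ ((+ 8 , p , u 1) ∷ [])
  ((+ 1 , p) ∷ (ℤ.- + 2 , poly 4 (λ d m δ μ → d * m * (δ * μ * d ^ 1))) ∷ []) refl refl

convolution-U₁U₁ = convolution-identity shear-U₁U₁ ((+ 4 , u 1 , u 1) ∷ [])
  ((+ 1 , w 3) ∷ (+ 1 , u 1) ∷ []) refl refl

convolution-OU₁ = convolution-identity shear-OU₁ ((+ 24 , o , u 1) ∷ [])
  ((+ 3 , o) ∷ (ℤ.- + 2 , u 1) ∷ (ℤ.- + 4 , u 3) ∷ []) refl refl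

-- The left-hand combination is a quarter of the bilinear part of 3 v₁ w₃ - ε v₃.
convolution-U₁W₃ = convolution-identity shear-U₁W₃ ((+ 96 , u 1 , w 3) ∷ (ℤ.- + 48 , o , u 3) ∷ [])
  ((+ 8 , u 5) ∷ (+ 3 , o) ∷ (+ 4 , u 3) ∷ (ℤ.- + 6 , u 1) ∷ (+ 12 , w 3) ∷ []) refl refl

convolution-OW₃ = convolution-identity shear-OW₃ ((+ 48 , o , w 3) ∷ [])
  ((ℤ.- + 2 , w 5) ∷ (ℤ.- + 3 , o) ∷ (ℤ.- + 4 , w 3) ∷ []) refl refl

-- The left-hand combination is 1/32 of the bilinear part of 8 ε w₅ + 9 w₃².
convolution-W₃W₃ = convolution-identity shear-W₃W₃ ((+ 72 , w 3 , w 3) ∷ (ℤ.- + 24 , o , w 5) ∷ [])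
  ((+ 1 , w 7) ∷ (ℤ.- + 3 , o) ∷ (+ 2 , w 5) ∷ (ℤ.- + 9 , w 3) ∷ []) refl refl

-- Sums of squares and the theta series

-- Read off from the bijection `r-counts`: one inverse law gives completeness, the other the absence
-- of repetitions.
solutionsᴱ : ∀ s n → Enum (λ (v : Vec ℤ s) → sumOfSquares v ≡ + n)
solutionsᴱ s n = record
  { list     = map (proj₁ ∘ to′) (allFin (r s n))
  ; unique   = Unique.map⁺ injective (Unique.allFin⁺ (r s n))
  ; sound    = λ v∈ → sound′ (∈-map⁻ (proj₁ ∘ to′) v∈)
  ; complete = λ {v} eq → subst (_∈ map (proj₁ ∘ to′) (allFin (r s n)))
      (cong proj₁ (Inverse.strictlyInverseˡ (r-counts s n) (v , eq)))
      (∈-map⁺ (proj₁ ∘ to′) (∈-allFin (Inverse.from (r-counts s n) (v , eq))))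
  }
  where
  to′ = Inverse.to (r-counts s n)
  ext : ∀ {p q : Σ (Vec ℤ s) (λ v → sumOfSquares v ≡ + n)} → proj₁ p ≡ proj₁ q → p ≡ q
  ext {_ , p} {_ , q} refl = cong (_ ,_) (uip p q)
  injective : ∀ {i j} → proj₁ (to′ i) ≡ proj₁ (to′ j) → i ≡ j
  injective {i} {j} eq = trans (sym (Inverse.strictlyInverseʳ (r-counts s n) i))
    (trans (cong (Inverse.from (r-counts s n)) (ext eq))
        (Inverse.strictlyInverseʳ (r-counts s n) j))
  sound′ : ∀ {v} → ∃[ i ] (i ∈ allFin (r s n) × v ≡ proj₁ (to′ i)) → sumOfSquares v ≡ + n
  sound′ (i , _ , refl) = proj₂ (to′ i)

R : ℕ → Series
R s n = + r s n

R-as-∑ : ∀ s n → R s n ≡ ∑ (solutionsᴱ s n) (λ _ → 1ℤ)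
R-as-∑ s n = sym (trans (count (list (solutionsᴱ s n)))
  (cong +_ (trans (length-map (proj₁ ∘ Inverse.to (r-counts s n)) (allFin (r s n)))
      (length-tabulate id))))
  where
  count : ∀ {A : Set} (xs : List A) → sumℤ (map (λ _ → 1ℤ) xs) ≡ + length xs
  count []       = refl
  count (x ∷ xs) = +-congˡ 1ℤ (count xs)

roots : ∀ n → Enum (λ k → k ℤ.* k ≡ + n)
roots n = solutionsᴱ 1 n ⟫ record
  { to      = Vec.head
  ; from    = λ k → k ∷ []
  ; to-∈    = λ { {k ∷ []} eq → trans (lemma k) eq }
  ; from-∈  = λ {k} eq → trans (sym (lemma k)) eq
  ; from∘to = λ { {k ∷ []} _ → refl }
  ; to∘from = λ _ → refl
  }
  where
  lemma : ∀ k → k ℤ.* k ≡ k ℤ.* (k ℤ.* 1ℤ) ℤ.+ 0ℤ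
  lemma = solve-∀

0≤k*k : ∀ k → 0ℤ ℤ.≤ k ℤ.* k
0≤k*k (+ zero)  = +≤+ z≤n
0≤k*k (+ suc k) = +≤+ z≤n
0≤k*k -[1+ k ]  = +≤+ z≤n

0≤sumOfSquares : ∀ {s} (v : Vec ℤ s) → 0ℤ ℤ.≤ sumOfSquares v
0≤sumOfSquares []      = +≤+ z≤n
0≤sumOfSquares (k ∷ v) = ℤ.+-mono-≤
    (subst (0ℤ ℤ.≤_) (cong (k ℤ.*_) (sym (ℤ.*-identityʳ k))) (0≤k*k k)) (0≤sumOfSquares v)

R₁ : Series
R₁ n = ∑ (roots n) (λ _ → 1ℤ)

-- Splits off the first coordinate k of a solution; the degree in the Cauchy product is j = k².
R-suc : ∀ s → R (suc s) ≐ R₁ ⋆ R s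
R-suc s n = begin
  R (suc s) n
    ≡⟨ R-as-∑ (suc s) n ⟩
  ∑ (solutionsᴱ (suc s) n) (λ _ → 1ℤ)
    ≡⟨ sym (∑-bij (graded roots (solutionsᴱ s) n) (solutionsᴱ (suc s) n) cons
        {F = λ _ → 1ℤ ℤ.* 1ℤ} (λ _ → refl)) ⟩
  ∑ (graded roots (solutionsᴱ s) n) (λ _ → 1ℤ ℤ.* 1ℤ)
    ≡⟨ ∑-graded roots (solutionsᴱ s) (λ _ → 1ℤ) (λ _ → 1ℤ) n ⟩
  (R₁ ⋆ (λ j → ∑ (solutionsᴱ s j) (λ _ → 1ℤ))) n
    ≡⟨ ⋆-cong {f = R₁} (λ _ → refl) (λ j → sym (R-as-∑ s j)) n ⟩
  (R₁ ⋆ R s) n ∎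
  where
  open ≡-Reasoning
  square : ∀ k → k ℤ.* (k ℤ.* 1ℤ) ≡ k ℤ.* k
  square = solve-∀
  cons : (λ ((j , (k , v)) : ℕ × (ℤ × Vec ℤ s)) →
           j ℕ.≤ n × k ℤ.* k ≡ + j × sumOfSquares v ≡ + (n ∸ j)) ≅
         (λ v → sumOfSquares v ≡ + n)
  cons = record
    { to      = λ (_ , (k , v)) → k ∷ v
    ; from    = λ { (k ∷ v) → ∣ k ℤ.* k ∣ , (k , v) }
    ; to-∈    = λ { {_ , (k , v)} (j≤n , eq , eq′) →
        trans (cong₂ ℤ._+_ (trans (square k) eq) eq′) (cong +_ (ℕ.m+[n∸m]≡n j≤n)) }
    ; from-∈  = λ { {k ∷ v} eq → nonneg-split (0≤k*k k) (0≤sumOfSquares v)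
        (trans (cong (ℤ._+ sumOfSquares v) (sym (square k))) eq) }
    ; from∘to = λ { {_ , p} (_ , eq , _) → cong (_, p) (cong ∣_∣ eq) }
    ; to∘from = λ { {k ∷ v} _ → refl }
    }

θ : Series
θ n = ∑ (roots n) sgn

sgn-square : ∀ k → sgn (k ℤ.* k) ≡ sgn k
sgn-square k = trans (cong (-1ℤ ℤ.^_) (ℤ.abs-* k k))
    (trans (sym (ℤ.^-*-assoc -1ℤ ∣ k ∣ ∣ k ∣)) (go (sgn-cases k)))
  where
  go : IsSign (sgn k) → sgn k ℤ.^ ∣ k ∣ ≡ sgn k
  go (inj₁ eq) = trans (cong (ℤ._^ ∣ k ∣) eq) (trans (ℤ.^-zeroˡ ∣ k ∣) (sym eq))
  -- As `sgn k` is -1 here, its power with exponent `∣ k ∣` is `sgn k` again.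
  go (inj₂ eq) = cong (ℤ._^ ∣ k ∣) eq

twist-R₁ : twist R₁ ≐ θ
twist-R₁ n = trans (sym (∑-* (-1ℤ ℤ.^ n) (roots n) (λ _ → 1ℤ)))
  (∑-cong (roots n) λ {k} eq → trans (ℤ.*-identityʳ _) (trans (cong sgn (sym eq)) (sgn-square k)))

twist-R-suc : ∀ s → twist (R (suc s)) ≐ θ ⋆ twist (R s)
twist-R-suc s n = trans (cong (-1ℤ ℤ.^ n ℤ.*_) (R-suc s n)) (trans (twist-⋆ R₁ (R s) n)
  (⋆-cong {g = twist (R s)} twist-R₁ (λ _ → refl) n))

twist-R-zero : twist (R 0) ≐ const 1ℤ
twist-R-zero zero    = refl
twist-R-zero (suc n) = ℤ.*-zeroʳ (-1ℤ ℤ.^ suc n)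

Form : Set
Form = (ℤ × ℤ) × ℤ

IsForm : ℕ → Form → Set
IsForm n ((a , x) , k) = (Pos a × Pos x) × a ℤ.* x ℤ.+ k ℤ.* k ≡ + n

pairs≅forms : ∀ n →
  (λ ((j , (p , k)) : ℕ × Form) → j ℕ.≤ n × IsPair j p × k ℤ.* k ≡ + (n ∸ j)) ≅ IsForm n
pairs≅forms n = record
  { to      = proj₂
  ; from    = λ { ((a , x) , k) → ∣ a ℤ.* x ∣ , ((a , x) , k) }
  ; to-∈    = λ { (j≤n , (0<a , 0<x , eq) , eq′) →
      (0<a , 0<x) , trans (cong₂ ℤ._+_ eq eq′) (cong +_ (ℕ.m+[n∸m]≡n j≤n)) }
  ; from-∈  = λ { {(a , x) , k} ((0<a , 0<x) , eq) →
      let (j≤n , eqˡ , eqʳ) = nonneg-split (ℤ.<⇒≤ (pos-* 0<a 0<x)) (0≤k*k k) eq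
      in j≤n , (0<a , 0<x , eqˡ) , eqʳ }
  ; from∘to = λ { {_ , p} (_ , (_ , _ , eq) , _) → cong (_, p) (cong ∣_∣ eq) }
  ; to∘from = λ _ → refl
  }

forms : ∀ n → Enum (IsForm n)
forms n = graded pairs roots n ⟫ pairs≅forms n

Λ-⋆-θ : ∀ c n → (Λ c ⋆ θ) n ≡ ∑ (forms n) (λ ((a , x) , k) → c a x ℤ.* sgn k)
Λ-⋆-θ c n = trans
  (sym (∑-graded pairs roots (λ (a , x) → c a x) sgn n))
  (∑-bij (graded pairs roots n) (forms n) (pairs≅forms n) (λ _ → refl))

-- The differential equation of θ

∑-antisymmetric : ∀ {A : Set} {P : A → Set} (E : Enum P) (b : P ≅ P) (F : A → ℤ) →
  (∀ {z} → P z → F (to b z) ≡ ℤ.- F z) → ∑ E F ≡ 0ℤ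
∑-antisymmetric E b F anti = ℤ.*-cancelˡ-≡ (+ 2) (∑ E F) 0ℤ (trans (double (∑ E F))
  (trans (+-congˡ (∑ E F) ∑≡-∑) (ℤ.+-inverseʳ (∑ E F))))
  where
  double : ∀ s → + 2 ℤ.* s ≡ s ℤ.+ s
  double = solve-∀
  ∑≡-∑ : ∑ E F ≡ ℤ.- ∑ E F
  ∑≡-∑ = trans (∑-bij E E b {G = λ z → ℤ.- F z} λ {z} pz →
      sym (trans (cong ℤ.-_ (anti pz)) (ℤ.neg-involutive (F z)))) (∑-neg E F)

pos-cancel : ∀ {a b} → Pos (b ℤ.- a) → a ℤ.< b
pos-cancel {a} {b} p = subst₂ ℤ._<_ (ℤ.+-identityˡ a) (lemma a b) (ℤ.+-monoˡ-< a p)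
  where
  lemma : ∀ a b → b ℤ.- a ℤ.+ a ≡ b
  lemma = solve-∀

module _ (n : ℕ) where

  -- The difference of `slope` and `third` is a + 2k - x, the value at (1, 1) of the form a X² + 2k
  -- XY - x Y². Its sign separates `IsB`, `IsC` and `IsZ`.
  slope : Form → ℤ
  slope ((a , x) , k) = a ℤ.+ (k ℤ.+ k)

  third : Form → ℤ
  third ((a , x) , k) = x

  negate : Form → Form
  negate ((a , x) , k) = (a , x) , ℤ.- k

  -- Replaces the form f(X, Y) by -f(Y, X). The value at (1, 1) changes sign, so `IsB` and `IsC` are
  -- exchanged.
  transpose : Form → Form
  transpose ((a , x) , k) = (x , a) , ℤ.- k

  -- Replaces the form f(X, Y) by f(X, X - Y). This exchanges the values at (1, 0) and (1, 1), which
  -- are both positive on `IsC`.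
  reflect : Form → Form
  reflect ((a , x) , k) = (a ℤ.+ (k ℤ.+ k) ℤ.- x , x) , x ℤ.- k

  IsB IsC IsZ : Form → Set
  IsB z = IsForm n z × slope z ℤ.< third z
  IsC z = IsForm n z × third z ℤ.< slope z
  IsZ z = IsForm n z × slope z ≡ third z

  negate-≅ : IsForm n ≅ IsForm n
  negate-≅ = record
    { to      = negate
    ; from    = negate
    ; to-∈    = λ { {(a , x) , k} → flip a x k }
    ; from-∈  = λ { {(a , x) , k} → flip a x k }
    ; from∘to = λ { {(a , x) , k} _ → cong ((a , x) ,_) (ℤ.neg-involutive k) }
    ; to∘from = λ { {(a , x) , k} _ → cong ((a , x) ,_) (ℤ.neg-involutive k) }
    }
    where
    lemma : ∀ a x k → a ℤ.* x ℤ.+ (ℤ.- k) ℤ.* (ℤ.- k) ≡ a ℤ.* x ℤ.+ k ℤ.* k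
    lemma = solve-∀
    flip : ∀ a x k → IsForm n ((a , x) , k) → IsForm n ((a , x) , ℤ.- k)
    flip a x k (p , eq) = p , trans (lemma a x k) eq

  transpose-form : ∀ a x k → IsForm n ((a , x) , k) → IsForm n ((x , a) , ℤ.- k)
  transpose-form a x k ((0<a , 0<x) , eq) = (0<x , 0<a) , trans (lemma a x k) eq
    where
    lemma : ∀ a x k → x ℤ.* a ℤ.+ (ℤ.- k) ℤ.* (ℤ.- k) ≡ a ℤ.* x ℤ.+ k ℤ.* k
    lemma = solve-∀

  transpose-≅ : IsB ≅ IsC
  transpose-≅ = record
    { to      = transpose
    ; from    = transpose
    ; to-∈    = λ { {(a , x) , k} (p , lt) → transpose-form a x k p ,
        pos-cancel (subst Pos (lemma a x k) (pos-- lt)) }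
    ; from-∈  = λ { {(a , x) , k} (p , lt) → transpose-form a x k p ,
        pos-cancel (subst Pos (lemma′ a x k) (pos-- lt)) }
    ; from∘to = λ { {(a , x) , k} _ → cong ((a , x) ,_) (ℤ.neg-involutive k) }
    ; to∘from = λ { {(a , x) , k} _ → cong ((a , x) ,_) (ℤ.neg-involutive k) }
    }
    where
    lemma : ∀ a x k → x ℤ.- (a ℤ.+ (k ℤ.+ k)) ≡ x ℤ.+ ((ℤ.- k) ℤ.+ (ℤ.- k)) ℤ.- a
    lemma = solve-∀
    lemma′ : ∀ a x k → a ℤ.+ (k ℤ.+ k) ℤ.- x ≡ a ℤ.- (x ℤ.+ ((ℤ.- k) ℤ.+ (ℤ.- k)))
    lemma′ = solve-∀

  reflect-≅ : IsC ≅ IsC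
  reflect-≅ = record
    { to      = reflect
    ; from    = reflect
    ; to-∈    = λ { {(a , x) , k} → reflect-C a x k }
    ; from-∈  = λ { {(a , x) , k} → reflect-C a x k }
    ; from∘to = λ { {(a , x) , k} _ → involutive a x k }
    ; to∘from = λ { {(a , x) , k} _ → involutive a x k }
    }
    where
    invariant : ∀ a x k → (a ℤ.+ (k ℤ.+ k) ℤ.- x) ℤ.* x ℤ.+ (x ℤ.- k) ℤ.* (x ℤ.- k) ≡
        a ℤ.* x ℤ.+ k ℤ.* k
    invariant = solve-∀
    lemma : ∀ a x k → a ≡ a ℤ.+ (k ℤ.+ k) ℤ.- x ℤ.+ ((x ℤ.- k) ℤ.+ (x ℤ.- k)) ℤ.- x
    lemma = solve-∀
    lemma′ : ∀ x k → x ℤ.- (x ℤ.- k) ≡ k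
    lemma′ = solve-∀
    reflect-C : ∀ a x k → IsC ((a , x) , k) → IsC (reflect ((a , x) , k))
    reflect-C a x k (((0<a , 0<x) , eq) , lt) =
      ((pos-- lt , 0<x) , trans (invariant a x k) eq) , pos-cancel (subst Pos (lemma a x k) 0<a)
    involutive : ∀ a x k → reflect (reflect ((a , x) , k)) ≡ ((a , x) , k)
    involutive a x k = cong₂ (λ i j → (i , x) , j) (sym (lemma a x k)) (lemma′ x k)

  -- F is (1 - ξ) a κ up to a term odd in k; the latter is chosen so that H, which collects the
  -- contributions of IsB and IsC, is antisymmetric under reflect.
  F : (a x k α ξ κ : ℤ) → ℤ
  F a x k α ξ κ = κ ℤ.* (a ℤ.- ξ ℤ.* a ℤ.+ (α ℤ.- ξ) ℤ.* k)

  H : (a x k α ξ κ : ℤ) → ℤ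
  H a x k α ξ κ = F a x k α ξ κ ℤ.+ F x a (ℤ.- k) ξ α κ

  at-form : ((a x k α ξ κ : ℤ) → ℤ) → Form → ℤ
  at-form Φ ((a , x) , k) = Φ a x k (sgn a) (sgn x) (sgn k)

  -- The reflected parities are αξ for a + 2k - x and ξκ for x - k. The identity uses ξ² = 1, hence
  -- the two cases.
  H-reflect : ∀ a x k α {ξ} κ → IsSign ξ →
    H (a ℤ.+ (k ℤ.+ k) ℤ.- x) x (x ℤ.- k) (α ℤ.* ξ) ξ (ξ ℤ.* κ) ≡ ℤ.- H a x k α ξ κ
  H-reflect a x k α κ (inj₁ refl) = lemma a x k α κ
    where
    lemma : ∀ a x k α κ →
      1ℤ ℤ.* κ ℤ.* ((a ℤ.+ (k ℤ.+ k) ℤ.- x) ℤ.- 1ℤ ℤ.* (a ℤ.+ (k ℤ.+ k) ℤ.- x)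
          ℤ.+ (α ℤ.* 1ℤ ℤ.- 1ℤ) ℤ.* (x ℤ.- k)) ℤ.+
      1ℤ ℤ.* κ ℤ.* (x ℤ.- α ℤ.* 1ℤ ℤ.* x ℤ.+ (1ℤ ℤ.- α ℤ.* 1ℤ) ℤ.* (ℤ.- (x ℤ.- k))) ≡
      ℤ.- (κ ℤ.* (a ℤ.- 1ℤ ℤ.* a ℤ.+ (α ℤ.- 1ℤ) ℤ.* k)
          ℤ.+ κ ℤ.* (x ℤ.- α ℤ.* x ℤ.+ (1ℤ ℤ.- α) ℤ.* (ℤ.- k)))
    lemma = solve-∀
  H-reflect a x k α κ (inj₂ refl) = lemma a x k α κ
    where
    lemma : ∀ a x k α κ →
      -1ℤ ℤ.* κ ℤ.* ((a ℤ.+ (k ℤ.+ k) ℤ.- x) ℤ.- -1ℤ ℤ.* (a ℤ.+ (k ℤ.+ k) ℤ.- x)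
          ℤ.+ (α ℤ.* -1ℤ ℤ.- -1ℤ) ℤ.* (x ℤ.- k)) ℤ.+
      -1ℤ ℤ.* κ ℤ.* (x ℤ.- α ℤ.* -1ℤ ℤ.* x ℤ.+ (-1ℤ ℤ.- α ℤ.* -1ℤ) ℤ.* (ℤ.- (x ℤ.- k))) ≡
      ℤ.- (κ ℤ.* (a ℤ.- -1ℤ ℤ.* a ℤ.+ (α ℤ.- -1ℤ) ℤ.* k)
          ℤ.+ κ ℤ.* (x ℤ.- α ℤ.* x ℤ.+ (-1ℤ ℤ.- α) ℤ.* (ℤ.- k)))
    lemma = solve-∀

  private
    E = forms n
    Eᴮ = E ∣ᴱ (λ z → slope z ℤ.<? third z)
    Eᶜ = E ∣ᴱ (λ z → third z ℤ.<? slope z)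
    Eᶻ = E ∣ᴱ (λ z → slope z ℤ.≟ third z)

  ∑-C-H : ∑ Eᶜ (at-form H) ≡ 0ℤ
  ∑-C-H = ∑-antisymmetric Eᶜ reflect-≅ (at-form H) λ { {(a , x) , k} _ → trans
    (cong₂ (λ α κ → H (a ℤ.+ (k ℤ.+ k) ℤ.- x) x (x ℤ.- k) α (sgn x) κ) (sgn-slope a x k)
        (sgn-- x k))
    (H-reflect a x k (sgn a) (sgn k) (sgn-cases x)) }
    where
    rearrange : ∀ a x k → a ℤ.+ (k ℤ.+ k) ℤ.- x ≡ a ℤ.- x ℤ.+ (k ℤ.+ k)
    rearrange = solve-∀
    sgn-slope : ∀ a x k → sgn (a ℤ.+ (k ℤ.+ k) ℤ.- x) ≡ sgn a ℤ.* sgn x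
    sgn-slope a x k = trans (sgn-even _ (a ℤ.- x) k (rearrange a x k)) (sgn-- a x)

  -- Transposing `IsB` onto `IsC` collects both regions into the sum of `H` over `IsC`, which
  -- vanishes by reflection. Only the forms vanishing at (1, 1) remain.
  ∑-F : ∑ E (at-form F) ≡ ∑ Eᶻ (at-form F)
  ∑-F = begin
    ∑ E (at-form F)
      ≡⟨ ∑-trichotomy E slope third (at-form F) ⟩
    ∑ Eᴮ (at-form F) ℤ.+ ∑ Eᶜ (at-form F) ℤ.+ ∑ Eᶻ (at-form F)
      ≡⟨ cong (λ s → s ℤ.+ ∑ Eᶜ (at-form F) ℤ.+ ∑ Eᶻ (at-form F))
           (∑-bij Eᴮ Eᶜ transpose-≅ {G = at-form F ∘ transpose} λ { {(a , x) , k} _ →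
             cong₂ (λ i j → F a x i (sgn a) (sgn x) j) (sym (ℤ.neg-involutive k))
               (cong sgn (sym (ℤ.neg-involutive k))) }) ⟩
    ∑ Eᶜ (at-form F ∘ transpose) ℤ.+ ∑ Eᶜ (at-form F) ℤ.+ ∑ Eᶻ (at-form F)
      ≡⟨ cong (ℤ._+ ∑ Eᶻ (at-form F))
          (trans (ℤ.+-comm (∑ Eᶜ (at-form F ∘ transpose)) (∑ Eᶜ (at-form F)))
           (trans (sym (∑-+ Eᶜ (at-form F) (at-form F ∘ transpose)))
           (trans (∑-cong Eᶜ (λ { {(a , x) , k} _ →
               cong (λ κ → at-form F ((a , x) , k) ℤ.+ F x a (ℤ.- k) (sgn x) (sgn a) κ)
                   (sgn-neg k) }))
             ∑-C-H))) ⟩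
    0ℤ ℤ.+ ∑ Eᶻ (at-form F)
      ≡⟨ ℤ.+-identityˡ _ ⟩
    ∑ Eᶻ (at-form F) ∎
    where open ≡-Reasoning

  positive-roots : Enum (λ s → s ℤ.* s ≡ + n × Pos s)
  positive-roots = roots n ∣ᴱ (0ℤ ℤ.<?_)

  -- On `IsZ` one has x = a + 2k, so n = (a + k)², and s = a + k is a positive root because 2s = a +
  -- x. For fixed s the entry a runs over 0 < a < 2s; moreover a and x have the same parity, so the
  -- term of `F` in k drops out.
  ∑-Z : ∑ Eᶻ (at-form F) ≡ ∑ positive-roots (λ s → ℤ.- + 2 ℤ.* (+ n ℤ.* sgn s))
  ∑-Z = begin
    ∑ Eᶻ (at-form F)
      ≡⟨ sym (∑-bij (sigma positive-roots (λ s → between (s ℤ.+ s))) Eᶻ roots≅Z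
           {F = λ (s , a) → sgn s ℤ.* (sgn a ℤ.* a ℤ.- a)} (λ { {s , a} _ → sym (value s a) })) ⟩
    ∑ (sigma positive-roots (λ s → between (s ℤ.+ s))) (λ (s , a) → sgn s ℤ.* (sgn a ℤ.* a ℤ.- a))
      ≡⟨ ∑-sigma positive-roots (λ s → between (s ℤ.+ s))
          (λ (s , a) → sgn s ℤ.* (sgn a ℤ.* a ℤ.- a)) ⟩
    ∑ positive-roots (λ s → ∑ (between (s ℤ.+ s)) (λ a → sgn s ℤ.* (sgn a ℤ.* a ℤ.- a)))
      ≡⟨ ∑-cong positive-roots (λ {s} (eq , 0<s) → inner s eq 0<s) ⟩
    ∑ positive-roots (λ s → ℤ.- + 2 ℤ.* (+ n ℤ.* sgn s)) ∎
    where
    open ≡-Reasoning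
    invariant : ∀ s a → a ℤ.* (s ℤ.+ s ℤ.- a) ℤ.+ (s ℤ.- a) ℤ.* (s ℤ.- a) ≡ s ℤ.* s
    invariant = solve-∀
    slope-eq : ∀ s a → a ℤ.+ ((s ℤ.- a) ℤ.+ (s ℤ.- a)) ≡ s ℤ.+ s ℤ.- a
    slope-eq = solve-∀
    invariant′ : ∀ a k → (a ℤ.+ k) ℤ.* (a ℤ.+ k) ≡ a ℤ.* (a ℤ.+ (k ℤ.+ k)) ℤ.+ k ℤ.* k
    invariant′ = solve-∀
    twice : ∀ a k → a ℤ.+ (a ℤ.+ (k ℤ.+ k)) ≡ (a ℤ.+ k) ℤ.+ (a ℤ.+ k)
    twice = solve-∀
    back : ∀ a s → a ℤ.+ (s ℤ.- a) ≡ s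
    back = solve-∀
    forth₁ : ∀ a k → (a ℤ.+ k) ℤ.+ (a ℤ.+ k) ℤ.- a ≡ a ℤ.+ (k ℤ.+ k)
    forth₁ = solve-∀
    forth₂ : ∀ a k → a ℤ.+ k ℤ.- a ≡ k
    forth₂ = solve-∀
    halve : ∀ s → Pos (s ℤ.+ s) → Pos s
    halve (+ suc s) _ = +<+ z<s
    halve (+ zero) (+<+ ())

    roots≅Z : (λ ((s , a) : ℤ × ℤ) → (s ℤ.* s ≡ + n × Pos s) × Pos a × a ℤ.< s ℤ.+ s) ≅ IsZ
    roots≅Z = record
      { to      = λ (s , a) → (a , s ℤ.+ s ℤ.- a) , s ℤ.- a
      ; from    = λ { ((a , x) , k) → a ℤ.+ k , a }
      ; to-∈    = λ { {s , a} ((eq , _) , 0<a , lt) →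
          ((0<a , pos-- lt) , trans (invariant s a) eq) , slope-eq s a }
      ; from-∈  = λ { {(a , _) , k} (((0<a , 0<x) , eq) , refl) →
          (trans (invariant′ a k) eq , halve (a ℤ.+ k) (subst Pos (twice a k) (pos-+ 0<a 0<x))) ,
              0<a ,
          subst₂ ℤ._<_ (ℤ.+-identityʳ a) (twice a k) (ℤ.+-monoʳ-< a 0<x) }
      ; from∘to = λ { {s , a} _ → cong (_, a) (back a s) }
      ; to∘from = λ { {(a , _) , k} (_ , refl) →
          cong₂ (λ i j → (a , i) , j) (forth₁ a k) (forth₂ a k) }
      }

    collapse : ∀ σ a k {α} → IsSign α → F a a k α α (σ ℤ.* α) ≡ σ ℤ.* (α ℤ.* a ℤ.- a)
    collapse σ a k (inj₁ refl) = lemma σ a k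
      where
      lemma : ∀ σ a k → σ ℤ.* 1ℤ ℤ.* (a ℤ.- 1ℤ ℤ.* a ℤ.+ (1ℤ ℤ.- 1ℤ) ℤ.* k) ≡ σ ℤ.* (1ℤ ℤ.* a ℤ.- a)
      lemma = solve-∀
    collapse σ a k (inj₂ refl) = lemma σ a k
      where
      lemma : ∀ σ a k → σ ℤ.* -1ℤ ℤ.* (a ℤ.- -1ℤ ℤ.* a ℤ.+ (-1ℤ ℤ.- -1ℤ) ℤ.* k) ≡
          σ ℤ.* (-1ℤ ℤ.* a ℤ.- a)
      lemma = solve-∀

    rearrange : ∀ s a → s ℤ.+ s ℤ.- a ≡ ℤ.- a ℤ.+ (s ℤ.+ s)
    rearrange = solve-∀

    value : ∀ s a → at-form F ((a , s ℤ.+ s ℤ.- a) , s ℤ.- a) ≡ sgn s ℤ.* (sgn a ℤ.* a ℤ.- a)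
    value s a = trans (cong₂ (λ ξ κ → F a a (s ℤ.- a) (sgn a) ξ κ)
      (trans (sgn-even _ (ℤ.- a) s (rearrange s a)) (sgn-neg a)) (sgn-- s a))
      (collapse (sgn s) a (s ℤ.- a) (sgn-cases a))

    -- An antidifference of 4 σ ((-1)^a a - a); the factor 4 clears the denominator in the
    -- antidifference (-1)^a (1 - 2a) / 4 of (-1)^a a.
    K : (σ α a : ℤ) → ℤ
    K σ α a = σ ℤ.* (α ℤ.* (1ℤ ℤ.- + 2 ℤ.* a) ℤ.- + 2 ℤ.* a ℤ.* a ℤ.+ + 2 ℤ.* a)

    step : ∀ σ α a → + 4 ℤ.* (σ ℤ.* (α ℤ.* a ℤ.- a)) ≡
      σ ℤ.* (ℤ.- α ℤ.* (1ℤ ℤ.- + 2 ℤ.* (a ℤ.+ 1ℤ)) ℤ.- + 2 ℤ.* (a ℤ.+ 1ℤ) ℤ.* (a ℤ.+ 1ℤ)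
          ℤ.+ + 2 ℤ.* (a ℤ.+ 1ℤ)) ℤ.-
      σ ℤ.* (α ℤ.* (1ℤ ℤ.- + 2 ℤ.* a) ℤ.- + 2 ℤ.* a ℤ.* a ℤ.+ + 2 ℤ.* a)
    step = solve-∀

    -- The subtracted `σ ℤ.* 1ℤ` is the lower boundary value `K σ -1ℤ 1ℤ`.
    total : ∀ σ s → σ ℤ.* (1ℤ ℤ.* (1ℤ ℤ.- + 2 ℤ.* (s ℤ.+ s)) ℤ.- + 2 ℤ.* (s ℤ.+ s) ℤ.* (s ℤ.+ s)
        ℤ.+ + 2 ℤ.* (s ℤ.+ s)) ℤ.-
      σ ℤ.* 1ℤ ≡ + 4 ℤ.* (ℤ.- + 2 ℤ.* (s ℤ.* s ℤ.* σ))
    total = solve-∀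

    inner : ∀ s → s ℤ.* s ≡ + n → Pos s →
      ∑ (between (s ℤ.+ s)) (λ a → sgn s ℤ.* (sgn a ℤ.* a ℤ.- a)) ≡ ℤ.- + 2 ℤ.* (+ n ℤ.* sgn s)
    inner s eq 0<s = ℤ.*-cancelˡ-≡ (+ 4) _ _ (begin
      + 4 ℤ.* ∑ (between (s ℤ.+ s)) (λ a → sgn s ℤ.* (sgn a ℤ.* a ℤ.- a))
        ≡⟨ sym (∑-* (+ 4) (between (s ℤ.+ s)) (λ a → sgn s ℤ.* (sgn a ℤ.* a ℤ.- a))) ⟩
      ∑ (between (s ℤ.+ s)) (λ a → + 4 ℤ.* (sgn s ℤ.* (sgn a ℤ.* a ℤ.- a)))
        ≡⟨ telescope (s ℤ.+ s) (pos-+ 0<s 0<s) (λ a → K (sgn s) (sgn a) a) _ (λ a →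
             trans (step (sgn s) (sgn a) a)
               (cong (λ α → K (sgn s) α (a ℤ.+ 1ℤ) ℤ.- K (sgn s) (sgn a) a) (sym (sgn-suc a)))) ⟩
      K (sgn s) (sgn (s ℤ.+ s)) (s ℤ.+ s) ℤ.- K (sgn s) (sgn 1ℤ) 1ℤ
        ≡⟨ cong (λ α → K (sgn s) α (s ℤ.+ s) ℤ.- K (sgn s) (sgn 1ℤ) 1ℤ) (sgn-double s) ⟩
      K (sgn s) 1ℤ (s ℤ.+ s) ℤ.- K (sgn s) (sgn 1ℤ) 1ℤ
        ≡⟨ total (sgn s) s ⟩
      + 4 ℤ.* (ℤ.- + 2 ℤ.* (s ℤ.* s ℤ.* sgn s))
        ≡⟨ cong (λ m → + 4 ℤ.* (ℤ.- + 2 ℤ.* (m ℤ.* sgn s))) eq ⟩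
      + 4 ℤ.* (ℤ.- + 2 ℤ.* (+ n ℤ.* sgn s)) ∎)

  ∂θ-positive : ∂ θ n ≡ + 2 ℤ.* ∑ positive-roots (λ s → + n ℤ.* sgn s)
  ∂θ-positive = begin
    + n ℤ.* ∑ (roots n) sgn
      ≡⟨ sym (∑-* (+ n) (roots n) sgn) ⟩
    ∑ (roots n) G
      ≡⟨ ∑-trichotomy (roots n) (λ _ → 0ℤ) id G ⟩
    ∑ positive-roots G ℤ.+ ∑ negative-roots G ℤ.+ ∑ zero-roots G
      ≡⟨ cong₂ (λ i j → ∑ positive-roots G ℤ.+ i ℤ.+ j)
           (∑-bij negative-roots positive-roots neg-≅ λ {k} _ → cong (+ n ℤ.*_) (sym (sgn-neg k)))
           -- The root 0 occurs only for n = 0, where the factor n kills its term.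
           (trans (∑-cong zero-roots {G = λ _ → 0ℤ ℤ.* 0ℤ} λ { (eq , refl) →
               trans (cong (ℤ._* 1ℤ) (sym eq)) refl }) (∑-* 0ℤ zero-roots (λ _ → 0ℤ))) ⟩
    ∑ positive-roots G ℤ.+ ∑ positive-roots G ℤ.+ 0ℤ
      ≡⟨ lemma (∑ positive-roots G) ⟩
    + 2 ℤ.* ∑ positive-roots G ∎
    where
    open ≡-Reasoning
    G : ℤ → ℤ
    G k = + n ℤ.* sgn k
    negative-roots = roots n ∣ᴱ (ℤ._<? 0ℤ)
    zero-roots = roots n ∣ᴱ (0ℤ ℤ.≟_)
    lemma : ∀ s → s ℤ.+ s ℤ.+ 0ℤ ≡ + 2 ℤ.* s
    lemma = solve-∀
    square : ∀ k → (ℤ.- k) ℤ.* (ℤ.- k) ≡ k ℤ.* k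
    square = solve-∀
    neg-≅ : (λ k → k ℤ.* k ≡ + n × k ℤ.< 0ℤ) ≅ (λ k → k ℤ.* k ≡ + n × Pos k)
    neg-≅ = record
      { to      = ℤ.-_
      ; from    = ℤ.-_
      ; to-∈    = λ {k} (eq , k<0) → trans (square k) eq , ℤ.neg-mono-< k<0
      ; from-∈  = λ {k} (eq , 0<k) → trans (square k) eq , ℤ.neg-mono-< 0<k
      ; from∘to = λ {k} _ → ℤ.neg-involutive k
      ; to∘from = λ {k} _ → ℤ.neg-involutive k
      }

P′ : Series
P′ = Λ (λ a x → a ℤ.- sgn x ℤ.* a)

∂θ : ∂ θ ≐ ⊟ P′ ⋆ θ
∂θ n = sym (begin
  (⊟ P′ ⋆ θ) n
    ≡⟨ solve 2 (λ p t → (:- p) :* t := :- (p :* t)) (λ _ → refl) P′ θ n ⟩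
  ℤ.- (P′ ⋆ θ) n
    ≡⟨ cong ℤ.-_ (begin
      (P′ ⋆ θ) n
        ≡⟨ Λ-⋆-θ _ n ⟩
      ∑ (forms n) (λ ((a , x) , k) → (a ℤ.- sgn x ℤ.* a) ℤ.* sgn k)
        ≡⟨ sym (ℤ.+-identityʳ _) ⟩
      ∑ (forms n) (λ ((a , x) , k) → (a ℤ.- sgn x ℤ.* a) ℤ.* sgn k) ℤ.+ 0ℤ
        -- Completes the summand to `F` by a term that is reversed under k ↦ -k and hence sums to
        -- zero.
        ≡⟨ +-congˡ (∑ (forms n) (λ ((a , x) , k) → (a ℤ.- sgn x ℤ.* a) ℤ.* sgn k))
             (sym (∑-antisymmetric (forms n) (negate-≅ n) odd-part
                 (λ { {(a , x) , k} _ → odd a x k }))) ⟩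
      ∑ (forms n) (λ ((a , x) , k) → (a ℤ.- sgn x ℤ.* a) ℤ.* sgn k) ℤ.+ ∑ (forms n) odd-part
        ≡⟨ sym (∑-+ (forms n) (λ ((a , x) , k) → (a ℤ.- sgn x ℤ.* a) ℤ.* sgn k) odd-part) ⟩
      ∑ (forms n) (λ z@((a , x) , k) → (a ℤ.- sgn x ℤ.* a) ℤ.* sgn k ℤ.+ odd-part z)
        ≡⟨ ∑-cong (forms n) (λ { {(a , x) , k} _ → gather a k (sgn a) (sgn x) (sgn k) }) ⟩
      ∑ (forms n) (at-form n (F n))
        ≡⟨ trans (∑-F n) (∑-Z n) ⟩
      ∑ (positive-roots n) (λ s → ℤ.- + 2 ℤ.* (+ n ℤ.* sgn s))
        ≡⟨ ∑-* (ℤ.- + 2) (positive-roots n) (λ s → + n ℤ.* sgn s) ⟩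
      ℤ.- + 2 ℤ.* ∑ (positive-roots n) (λ s → + n ℤ.* sgn s) ∎) ⟩
  ℤ.- (ℤ.- + 2 ℤ.* ∑ (positive-roots n) (λ s → + n ℤ.* sgn s))
    ≡⟨ double-neg (∑ (positive-roots n) (λ s → + n ℤ.* sgn s)) ⟩
  + 2 ℤ.* ∑ (positive-roots n) (λ s → + n ℤ.* sgn s)
    ≡⟨ sym (∂θ-positive n) ⟩
  ∂ θ n ∎)
  where
  open ≡-Reasoning
  open SeriesSolver using (solve; _:*_; :-_; _:=_)
  odd-part : Form → ℤ
  odd-part ((a , x) , k) = sgn k ℤ.* ((sgn a ℤ.- sgn x) ℤ.* k)
  negated : ∀ κ δ k → κ ℤ.* (δ ℤ.* (ℤ.- k)) ≡ ℤ.- (κ ℤ.* (δ ℤ.* k))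
  negated = solve-∀
  odd : ∀ a x k → odd-part (negate n ((a , x) , k)) ≡ ℤ.- odd-part ((a , x) , k)
  odd a x k = trans (cong (ℤ._* ((sgn a ℤ.- sgn x) ℤ.* (ℤ.- k))) (sgn-neg k))
      (negated (sgn k) (sgn a ℤ.- sgn x) k)
  gather : ∀ a k α ξ κ → (a ℤ.- ξ ℤ.* a) ℤ.* κ ℤ.+ κ ℤ.* ((α ℤ.- ξ) ℤ.* k) ≡
    κ ℤ.* (a ℤ.- ξ ℤ.* a ℤ.+ (α ℤ.- ξ) ℤ.* k)
  gather = solve-∀
  double-neg : ∀ s → ℤ.- (ℤ.- + 2 ℤ.* s) ≡ + 2 ℤ.* s
  double-neg = solve-∀

-- Relations between the series

-- Lets a convolution identity x ≐ y enter as a hypothesis: the remaining equation is a polynomial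
-- identity that the solver proves outright.
cancel : ∀ {f g x y} k → x ≐ y → f ⊞ k ⋆ y ≐ g ⊞ k ⋆ x → f ≐ g
cancel {f} {g} {x} {y} k x≐y eq n = trans (lemma (f n) ((k ⋆ y) n)) (trans
  (cong (ℤ._- (k ⋆ y) n) (trans (eq n) (+-congˡ (g n) (⋆-cong {f = k} (λ _ → refl) x≐y n))))
  (sym (lemma (g n) ((k ⋆ y) n))))
  where
  lemma : ∀ a b → a ≡ a ℤ.+ b ℤ.- b
  lemma = solve-∀

U W : ℕ → Series
U k = lambert (u k)
W k = lambert (w k)

O : Series
O = lambert o

v₁ v₃ v₅ w₃ w₅ w₇ ε : Series
v₁ = const -1ℤ ⊞ const (+ 8) ⋆ U 1
v₃ = const 1ℤ ⊞ const (+ 16) ⋆ U 3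
v₅ = const -1ℤ ⊞ const (+ 8) ⋆ U 5
w₃ = const 1ℤ ⊞ const (+ 16) ⋆ W 3
w₅ = const 1ℤ ⊞ const (ℤ.- + 8) ⋆ W 5
w₇ = const (+ 17) ⊞ const (+ 32) ⋆ W 7
ε  = const 1ℤ ⊞ const (+ 12) ⋆ O

open SeriesSolver using (solve; con; _:+_; _:*_; :-_; _:=_; Polynomial)

module _ where
  private
    :v₁ :v₃ :v₅ :w₃ :w₅ :w₇ :ε : ∀ {n} → Polynomial n → Polynomial n
    :v₁ x = con -1ℤ :+ con (+ 8) :* x
    :v₃ x = con 1ℤ :+ con (+ 16) :* x
    :v₅ x = con -1ℤ :+ con (+ 8) :* x
    :w₃ x = con 1ℤ :+ con (+ 16) :* x
    :w₅ x = con 1ℤ :+ con (ℤ.- + 8) :* x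
    :w₇ x = con (+ 17) :+ con (+ 32) :* x
    :ε  x = con 1ℤ :+ con (+ 12) :* x

  -- The multiplier -16 removes the quadratic term 64 (U₁)² of v₁² against the 4 (U₁)² of the
  -- convolution. The multipliers in the next four relations are fixed by the bilinear terms in the
  -- same way.
  w₃≐ : w₃ ≐ v₁ ⋆ v₁
  w₃≐ = cancel (const (ℤ.- + 16)) convolution-U₁U₁ (solve 2 (λ u₁ w₃ →
    :w₃ w₃ :+ con (ℤ.- + 16) :* (con 1ℤ :* w₃ :+ (con 1ℤ :* u₁ :+ con 0ℤ)) :=
    :v₁ u₁ :* :v₁ u₁ :+ con (ℤ.- + 16) :* (con (+ 4) :* (u₁ :* u₁) :+ con 0ℤ)) (λ _ → refl) (U 1)
        (W 3))

  v₃≐ : v₃ ≐ ⊟ (ε ⋆ v₁)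
  v₃≐ = cancel (const (+ 4)) convolution-OU₁ (solve 3 (λ u₁ u₃ e →
    :v₃ u₃ :+ con (+ 4) :*
        (con (+ 3) :* e :+ (con (ℤ.- + 2) :* u₁ :+ (con (ℤ.- + 4) :* u₃ :+ con 0ℤ))) :=
    :- (:ε e :* :v₁ u₁) :+ con (+ 4) :* (con (+ 24) :* (e :* u₁) :+ con 0ℤ)) (λ _ → refl) (U 1)
        (U 3) O)

  4v₅≐ : const (+ 4) ⋆ v₅ ≐ ⊟ (ε ⋆ v₃) ⊞ const (+ 3) ⋆ (v₁ ⋆ w₃)
  4v₅≐ = cancel (const (ℤ.- + 4)) convolution-U₁W₃ (solve 5 (λ u₁ u₃ u₅ w₃ e →
    con (+ 4) :* :v₅ u₅ :+ con (ℤ.- + 4) :*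
        (con (+ 8) :* u₅ :+ (con (+ 3) :* e :+ (con (+ 4) :* u₃ :+
      (con (ℤ.- + 6) :* u₁ :+ (con (+ 12) :* w₃ :+ con 0ℤ))))) :=
    :- (:ε e :* :v₃ u₃) :+ con (+ 3) :* (:v₁ u₁ :* :w₃ w₃) :+
      con (ℤ.- + 4) :* (con (+ 96) :* (u₁ :* w₃) :+ (con (ℤ.- + 48) :* (e :* u₃) :+ con 0ℤ)))
    (λ _ → refl) (U 1) (U 3) (U 5) (W 3) O)

  w₅≐ : w₅ ≐ ε ⋆ w₃
  w₅≐ = cancel (const (ℤ.- + 4)) convolution-OW₃ (solve 3 (λ w₃ w₅ e →
    :w₅ w₅ :+ con (ℤ.- + 4) :*
        (con (ℤ.- + 2) :* w₅ :+ (con (ℤ.- + 3) :* e :+ (con (ℤ.- + 4) :* w₃ :+ con 0ℤ))) :=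
    :ε e :* :w₃ w₃ :+ con (ℤ.- + 4) :* (con (+ 48) :* (e :* w₃) :+ con 0ℤ)) (λ _ → refl) (W 3)
        (W 5) O)

  w₇≐ : w₇ ≐ const (+ 8) ⋆ (ε ⋆ w₅) ⊞ const (+ 9) ⋆ (w₃ ⋆ w₃)
  w₇≐ = cancel (const (ℤ.- + 32)) convolution-W₃W₃ (solve 4 (λ w₃ w₅ w₇ e →
    :w₇ w₇ :+ con (ℤ.- + 32) :* (con (+ 1) :* w₇ :+ (con (ℤ.- + 3) :* e :+ (con (+ 2) :* w₅ :+
      (con (ℤ.- + 9) :* w₃ :+ con 0ℤ)))) :=
    con (+ 8) :* (:ε e :* :w₅ w₅) :+ con (+ 9) :* (:w₃ w₃ :* :w₃ w₃) :+
      con (ℤ.- + 32) :* (con (+ 72) :* (w₃ :* w₃) :+ (con (ℤ.- + 24) :* (e :* w₅) :+ con 0ℤ)))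
    (λ _ → refl) (W 3) (W 5) (W 7) O)

∂-affine : ∀ c k f → ∂ (const c ⊞ const k ⋆ f) ≐ const k ⋆ ∂ f
∂-affine c k f zero    = trans (ℤ.*-zeroˡ (c ℤ.+ k ℤ.* f 0)) (sym (ℤ.*-zeroʳ k))
∂-affine c k f (suc n) = trans
  (cong (+ suc n ℤ.*_) (trans (ℤ.+-identityˡ _) (const-⋆ k f (suc n))))
  (trans (lemma (+ suc n) k (f (suc n))) (sym (const-⋆ k (∂ f) (suc n))))
  where
  lemma : ∀ n k f → n ℤ.* (k ℤ.* f) ≡ k ℤ.* (n ℤ.* f)
  lemma = solve-∀

∂U₁ : lambert (poly 4 (λ d m δ μ → d * m * (δ * μ * d ^ 1))) ≐ ∂ (U 1)
∂U₁ n = trans (∑-cong (pairs n) λ { {d , m} (_ , _ , eq) →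
    cong (ℤ._* (sgn d ℤ.* sgn m ℤ.* (d ℤ.* 1ℤ))) eq })
  (∑-* (+ n) (pairs n) (λ (d , m) → sgn d ℤ.* sgn m ℤ.* (d ℤ.* 1ℤ)))

∂v₁ : ∂ v₁ ≐ (const (ℤ.- + 4) ⋆ P′) ⋆ v₁
∂v₁ n = trans (∂-affine -1ℤ (+ 8) (U 1) n)
    (cancel {const (+ 8) ⋆ ∂ (U 1)} {(const (ℤ.- + 4) ⋆ P′) ⋆ v₁} (const (+ 4)) identity
  (solve 3 (λ p u₁ u₁′ → con (+ 8) :* u₁′ :+ con (+ 4) :*
      (con (+ 1) :* p :+ (con (ℤ.- + 2) :* u₁′ :+ con 0ℤ)) :=
    con (ℤ.- + 4) :* p :* (con -1ℤ :+ con (+ 8) :* u₁) :+ con (+ 4) :*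
        (con (+ 8) :* (p :* u₁) :+ con 0ℤ))
    (λ _ → refl) P′ (U 1) (∂ (U 1))) n)
  where
  identity : const (+ 8) ⋆ (P′ ⋆ U 1) ⊞ const 0ℤ ≐ const (+ 1) ⋆ P′ ⊞
      (const (ℤ.- + 2) ⋆ ∂ (U 1) ⊞ const 0ℤ)
  identity n = trans (convolution-P′U₁ n) (+-congˡ ((const (+ 1) ⋆ P′) n)
    (cong (ℤ._+ const 0ℤ n) (⋆-cong {f = const (ℤ.- + 2)} (λ _ → refl) ∂U₁ n)))

∂-logarithmic : ∀ {a b f g} → ∂ f ≐ a ⋆ f → ∂ g ≐ b ⋆ g → ∂ (f ⋆ g) ≐ (a ⊞ b) ⋆ (f ⋆ g)
∂-logarithmic {a} {b} {f} {g} f′ g′ n = trans (∂-⋆ f g n) (trans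
  (cong₂ ℤ._+_ (⋆-cong {g = g} f′ (λ _ → refl) n) (⋆-cong {f = f} (λ _ → refl) g′ n))
  (solve 4 (λ a b f g → a :* f :* g :+ f :* (b :* g) := (a :+ b) :* (f :* g))
      (λ _ → refl) a b f g n))

-- The powers of theta

T : ℕ → Series
T s = twist (R s)

T-+ : ∀ k s → T (k ℕ.+ s) ≐ T k ⋆ T s
T-+ zero s n = sym (trans (⋆-cong {g = T s} twist-R-zero (λ _ → refl) n) (⋆-identityˡ (T s) n))
T-+ (suc k) s n = trans (twist-R-suc (k ℕ.+ s) n) (trans (⋆-cong {f = θ} (λ _ → refl) (T-+ k s) n)
  (trans (sym (⋆-assoc θ (T k) (T s) n))
      (⋆-cong {g = T s} (λ j → sym (twist-R-suc k j)) (λ _ → refl) n)))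

-- Logarithmic derivatives add, and `T s` is the s-th power of θ.
∂T : ∀ s → ∂ (T s) ≐ (const (ℤ.- + s) ⋆ P′) ⋆ T s
∂T zero n = trans (trans (cong (+ n ℤ.*_) (twist-R-zero n)) (∂-1 n))
    (sym (solve 2 (λ p t → con 0ℤ :* p :* t := con 0ℤ) (λ _ → refl) P′ (T 0) n))
  where
  ∂-1 : ∂ (const 1ℤ) ≐ const 0ℤ
  ∂-1 zero    = refl
  ∂-1 (suc n) = ℤ.*-zeroʳ (+ suc n)
∂T (suc s) n = trans (cong (+ n ℤ.*_) (twist-R-suc s n))
    (trans (∂-logarithmic {⊟ P′} {const (ℤ.- + s) ⋆ P′} {θ} {T s} ∂θ (∂T s) n)
  (⋆-cong lemma (λ j → sym (twist-R-suc s j)) n))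
  where
  lemma : ⊟ P′ ⊞ const (ℤ.- + s) ⋆ P′ ≐ const (ℤ.- + suc s) ⋆ P′
  lemma j = trans (+-congˡ (ℤ.- P′ j) (const-⋆ (ℤ.- + s) P′ j))
      (trans (ring′ (P′ j) (+ s)) (sym (const-⋆ (ℤ.- + suc s) P′ j)))
    where
    ring′ : ∀ p s → ℤ.- p ℤ.+ ℤ.- s ℤ.* p ≡ (ℤ.- (1ℤ ℤ.+ s)) ℤ.* p
    ring′ = solve-∀

-- Jacobi's four-square theorem. The two `refl` check that the multiplier -4 P has no constant term
-- and that both series start with the same coefficient.
four-squares : ⊟ v₁ ≐ T 4
four-squares = ∂-unique (const (ℤ.- + 4) ⋆ P′) (⊟ v₁) (T 4) refl refl
  (λ n → trans (sym (ℤ.neg-distribʳ-* (+ n) (v₁ n))) (trans (cong ℤ.-_ (∂v₁ n))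
    (solve 2 (λ a v → :- (a :* v) := a :* (:- v)) (λ _ → refl) (const (ℤ.- + 4) ⋆ P′) v₁ n)))
  (∂T 4)

module _ where
  open CommutativeRing seriesRing using ()
    renaming (+-cong to ⊞-cong; -‿cong to ⊟-cong; refl to ≐-refl; sym to ≐-sym; trans to ≐-trans)
  open SetoidReasoning (CommutativeRing.setoid seriesRing)

  T₁₆ : const (+ 3) ⋆ T 16 ≐ const (+ 4) ⋆ (v₁ ⋆ v₅) ⊞ ⊟ (v₃ ⋆ v₃)
  T₁₆ = begin
    const (+ 3) ⋆ T 16
      ≈⟨ ⋆-cong {f = const (+ 3)} ≐-refl
          (≐-trans (T-+ 4 12) (⋆-cong {f = T 4} ≐-refl
              (≐-trans (T-+ 4 8) (⋆-cong {f = T 4} ≐-refl (T-+ 4 4))))) ⟩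
    const (+ 3) ⋆ (T 4 ⋆ (T 4 ⋆ (T 4 ⋆ T 4)))
      ≈⟨ ⋆-cong {f = const (+ 3)} ≐-refl
          (≐-sym (⋆-cong four-squares (⋆-cong four-squares (⋆-cong four-squares four-squares)))) ⟩
    const (+ 3) ⋆ (⊟ v₁ ⋆ (⊟ v₁ ⋆ (⊟ v₁ ⋆ ⊟ v₁)))
      -- Inserts -ε v₁ v₃ + ε v₁ v₃, so that the bracket becomes 4 v₅ and the last factor v₃.
      ≈⟨ solve 3 (λ v₁ v₃ ε → con (+ 3) :* (:- v₁ :* (:- v₁ :* (:- v₁ :* (:- v₁)))) :=
           v₁ :* (:- (ε :* v₃) :+ con (+ 3) :* (v₁ :* (v₁ :* v₁))) :+ :- (v₃ :* :- (ε :* v₁)))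
               (λ _ → refl) v₁ v₃ ε ⟩
    v₁ ⋆ (⊟ (ε ⋆ v₃) ⊞ const (+ 3) ⋆ (v₁ ⋆ (v₁ ⋆ v₁))) ⊞ ⊟ (v₃ ⋆ ⊟ (ε ⋆ v₁))
      ≈⟨ ⊞-cong (⋆-cong {f = v₁} ≐-refl
          (⊞-cong {⊟ (ε ⋆ v₃)} ≐-refl
              (⋆-cong {f = const (+ 3)} ≐-refl (⋆-cong {f = v₁} ≐-refl (≐-sym w₃≐)))))
           (⊟-cong (⋆-cong {f = v₃} ≐-refl (≐-sym v₃≐))) ⟩
    v₁ ⋆ (⊟ (ε ⋆ v₃) ⊞ const (+ 3) ⋆ (v₁ ⋆ w₃)) ⊞ ⊟ (v₃ ⋆ v₃)
      ≈⟨ ⊞-cong (⋆-cong {f = v₁} ≐-refl (≐-sym 4v₅≐)) ≐-refl ⟩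
    v₁ ⋆ (const (+ 4) ⋆ v₅) ⊞ ⊟ (v₃ ⋆ v₃)
      ≈⟨ solve 3 (λ v₁ v₃ v₅ → v₁ :* (con (+ 4) :* v₅) :+ :- (v₃ :* v₃) :=
          con (+ 4) :* (v₁ :* v₅) :+ :- (v₃ :* v₃)) (λ _ → refl) v₁ v₃ v₅ ⟩
    const (+ 4) ⋆ (v₁ ⋆ v₅) ⊞ ⊟ (v₃ ⋆ v₃) ∎

  -- Jacobi's eight-square theorem. It allows θ²⁴ to be handled as the cube of `w₃`.
  T₈ : T 8 ≐ w₃
  T₈ = begin
    T 8             ≈⟨ T-+ 4 4 ⟩
    T 4 ⋆ T 4       ≈⟨ ≐-sym (⋆-cong four-squares four-squares) ⟩
    ⊟ v₁ ⋆ ⊟ v₁     ≈⟨ solve 1 (λ v₁ → :- v₁ :* (:- v₁) := v₁ :* v₁) (λ _ → refl) v₁ ⟩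
    v₁ ⋆ v₁         ≈⟨ ≐-sym w₃≐ ⟩
    w₃              ∎

  T₂₄ : const (+ 9) ⋆ T 24 ≐ w₃ ⋆ w₇ ⊞ ⊟ (const (+ 8) ⋆ (w₅ ⋆ w₅))
  T₂₄ = begin
    const (+ 9) ⋆ T 24
      ≈⟨ ⋆-cong {f = const (+ 9)} ≐-refl (≐-trans (T-+ 8 16) (⋆-cong {f = T 8} ≐-refl (T-+ 8 8))) ⟩
    const (+ 9) ⋆ (T 8 ⋆ (T 8 ⋆ T 8))
      ≈⟨ ⋆-cong {f = const (+ 9)} ≐-refl (⋆-cong T₈ (⋆-cong T₈ T₈)) ⟩
    const (+ 9) ⋆ (w₃ ⋆ (w₃ ⋆ w₃))
      -- Inserts 8 ε w₃ w₅ - 8 ε w₃ w₅, so that the bracket becomes w₇ and the last factor w₅.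
      ≈⟨ solve 3 (λ w₃ w₅ ε → con (+ 9) :* (w₃ :* (w₃ :* w₃)) :=
           w₃ :* (con (+ 8) :* (ε :* w₅) :+ con (+ 9) :* (w₃ :* w₃)) :+ :- (con (+ 8) :*
               (w₅ :* (ε :* w₃)))) (λ _ → refl) w₃ w₅ ε ⟩
    w₃ ⋆ (const (+ 8) ⋆ (ε ⋆ w₅) ⊞ const (+ 9) ⋆ (w₃ ⋆ w₃)) ⊞ ⊟ (const (+ 8) ⋆ (w₅ ⋆ (ε ⋆ w₃)))
      ≈⟨ ⊞-cong (⋆-cong {f = w₃} ≐-refl (≐-sym w₇≐))
          (⊟-cong (⋆-cong {f = const (+ 8)} ≐-refl (⋆-cong {f = w₅} ≐-refl (≐-sym w₅≐)))) ⟩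
    w₃ ⋆ w₇ ⊞ ⊟ (const (+ 8) ⋆ (w₅ ⋆ w₅)) ∎

-- Comparison of coefficients

below : ∀ n → Enum (ℕ._< n)
below n = record
  { list     = upTo n
  ; unique   = Unique.upTo⁺ n
  ; sound    = ∈-upTo⁻
  ; complete = ∈-upTo⁺
  }

divisors≅pairs : ∀ n → .{{_ : NonZero n}} →
  (λ i → i ℕ.< n × suc i ∣ n) ≅ IsPair n
divisors≅pairs n = record
  { to      = λ i → + suc i , + (n ℕ./ suc i)
  ; from    = λ (a , _) → ℕ.pred ∣ a ∣
  ; to-∈    = λ {i} (_ , i∣n) → +<+ z<s , +<+ (m≥n⇒m/n>0 (∣⇒≤ i∣n)) ,
      trans (sym (ℤ.pos-* (suc i) (n ℕ./ suc i)))
          (cong +_ (trans (ℕ.*-comm (suc i) (n ℕ./ suc i)) (m/n*n≡m i∣n)))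
  ; from-∈  = λ { {+ suc i , + suc j} (_ , _ , eq) → let eq′ = ℤ.+-injective eq in
      subst (suc i ℕ.≤_) eq′ (ℕ.m≤m*n (suc i) (suc j)) , subst (suc i ∣_) eq′ (m∣m*n (suc j))
    ; {+ zero , _} (+<+ () , _) ; {+ suc i , + zero} (_ , +<+ () , _) }
  ; from∘to = λ _ → refl
  ; to∘from = λ { {+ suc i , + suc j} (_ , _ , eq) → cong (λ z → + suc i , + z)
      (quotient i j (ℤ.+-injective eq))
    ; {+ zero , _} (+<+ () , _) ; {+ suc i , + zero} (_ , +<+ () , _) }
  }
  where
  quotient : ∀ i j → suc i ℕ.* suc j ≡ n → n ℕ./ suc i ≡ suc j
  quotient i j refl = trans (cong (ℕ._/ suc i) (ℕ.*-comm (suc i) (suc j))) (m*n/n≡m (suc j) (suc i))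

∑∣≡Λ : ∀ n (f : (d : ℕ) .{{_ : NonZero d}} → ℤ) (g : ℤ → ℤ → ℤ) →
  (∀ i → f (suc i) ≡ g (+ suc i) (+ (n ℕ./ suc i))) → ∑∣ n f ≡ Λ g n
-- Both sums are empty at 0, so the divisor functions and the Lambert series agree as series,
-- constant terms included.
∑∣≡Λ zero      f g eq = refl
∑∣≡Λ n@(suc _) f g eq = ∑-bij (below n ∣ᴱ (λ i → suc i ∣? n)) (pairs n) (divisors≅pairs n)
    (λ {i} _ → eq i)

⟦^⟧ : ∀ {n} (e : Expr ℤ n) k ρ → ⟦ e ^ k ⟧ ρ ≡ ⟦ e ⟧ ρ ℤ.^ k
⟦^⟧ e zero    ρ = refl
⟦^⟧ e (suc k) ρ = cong (⟦ e ⟧ ρ ℤ.*_) (⟦^⟧ e k ρ)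

σ̃≐U : ∀ k → σ̃ k ≐ U k
σ̃≐U k n = ∑∣≡Λ n (λ d → -1ℤ ℤ.^ (d ℕ.+ n ℕ./ d) ℤ.* (+ d) ℤ.^ k)
    (λ d m → ⟦ u k ⟧ (d ∷ m ∷ sgn d ∷ sgn m ∷ [])) λ i → cong₂ ℤ._*_ (pow-+ (suc i) (n ℕ./ suc i))
  (sym (⟦^⟧ (Ι zero) k (+ suc i ∷ + (n ℕ./ suc i) ∷ sgn (+ suc i) ∷ sgn (+ (n ℕ./ suc i)) ∷ [])))

σ†≐W : ∀ k → σ† k ≐ W k
σ†≐W k n = ∑∣≡Λ n (λ d → -1ℤ ℤ.^ d ℤ.* (+ d) ℤ.^ k)
    (λ d m → ⟦ w k ⟧ (d ∷ m ∷ sgn d ∷ sgn m ∷ [])) λ i → cong (-1ℤ ℤ.^ suc i ℤ.*_)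
  (sym (⟦^⟧ (Ι zero) k (+ suc i ∷ + (n ℕ./ suc i) ∷ sgn (+ suc i) ∷ sgn (+ (n ℕ./ suc i)) ∷ [])))

-- Vanishing constant terms remove the two extreme terms of the Cauchy product, leaving the indices
-- strictly between 0 and `suc n`.
⋆-as-∑< : ∀ f g → f 0 ≡ 0ℤ → g 0 ≡ 0ℤ → ∀ n →
  (f ⋆ g) (suc n) ≡ ∑< (suc n) (λ m → f m ℤ.* g (suc n ∸ m))
⋆-as-∑< f g f₀ g₀ n = trans
    (cong (ℤ._+ (f ∘ suc ⋆ g) n) (trans (cong (ℤ._* g (suc n)) f₀) (ℤ.*-zeroˡ (g (suc n)))))
  (trans (ℤ.+-identityˡ ((f ∘ suc ⋆ g) n)) (trans (sym (go (f ∘ suc) n))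
    (cong sumℤ (sym (map-upTo (λ i → f (suc i) ℤ.* g (n ∸ i)) n)))))
  where
  go : ∀ f n → sumℤ (applyUpTo (λ j → f j ℤ.* g (n ∸ j)) n) ≡ (f ⋆ g) n
  go f zero    = sym (trans (cong (f 0 ℤ.*_) g₀) (ℤ.*-zeroʳ (f 0)))
  go f (suc n) = +-congˡ (f 0 ℤ.* g (suc n)) (go (f ∘ suc) n)

∑<-difference : ∀ {f g h k} → f 0 ≡ 0ℤ → g 0 ≡ 0ℤ → h 0 ≡ 0ℤ → k 0 ≡ 0ℤ → ∀ n →
  ∑< (suc n) (λ m → f m ℤ.* g (suc n ∸ m) ℤ.- h m ℤ.* k (suc n ∸ m)) ≡ (f ⋆ g ⊞ ⊟ (h ⋆ k)) (suc n)
∑<-difference {f} {g} {h} {k} f₀ g₀ h₀ k₀ n = trans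
  (sumℤ-map-- (λ i → f (suc i) ℤ.* g (n ∸ i)) (λ i → h (suc i) ℤ.* k (n ∸ i)) (upTo n))
  (cong₂ ℤ._-_ (sym (⋆-as-∑< f g f₀ g₀ n)) (sym (⋆-as-∑< h k h₀ k₀ n)))

module _ {a b c u v w : Series} (a≐ : a ≐ u) (b≐ : b ≐ v) (c≐ : c ≐ w)
  (a₀ : a 0 ≡ 0ℤ) (b₀ : b 0 ≡ 0ℤ) (c₀ : c 0 ≡ 0ℤ) (n : ℕ) where

  open ≡-Reasoning
  private N = suc n

  -- Both products get the coefficient 4 · 8 · 8 = 16 · 16 = 256, and all linear terms get -4 · 8 =
  -- -2 · 16 = -32. The constant 4 - 1 = 3 does not reach the positive index N.
  sixteen-coefficient :
    (const (+ 4) ⋆ ((const -1ℤ ⊞ const (+ 8) ⋆ u) ⋆ (const -1ℤ ⊞ const (+ 8) ⋆ w)) ⊞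
      ⊟ ((const 1ℤ ⊞ const (+ 16) ⋆ v) ⋆ (const 1ℤ ⊞ const (+ 16) ⋆ v))) N ≡
    ℤ.- + 32 ℤ.* (a N ℤ.+ b N ℤ.+ c N) ℤ.+
    + 256 ℤ.* ∑[1≤ m < N ] (a m ℤ.* c (N ∸ m) ℤ.- b m ℤ.* b (N ∸ m))
  sixteen-coefficient = begin
    (const (+ 4) ⋆ ((const -1ℤ ⊞ const (+ 8) ⋆ u) ⋆ (const -1ℤ ⊞ const (+ 8) ⋆ w)) ⊞
      ⊟ ((const 1ℤ ⊞ const (+ 16) ⋆ v) ⋆ (const 1ℤ ⊞ const (+ 16) ⋆ v))) N
      ≡⟨ solve 3 (λ u v w → con (+ 4) :*
          ((con -1ℤ :+ con (+ 8) :* u) :* (con -1ℤ :+ con (+ 8) :* w)) :+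
           :- ((con 1ℤ :+ con (+ 16) :* v) :* (con 1ℤ :+ con (+ 16) :* v)) :=
           con (+ 3) :+ (con (ℤ.- + 32) :* (u :+ v :+ w) :+ con (+ 256) :* (u :* w :+ :- (v :* v))))
           (λ _ → refl) u v w N ⟩
    0ℤ ℤ.+ ((const (ℤ.- + 32) ⋆ (u ⊞ v ⊞ w)) N ℤ.+ (const (+ 256) ⋆ (u ⋆ w ⊞ ⊟ (v ⋆ v))) N)
      ≡⟨ ℤ.+-identityˡ _ ⟩
    (const (ℤ.- + 32) ⋆ (u ⊞ v ⊞ w)) N ℤ.+ (const (+ 256) ⋆ (u ⋆ w ⊞ ⊟ (v ⋆ v))) N
      ≡⟨ cong₂ ℤ._+_ (const-⋆ (ℤ.- + 32) (u ⊞ v ⊞ w) N) (const-⋆ (+ 256) (u ⋆ w ⊞ ⊟ (v ⋆ v)) N) ⟩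
    ℤ.- + 32 ℤ.* (u N ℤ.+ v N ℤ.+ w N) ℤ.+ + 256 ℤ.* ((u ⋆ w) N ℤ.- (v ⋆ v) N)
      ≡⟨ cong₂ (λ i j → ℤ.- + 32 ℤ.* i ℤ.+ + 256 ℤ.* j)
           (sym (cong₂ ℤ._+_ (cong₂ ℤ._+_ (a≐ N) (b≐ N)) (c≐ N)))
           (trans (sym (cong₂ ℤ._-_ (⋆-cong a≐ c≐ N) (⋆-cong b≐ b≐ N)))
             (sym (∑<-difference {a} {c} {b} {b} a₀ c₀ b₀ b₀ n))) ⟩
    _ ∎

  -- Here 16 · 32 = 8 · 8 · 8 = 512 is the common coefficient of the products, and the constant is
  -- 17 - 8 = 9.
  twenty-four-coefficient :
    ((const 1ℤ ⊞ const (+ 16) ⋆ u) ⋆ (const (+ 17) ⊞ const (+ 32) ⋆ w) ⊞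
      ⊟ (const (+ 8) ⋆ ((const 1ℤ ⊞ const (ℤ.- + 8) ⋆ v) ⋆ (const 1ℤ ⊞ const (ℤ.- + 8) ⋆ v)))) N ≡
    + 16 ℤ.* (+ 17 ℤ.* a N ℤ.+ + 8 ℤ.* b N ℤ.+ + 2 ℤ.* c N) ℤ.+
    + 512 ℤ.* ∑[1≤ m < N ] (a m ℤ.* c (N ∸ m) ℤ.- b m ℤ.* b (N ∸ m))
  twenty-four-coefficient = begin
    ((const 1ℤ ⊞ const (+ 16) ⋆ u) ⋆ (const (+ 17) ⊞ const (+ 32) ⋆ w) ⊞
      ⊟ (const (+ 8) ⋆ ((const 1ℤ ⊞ const (ℤ.- + 8) ⋆ v) ⋆ (const 1ℤ ⊞ const (ℤ.- + 8) ⋆ v)))) N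
      ≡⟨ solve 3 (λ u v w → (con 1ℤ :+ con (+ 16) :* u) :* (con (+ 17) :+ con (+ 32) :* w) :+
           :- (con (+ 8) :* ((con 1ℤ :+ con (ℤ.- + 8) :* v) :* (con 1ℤ :+ con (ℤ.- + 8) :* v))) :=
           con (+ 9) :+ (con (+ 16) :* (con (+ 17) :* u :+ con (+ 8) :* v :+ con (+ 2) :* w) :+
             con (+ 512) :* (u :* w :+ :- (v :* v)))) (λ _ → refl) u v w N ⟩
    0ℤ ℤ.+ ((const (+ 16) ⋆ L) N ℤ.+ (const (+ 512) ⋆ (u ⋆ w ⊞ ⊟ (v ⋆ v))) N)
      ≡⟨ ℤ.+-identityˡ _ ⟩
    (const (+ 16) ⋆ L) N ℤ.+ (const (+ 512) ⋆ (u ⋆ w ⊞ ⊟ (v ⋆ v))) N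
      ≡⟨ cong₂ ℤ._+_ (const-⋆ (+ 16) L N) (const-⋆ (+ 512) (u ⋆ w ⊞ ⊟ (v ⋆ v)) N) ⟩
    + 16 ℤ.* L N ℤ.+ + 512 ℤ.* ((u ⋆ w) N ℤ.- (v ⋆ v) N)
      ≡⟨ cong₂ (λ i j → + 16 ℤ.* i ℤ.+ + 512 ℤ.* j)
           (sym (cong₂ ℤ._+_ (cong₂ ℤ._+_ (term (+ 17) a≐) (term (+ 8) b≐)) (term (+ 2) c≐)))
           (trans (sym (cong₂ ℤ._-_ (⋆-cong a≐ c≐ N) (⋆-cong b≐ b≐ N)))
             (sym (∑<-difference {a} {c} {b} {b} a₀ c₀ b₀ b₀ n))) ⟩
    _ ∎
    where
    L : Series
    L = const (+ 17) ⋆ u ⊞ const (+ 8) ⋆ v ⊞ const (+ 2) ⋆ w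
    term : ∀ {f g} c → f ≐ g → c ℤ.* f N ≡ (const c ⋆ g) N
    term {g = g} c f≐g = trans (cong (c ℤ.*_) (f≐g N)) (sym (const-⋆ c g N))

-- Stated for all s, so that r 16 and r 24 are never unfolded.
scaled-T : ∀ c s n → c ℤ.* (-1ℤ ℤ.^ n ℤ.* + r s n) ≡ (const c ⋆ T s) n
scaled-T c s n = sym (const-⋆ c (T s) n)

sixteen : ∀ n → + 3 ℤ.* (-1ℤ ℤ.^ suc n ℤ.* + r 16 (suc n)) ≡
  ℤ.- + 32 ℤ.* (σ̃ 1 (suc n) ℤ.+ σ̃ 3 (suc n) ℤ.+ σ̃ 5 (suc n)) ℤ.+
  + 256 ℤ.* ∑[1≤ m < suc n ] (σ̃ 1 m ℤ.* σ̃ 5 (suc n ∸ m) ℤ.- σ̃ 3 m ℤ.* σ̃ 3 (suc n ∸ m))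
sixteen n = trans (scaled-T (+ 3) 16 (suc n)) (trans (T₁₆ (suc n))
  (sixteen-coefficient (σ̃≐U 1) (σ̃≐U 3) (σ̃≐U 5) refl refl refl n))

twenty-four : ∀ n → + 9 ℤ.* (-1ℤ ℤ.^ suc n ℤ.* + r 24 (suc n)) ≡
  + 16 ℤ.* (+ 17 ℤ.* σ† 3 (suc n) ℤ.+ + 8 ℤ.* σ† 5 (suc n) ℤ.+ + 2 ℤ.* σ† 7 (suc n)) ℤ.+
  + 512 ℤ.* ∑[1≤ m < suc n ] (σ† 3 m ℤ.* σ† 7 (suc n ∸ m) ℤ.- σ† 5 m ℤ.* σ† 5 (suc n ∸ m))
twenty-four n = trans (scaled-T (+ 9) 24 (suc n)) (trans (T₂₄ (suc n))
  (twenty-four-coefficient (σ†≐W 3) (σ†≐W 5) (σ†≐W 7) refl refl refl n))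

-- Passage to rational coefficients

toℚᵘ-** : ∀ x y z → ℚ.toℚᵘ (x ℚ.* y ℚ.* z) ℚᵘ.≃ ℚ.toℚᵘ x ℚᵘ.* ℚ.toℚᵘ y ℚᵘ.* ℚ.toℚᵘ z
toℚᵘ-** x y z = ℚᵘ.≃-trans (ℚ.toℚᵘ-homo-* (x ℚ.* y) z) (ℚᵘ.*-congʳ (ℚ.toℚᵘ-homo-* x y))

-- Multiplication by s, whose square is 1, moves the sign to the other side. Over unnormalised
-- fractions the claim is an integer cross-multiplication, with the unreduced common denominator 3 ·
-- 3 = 9.
sixteen-ℚ : ∀ R s A B → s ℤ.* s ≡ 1ℤ → + 3 ℤ.* (s ℤ.* R) ≡ ℤ.- + 32 ℤ.* A ℤ.+ + 256 ℤ.* B →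
  fromℤ R ≡ (ℚ.- fromℤ s) ℚ.* (+ 32 / 3) ℚ.* fromℤ A ℚ.+ fromℤ s ℚ.* (+ 256 / 3) ℚ.* fromℤ B
sixteen-ℚ R s A B s² eq = ℚ.toℚᵘ-injective (begin
  mkℚᵘ R 0
    ≈⟨ *≡* cross-multiply ⟩
  (ℚᵘ.- mkℚᵘ s 0) ℚᵘ.* mkℚᵘ (+ 32) 2 ℚᵘ.* mkℚᵘ A 0 ℚᵘ.+ mkℚᵘ s 0 ℚᵘ.* mkℚᵘ (+ 256) 2 ℚᵘ.* mkℚᵘ B 0
    ≈⟨ ℚᵘ.≃-sym (ℚᵘ.≃-trans (ℚ.toℚᵘ-homo-+ x y) (ℚᵘ.+-cong
         (ℚᵘ.≃-trans (toℚᵘ-** (ℚ.- fromℤ s) (+ 32 / 3) (fromℤ A))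
             (ℚᵘ.*-congʳ (ℚᵘ.*-congʳ (ℚ.toℚᵘ-homo‿- (fromℤ s)))))
         (toℚᵘ-** (fromℤ s) (+ 256 / 3) (fromℤ B)))) ⟩
  ℚ.toℚᵘ (x ℚ.+ y) ∎)
  where
  open ℚᵘ.≃-Reasoning
  x y : ℚ
  x = (ℚ.- fromℤ s) ℚ.* (+ 32 / 3) ℚ.* fromℤ A
  y = fromℤ s ℚ.* (+ 256 / 3) ℚ.* fromℤ B
  left : ∀ s R → + 9 ℤ.* (s ℤ.* s) ℤ.* R ≡ + 3 ℤ.* s ℤ.* (+ 3 ℤ.* (s ℤ.* R))
  left = solve-∀
  right : ∀ s A B → + 3 ℤ.* s ℤ.* (ℤ.- + 32 ℤ.* A ℤ.+ + 256 ℤ.* B) ≡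
    ((ℤ.- s ℤ.* + 32 ℤ.* A) ℤ.* + 3 ℤ.+ (s ℤ.* + 256 ℤ.* B) ℤ.* + 3) ℤ.* 1ℤ
  right = solve-∀
  cross-multiply : R ℤ.* + 9 ≡
      ((ℤ.- s ℤ.* + 32 ℤ.* A) ℤ.* + 3 ℤ.+ (s ℤ.* + 256 ℤ.* B) ℤ.* + 3) ℤ.* 1ℤ
  cross-multiply = trans (ℤ.*-comm R (+ 9)) (trans (cong (λ i → + 9 ℤ.* i ℤ.* R) (sym s²))
    (trans (left s R) (trans (cong (+ 3 ℤ.* s ℤ.*_) eq) (right s A B))))

twenty-four-ℚ : ∀ R s A B → s ℤ.* s ≡ 1ℤ → + 9 ℤ.* (s ℤ.* R) ≡ + 16 ℤ.* A ℤ.+ + 512 ℤ.* B →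
  fromℤ R ≡ fromℤ s ℚ.* (+ 16 / 9) ℚ.* fromℤ A ℚ.+ fromℤ s ℚ.* (+ 512 / 9) ℚ.* fromℤ B
twenty-four-ℚ R s A B s² eq = ℚ.toℚᵘ-injective (begin
  mkℚᵘ R 0
    ≈⟨ *≡* cross-multiply ⟩
  mkℚᵘ s 0 ℚᵘ.* mkℚᵘ (+ 16) 8 ℚᵘ.* mkℚᵘ A 0 ℚᵘ.+ mkℚᵘ s 0 ℚᵘ.* mkℚᵘ (+ 512) 8 ℚᵘ.* mkℚᵘ B 0
    ≈⟨ ℚᵘ.≃-sym (ℚᵘ.≃-trans (ℚ.toℚᵘ-homo-+ x y) (ℚᵘ.+-cong
         (toℚᵘ-** (fromℤ s) (+ 16 / 9) (fromℤ A)) (toℚᵘ-** (fromℤ s) (+ 512 / 9) (fromℤ B)))) ⟩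
  ℚ.toℚᵘ (x ℚ.+ y) ∎)
  where
  open ℚᵘ.≃-Reasoning
  x y : ℚ
  x = fromℤ s ℚ.* (+ 16 / 9) ℚ.* fromℤ A
  y = fromℤ s ℚ.* (+ 512 / 9) ℚ.* fromℤ B
  left : ∀ s R → + 81 ℤ.* (s ℤ.* s) ℤ.* R ≡ + 9 ℤ.* s ℤ.* (+ 9 ℤ.* (s ℤ.* R))
  left = solve-∀
  right : ∀ s A B → + 9 ℤ.* s ℤ.* (+ 16 ℤ.* A ℤ.+ + 512 ℤ.* B) ≡
    ((s ℤ.* + 16 ℤ.* A) ℤ.* + 9 ℤ.+ (s ℤ.* + 512 ℤ.* B) ℤ.* + 9) ℤ.* 1ℤ
  right = solve-∀
  cross-multiply : R ℤ.* + 81 ≡ ((s ℤ.* + 16 ℤ.* A) ℤ.* + 9 ℤ.+ (s ℤ.* + 512 ℤ.* B) ℤ.* + 9) ℤ.* 1ℤ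
  cross-multiply = trans (ℤ.*-comm R (+ 81)) (trans (cong (λ i → + 81 ℤ.* i ℤ.* R) (sym s²))
    (trans (left s R) (trans (cong (+ 9 ℤ.* s ℤ.*_) eq) (right s A B))))

theorem1p7 : (n : ℕ) → .{{_ : NonZero n}} →
  (fromℤ (+ r 16 n) ≡
    (ℚ.- fromℤ (-1ℤ ℤ.^ n)) ℚ.* (+ 32 / 3) ℚ.* fromℤ (σ̃ 1 n ℤ.+ σ̃ 3 n ℤ.+ σ̃ 5 n)
    ℚ.+ fromℤ (-1ℤ ℤ.^ n) ℚ.* (+ 256 / 3) ℚ.*
      fromℤ (∑[1≤ m < n ] (σ̃ 1 m ℤ.* σ̃ 5 (n ∸ m) ℤ.- σ̃ 3 m ℤ.* σ̃ 3 (n ∸ m))))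
  ×
  (fromℤ (+ r 24 n) ≡
    fromℤ (-1ℤ ℤ.^ n) ℚ.* (+ 16 / 9) ℚ.*
      fromℤ (+ 17 ℤ.* σ† 3 n ℤ.+ + 8 ℤ.* σ† 5 n ℤ.+ + 2 ℤ.* σ† 7 n)
    ℚ.+ fromℤ (-1ℤ ℤ.^ n) ℚ.* (+ 512 / 9) ℚ.*
      fromℤ (∑[1≤ m < n ] (σ† 3 m ℤ.* σ† 7 (n ∸ m) ℤ.- σ† 5 m ℤ.* σ† 5 (n ∸ m))))
theorem1p7 (suc n) =
  sixteen-ℚ (+ r 16 (suc n)) (-1ℤ ℤ.^ suc n) (σ̃ 1 (suc n) ℤ.+ σ̃ 3 (suc n) ℤ.+ σ̃ 5 (suc n))
    (∑[1≤ m < suc n ] (σ̃ 1 m ℤ.* σ̃ 5 (suc n ∸ m) ℤ.- σ̃ 3 m ℤ.* σ̃ 3 (suc n ∸ m)))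
        (sgn² (+ suc n)) (sixteen n) ,
  twenty-four-ℚ (+ r 24 (suc n)) (-1ℤ ℤ.^ suc n)
      (+ 17 ℤ.* σ† 3 (suc n) ℤ.+ + 8 ℤ.* σ† 5 (suc n) ℤ.+ + 2 ℤ.* σ† 7 (suc n))
    (∑[1≤ m < suc n ] (σ† 3 m ℤ.* σ† 7 (suc n ∸ m) ℤ.- σ† 5 m ℤ.* σ† 5 (suc n ∸ m)))
        (sgn² (+ suc n)) (twenty-four n)
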